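{- The translations $N:L_{name}\to L_{lcc}$ and $N\circ W:L_{LR}\to L_{lcc}$ are fully abstract. That is, for all $s_1,s_2\in\mathbb{E}_{\mathcal L}$: $s_1\le_{name}s_2\iff N(s_1)\le_{lcc}N(s_2)$, and $s_1\le_{LR}s_2\iff N(W(s_1))\le_{lcc}N(W(s_2))$.
   Context: **Syntax.** Fix a set of data constructors partitioned into types; each constructor $c$ has an arity $\mathrm{ar}(c)\ge 0$; the constructors of type $T$ are enumerated as $c_{T,1},\dots,c_{T,|T|}$; there is a type Bool with nullary constructors True, False. Constructors occur only fully saturated. Expressions $\mathbb{E}_{\mathcal L}$: $s,t ::= x \mid (s\ t)\mid (\lambda x.s)\mid (\mathtt{letrec}\ x_1=s_1,\dots,x_n=s_n\ \mathtt{in}\ t)\mid (c\ s_1\dots s_{\mathrm{ar}(c)})\mid(\mathtt{seq}\ s\ t)\mid(\mathtt{case}_T\ s\ \mathtt{of}\ alts)$, where $alts$ has exactly one alternative $((c\ y_1\dots y_{\mathrm{ar}(c)})\to r)$ for each constructor $c$ of type $T$ (the $y_i$ are distinct variables bound in $r$). In letrec, $n\ge1$, the $x_i$ are distinct, the bindings are recursive (the scope of each $x_j$ is $s_1,\dots,s_n,t$) and are identified up to reordering. Expressions are taken up to $\alpha$-equivalence; bound variables are assumed distinct from each other and from free variables, and reductions rename implicitly if necessary. $Env$ denotes a group of letrec-bindings (possibly empty if other bindings are displayed). Contexts $C$ are expressions with one hole $[\cdot]$ in place of a subexpression; $\mathbb{C}_{\mathcal L}$ is the set of all of them. A value $v$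 is an abstraction or a constructor application. $\mathbb{E}_\lambda\subseteq\mathbb{E}_{\mathcal L}$ is the set of letrec-free expressions and $\mathbb{C}_\lambda$ the set of letrec-free contexts. **The calculus $L_{LR}$.** A normal-order step $\xrightarrow{LR}$ on $\mathbb{E}_{\mathcal L}$ is defined in two stages. *Stage 1 (labelling)* with labels $S,T,V,W$: start with $s^T$ and no other labels, and exhaustively apply (subterms may carry more labels than displayed; $a^{S\vee T}$ means label $S$ or $T$; the fail rules take precedence): - $(\mathtt{letrec}\ Env\ \mathtt{in}\ s)^T\leadsto(\mathtt{letrec}\ Env\ \mathtt{in}\ s^S)^V$; - $(s\ t)^{S\vee T}\leadsto(s^S\ t)^V$; $(\mathtt{seq}\ s\ t)^{S\vee T}\leadsto(\mathtt{seq}\ s^S\ t)^V$; $(\mathtt{case}_T\ s\ \mathtt{of}\ alts)^{S\vee T}\leadsto(\mathtt{case}_T\ s^S\ \mathtt{of}\ alts)^V$; - $\mathtt{letrec}\ x=s,Env\ \mathtt{in}\ C[x^S]\leadsto\mathtt{letrec}\ x=s^S,Env\ \mathtt{in}\ C[x^V]$; - $\mathtt{letrec}\ x=s^{V\vee W},y=C[x^S],Env\ \mathtt{in}\ t\leadsto$ fail; $\mathtt{letrec}\ x=C[x^S],Env\ \mathtt{in}\ s\leadsto$ fail; - $\mathtt{letrec}\ x=s,y=C[x^S],Env\ \mathtt{in}\ t\leadsto\mathtt{letrec}\ x=s^S,y=C[x^V],Env\ \mathtt{in}\ t$ if $C[x]\neq x$; - $\mathtt{letrec}\ x=s,y=x^S,Env\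 \mathtt{in}\ t\leadsto\mathtt{letrec}\ x=s^S,y=x^W,Env\ \mathtt{in}\ t$. *Stage 2*: if labelling does not fail, apply one of the following rules, if possible, where the displayed labels $S,V$ must match. $Ch$ denotes a chain $x_2=x_1,\dots,x_m=x_{m-1}$ (empty if $m=1$). - (lbeta) $C[((\lambda x.s)^S\ t)]\to C[\mathtt{letrec}\ x=t\ \mathtt{in}\ s]$. - (cp-in) $\mathtt{letrec}\ x_1=(\lambda x.s)^S,Ch,Env\ \mathtt{in}\ C[x_m^V]\to\mathtt{letrec}\ x_1=\lambda x.s,Ch,Env\ \mathtt{in}\ C[\lambda x.s]$. - (cp-e) $\mathtt{letrec}\ x_1=(\lambda x.s)^S,Ch,Env,y=C[x_m^V]\ \mathtt{in}\ t\to\mathtt{letrec}\ x_1=\lambda x.s,Ch,Env,y=C[\lambda x.s]\ \mathtt{in}\ t$. - (lapp) $C[((\mathtt{letrec}\ Env\ \mathtt{in}\ s)^S\ t)]\to C[\mathtt{letrec}\ Env\ \mathtt{in}\ (s\ t)]$; (lcase) $C[\mathtt{case}_T\ (\mathtt{letrec}\ Env\ \mathtt{in}\ s)^S\ \mathtt{of}\ alts]\to C[\mathtt{letrec}\ Env\ \mathtt{in}\ (\mathtt{case}_T\ s\ \mathtt{of}\ alts)]$; (lseq) $C[\mathtt{seq}\ (\mathtt{letrec}\ Env\ \mathtt{in}\ s)^S\ t]\to C[\mathtt{letrec}\ Env\ \mathtt{in}\ (\mathtt{seq}\ s\ t)]$. - (llet-in) $\mathtt{letrec}\ Env_1\ \mathtt{in}\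 (\mathtt{letrec}\ Env_2\ \mathtt{in}\ s)^S\to\mathtt{letrec}\ Env_1,Env_2\ \mathtt{in}\ s$; (llet-e) $\mathtt{letrec}\ Env_1,x=(\mathtt{letrec}\ Env_2\ \mathtt{in}\ s)^S\ \mathtt{in}\ t\to\mathtt{letrec}\ Env_1,Env_2,x=s\ \mathtt{in}\ t$. - (seq-c) $C[(\mathtt{seq}\ v^S\ s)]\to C[s]$ for a value $v$; (seq-in) $\mathtt{letrec}\ x_1=v^S,Ch,Env\ \mathtt{in}\ C[(\mathtt{seq}\ x_m^V\ s)]\to\mathtt{letrec}\ x_1=v,Ch,Env\ \mathtt{in}\ C[s]$ and (seq-e) $\mathtt{letrec}\ x_1=v^S,Ch,Env,y=C[(\mathtt{seq}\ x_m^V\ s)]\ \mathtt{in}\ t\to\mathtt{letrec}\ x_1=v,Ch,Env,y=C[s]\ \mathtt{in}\ t$, both for a constructor application $v$. - (case-c) $C[\mathtt{case}_T\ (c\ s_1\dots s_k)^S\ \mathtt{of}\dots((c\ y_1\dots y_k)\to t)\dots]\to C[\mathtt{letrec}\ y_1=s_1,\dots,y_k=s_k\ \mathtt{in}\ t]$ if $k=\mathrm{ar}(c)\ge1$, and $\to C[t]$ if $k=0$. - (case-in) $\mathtt{letrec}\ x_1=(c\ s_1\dots s_k)^S,Ch,Env\ \mathtt{in}\ C[\mathtt{case}_T\ x_m^V\ \mathtt{of}\dots((c\ z_1\dots z_k)\to t)\dots]\to\mathtt{letrec}\ x_1=(c\ y_1\dots y_k),y_1=s_1,\dots,y_k=s_k,Ch,Env\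 \mathtt{in}\ C[\mathtt{letrec}\ z_1=y_1,\dots,z_k=y_k\ \mathtt{in}\ t]$ with fresh $y_i$ if $k=\mathrm{ar}(c)\ge1$; if $k=0$ the result is $\mathtt{letrec}\ x_1=c,Ch,Env\ \mathtt{in}\ C[t]$. - (case-e) the same with the case-expression inside a binding: $\mathtt{letrec}\ x_1=(c\ s_1\dots s_k)^S,Ch,u=C[\mathtt{case}_T\ x_m^V\ \mathtt{of}\dots((c\ z_1\dots z_k)\to t)\dots],Env\ \mathtt{in}\ r\to\mathtt{letrec}\ x_1=(c\ y_1\dots y_k),y_1=s_1,\dots,y_k=s_k,Ch,u=C[\mathtt{letrec}\ z_1=y_1,\dots,z_k=y_k\ \mathtt{in}\ t],Env\ \mathtt{in}\ r$ with fresh $y_i$ if $k\ge1$; if $k=0$ the result is $\mathtt{letrec}\ x_1=c,Ch,u=C[t],Env\ \mathtt{in}\ r$. The $L_{LR}$-WHNFs (answers) are: abstractions; constructor applications; $\mathtt{letrec}\ Env\ \mathtt{in}\ v$ with $v$ a value; and $\mathtt{letrec}\ x_1=v,Ch,Env\ \mathtt{in}\ x_m$ with $v$ a constructor application. **The call-by-name calculus $L_{name}$** on $\mathbb{E}_{\mathcal L}$: let $L::=[\cdot]\mid\mathtt{letrec}\ Env\ \mathtt{in}\ L$ and $A::=[\cdot]\mid(A\ s)\mid(\mathtt{case}_T\ A\ \mathtt{of}\ alts)\mid(\mathtt{seq}\ A\ s)$; reduction contexts are $R=L[A]$. $\xrightarrow{name}$ is given by: (beta) $R[(\lambda x.s)\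 t]\to R[s[t/x]]$; (gcp) $L[\mathtt{letrec}\ Env,x=s\ \mathtt{in}\ R[x]]\to L[\mathtt{letrec}\ Env,x=s\ \mathtt{in}\ R[s]]$ (with $x$ the displayed bound variable); (lapp) $R[((\mathtt{letrec}\ Env\ \mathtt{in}\ s)\ t)]\to R[\mathtt{letrec}\ Env\ \mathtt{in}\ (s\ t)]$; (lcase) $R[\mathtt{case}_T\ (\mathtt{letrec}\ Env\ \mathtt{in}\ s)\ \mathtt{of}\ alts]\to R[\mathtt{letrec}\ Env\ \mathtt{in}\ (\mathtt{case}_T\ s\ \mathtt{of}\ alts)]$; (lseq) $R[\mathtt{seq}\ (\mathtt{letrec}\ Env\ \mathtt{in}\ s)\ t]\to R[\mathtt{letrec}\ Env\ \mathtt{in}\ (\mathtt{seq}\ s\ t)]$; (seq) $R[\mathtt{seq}\ v\ s]\to R[s]$ for a value $v$; (case) $R[\mathtt{case}_T\ (c\ s_1\dots s_k)\ \mathtt{of}\dots((c\ x_1\dots x_k)\to t)\dots]\to R[t[s_1/x_1,\dots,s_k/x_k]]$. The $L_{name}$-WHNFs (answers) are the expressions $L[v]$ with $v$ a value. **The calculus $L_{lcc}$**: expressions $\mathbb{E}_\lambda$, contexts $\mathbb{C}_\lambda$, answers are abstractions and constructor applications, reduction contexts $R::=[\cdot]\mid(R\ s)\mid\mathtt{case}_T\ R\ \mathtt{of}\ alts\mid\mathtt{seq}\ R\ s$, and $\xrightarrow{lcc}$: $R[((\lambda x.s)\ t)]\to R[s[t/x]]$; $R[\mathtt{case}_T\ (c\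 s_1\dots s_k)\ \mathtt{of}\dots((c\ x_1\dots x_k)\to t)\dots]\to R[t[s_1/x_1,\dots,s_k/x_k]]$; $R[\mathtt{seq}\ v\ s]\to R[s]$ for a value $v$. **Contextual preorders.** For $D\in\{LR,name,lcc\}$, $s\downarrow_D$ means $s\xrightarrow{D,*}v$ for some answer $v$ of the calculus, and $s\le_Dt$ iff for all contexts $C$ of the calculus ($\mathbb{C}_{\mathcal L}$ for $LR$ and $name$; $\mathbb{C}_\lambda$ for $lcc$): $C[s]\downarrow_D\Rightarrow C[t]\downarrow_D$. **Translations.** $W:L_{LR}\to L_{name}$ is the identity on expressions and contexts. $N:\mathbb{E}_{\mathcal L}\to\mathbb{E}_\lambda$ is homomorphic on all constructs other than letrec ($N(x)=x$, $N(s\ t)=(N(s)\ N(t))$, $N(\lambda x.s)=\lambda x.N(s)$, etc.), and $N(\mathtt{letrec}\ x_1=s_1,\dots,x_n=s_n\ \mathtt{in}\ t)=(\lambda x_1'.\cdots\lambda x_n'.(\lambda x_1.\cdots\lambda x_n.N(t))\ U_1\dots U_n)\ X_1'\dots X_n'$ where $x_1',\dots,x_n'$ are fresh variables, $U_i=x_i'\ x_1'\dots x_n'$, $X_i'=\lambda x_1.\cdots\lambda x_n.F_i\ (x_1\ x_1\dots x_n)\dots(x_n\ x_1\dots x_n)$ and $F_i=\lambda x_1.\cdots\lambda x_n.N(s_i)$. On contexts, $N([\cdot])=[\cdot]$. -}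

module Defs where

open import Data.Empty using (⊥)
open import Data.Fin using (Fin; zero; suc; _↑ˡ_; _↑ʳ_; splitAt; lift)
open import Data.List using (List; []; _∷_; length; lookup)
open import Data.Maybe using (Maybe; just; nothing)
open import Data.Nat using (ℕ; zero; suc; _+_)
open import Data.Product using (∃; _×_; _,_)
open import Data.Sum using ([_,_]′)
open import Data.Unit using (⊤; tt)
open import Data.Vec as Vec using (Vec; []; _∷_; _++_; tabulate; _[_]%=_; _[_]≔_)
open import Function using (_∘_; id)
open import Function.Bundles using (_↣_; Injection)
open import Relation.Binary.Construct.Closure.ReflexiveTransitive using (Star)
open import Relation.Binary.PropositionalEquality using (_≡_; _≢_)
open import Relation.Nullary using (¬_)

-- A type is given by the list of the arities of its constructors.
record Signature : Set₁ where
  field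
    Type         : Set
    arities      : Type → List ℕ
    nonempty     : ∀ τ → arities τ ≢ []
    bool         : Type
    bool-arities : arities bool ≡ 0 ∷ 0 ∷ []     -- True, False

data Label : Set where
  S T V W : Label

-- One grammar for three languages: 𝓛 are the expressions with letrec, Λ the
-- letrec-free ones, and 𝓛ˡ those of 𝓛 where every subexpression may carry a
-- label.
data Lang : Set where
  𝓛 𝓛ˡ Λ : Lang

Ann : Lang → Set
Ann 𝓛  = ⊤
Ann 𝓛ˡ = Maybe Label
Ann Λ  = ⊤

unlabelled : ∀ {g} → Ann g
unlabelled {𝓛}  = tt
unlabelled {𝓛ˡ} = nothing
unlabelled {Λ}  = tt

HasLetrec : Lang → Set
HasLetrec 𝓛  = ⊤
HasLetrec 𝓛ˡ = ⊤
HasLetrec Λ  = ⊥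

-- Scope n extended by two consecutive groups of p and q letrec-bindings: the
-- groups are merged into one, old embeds the variables that were already
-- visible under the first group, new those visible under both.
old : ∀ {p q n} → Fin (p + n) → Fin ((p + q) + n)
old {p} {q} {n} = [ (λ i → (i ↑ˡ q) ↑ˡ n) , (λ j → (p + q) ↑ʳ j) ]′ ∘ splitAt p

new : ∀ {p q n} → Fin (q + (p + n)) → Fin ((p + q) + n)
new {p} {q} {n} = [ (λ i → (p ↑ʳ i) ↑ˡ n) , old {p} {q} {n} ]′ ∘ splitAt q

module Calculus (Sig : Signature) where
  open Signature Sig public

  Con : Type → Set
  Con τ = Fin (length (arities τ))

  ar : (τ : Type) → Con τ → ℕ
  ar τ c = lookup (arities τ) c

  -- α-equivalence classes, as well-scoped de Bruijn terms over n free
  -- variables.  A binder of k variables turns scope n into k + n, where i ↑ˡ n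
  -- is the i-th bound variable and k ↑ʳ j is the variable j from outside.
  mutual
    data Exp (g : Lang) (n : ℕ) : Set where
      var    : {l : Ann g} → Fin n → Exp g n
      app    : {l : Ann g} → Exp g n → Exp g n → Exp g n
      lam    : {l : Ann g} → Exp g (suc n) → Exp g n
      letrec : {h : HasLetrec g} {l : Ann g} {p : ℕ} →
               Vec (Exp g (suc p + n)) (suc p) → Exp g (suc p + n) → Exp g n
      con    : {l : Ann g} (τ : Type) (c : Con τ) → Vec (Exp g n) (ar τ c) → Exp g n
      seq    : {l : Ann g} → Exp g n → Exp g n → Exp g n
      case   : {l : Ann g} (τ : Type) → Exp g n → Alts g n (arities τ) → Exp g n

    data Alts (g : Lang) (n : ℕ) : List ℕ → Set where
      []  : Alts g n []
      _∷_ : ∀ {k ks} → Exp g (k + n) → Alts g n ks → Alts g n (k ∷ ks)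

  LExp : ℕ → Set
  LExp = Exp 𝓛ˡ

  alternative : ∀ {g n ks} → Alts g n ks → (c : Fin (length ks)) → Exp g (lookup ks c + n)
  alternative (r ∷ rs) zero    = r
  alternative (r ∷ rs) (suc c) = alternative rs c

  data Value {g : Lang} {n : ℕ} : Exp g n → Set where
    lam : ∀ {l} (s : Exp g (suc n)) → Value (lam {l = l} s)
    con : ∀ {l} τ (c : Con τ) (ss : Vec (Exp g n) (ar τ c)) → Value (con {l = l} τ c ss)

  mutual
    rename : ∀ {g m n} → (Fin m → Fin n) → Exp g m → Exp g n
    rename ρ (var {l} x)            = var {l = l} (ρ x)
    rename ρ (app {l} s t)          = app {l = l} (rename ρ s) (rename ρ t)
    rename ρ (lam {l} s)            = lam {l = l} (rename (lift 1 ρ) s)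
    rename ρ (letrec {h} {l} {p} E t) =
      letrec {h = h} {l = l} (rename* (lift (suc p) ρ) E) (rename (lift (suc p) ρ) t)
    rename ρ (con {l} τ c ss)       = con {l = l} τ c (rename* ρ ss)
    rename ρ (seq {l} s t)          = seq {l = l} (rename ρ s) (rename ρ t)
    rename ρ (case {l} τ s rs)      = case {l = l} τ (rename ρ s) (renameᵃ ρ rs)

    rename* : ∀ {g m n k} → (Fin m → Fin n) → Vec (Exp g m) k → Vec (Exp g n) k
    rename* ρ []       = []
    rename* ρ (s ∷ ss) = rename ρ s ∷ rename* ρ ss

    renameᵃ : ∀ {g m n ks} → (Fin m → Fin n) → Alts g m ks → Alts g n ks
    renameᵃ ρ []               = []
    renameᵃ ρ (_∷_ {k = k} r rs) = rename (lift k ρ) r ∷ renameᵃ ρ rs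

  weaken : ∀ {g n} k → Exp g n → Exp g (k + n)
  weaken k = rename (k ↑ʳ_)

  weaken* : ∀ {g n j} k → Vec (Exp g n) j → Vec (Exp g (k + n)) j
  weaken* k = rename* (k ↑ʳ_)

  weakenᵃ : ∀ {g n ks} k → Alts g n ks → Alts g (k + n) ks
  weakenᵃ k = renameᵃ (k ↑ʳ_)

  lifts : ∀ {g m n} k → (Fin m → Exp g n) → Fin (k + m) → Exp g (k + n)
  lifts zero    σ x       = σ x
  lifts (suc k) σ zero    = var {l = unlabelled} zero
  lifts (suc k) σ (suc x) = weaken 1 (lifts k σ x)

  mutual
    subst : ∀ {g m n} → (Fin m → Exp g n) → Exp g m → Exp g n
    subst σ (var x)                 = σ x
    subst σ (app {l} s t)           = app {l = l} (subst σ s) (subst σ t)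
    subst σ (lam {l} s)             = lam {l = l} (subst (lifts 1 σ) s)
    subst σ (letrec {h} {l} {p} E t) =
      letrec {h = h} {l = l} (subst* (lifts (suc p) σ) E) (subst (lifts (suc p) σ) t)
    subst σ (con {l} τ c ss)        = con {l = l} τ c (subst* σ ss)
    subst σ (seq {l} s t)           = seq {l = l} (subst σ s) (subst σ t)
    subst σ (case {l} τ s rs)       = case {l = l} τ (subst σ s) (substᵃ σ rs)

    subst* : ∀ {g m n k} → (Fin m → Exp g n) → Vec (Exp g m) k → Vec (Exp g n) k
    subst* σ []       = []
    subst* σ (s ∷ ss) = subst σ s ∷ subst* σ ss

    substᵃ : ∀ {g m n ks} → (Fin m → Exp g n) → Alts g m ks → Alts g n ks
    substᵃ σ []                 = []
    substᵃ σ (_∷_ {k = k} r rs) = subst (lifts k σ) r ∷ substᵃ σ rs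

  infix 25 _[_/x]
  _[_/x] : ∀ {g n k} → Exp g (k + n) → Vec (Exp g n) k → Exp g n
  _[_/x] {k = k} t ss = subst ([ Vec.lookup ss , (λ j → var {l = unlabelled} j) ]′ ∘ splitAt k) t

  mutual
    convert : ∀ {g g′ n} → (HasLetrec g → HasLetrec g′) → (Ann g → Ann g′) →
              Exp g n → Exp g′ n
    convert f a (var {l} x)          = var {l = a l} x
    convert f a (app {l} s t)        = app {l = a l} (convert f a s) (convert f a t)
    convert f a (lam {l} s)          = lam {l = a l} (convert f a s)
    convert f a (letrec {h} {l} E t) = letrec {h = f h} {l = a l} (convert* f a E) (convert f a t)
    convert f a (con {l} τ c ss)     = con {l = a l} τ c (convert* f a ss)
    convert f a (seq {l} s t)        = seq {l = a l} (convert f a s) (convert f a t)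
    convert f a (case {l} τ s rs)    = case {l = a l} τ (convert f a s) (convertᵃ f a rs)

    convert* : ∀ {g g′ n k} → (HasLetrec g → HasLetrec g′) → (Ann g → Ann g′) →
               Vec (Exp g n) k → Vec (Exp g′ n) k
    convert* f a []       = []
    convert* f a (s ∷ ss) = convert f a s ∷ convert* f a ss

    convertᵃ : ∀ {g g′ n ks} → (HasLetrec g → HasLetrec g′) → (Ann g → Ann g′) →
               Alts g n ks → Alts g′ n ks
    convertᵃ f a []       = []
    convertᵃ f a (r ∷ rs) = convert f a r ∷ convertᵃ f a rs

  withoutLabels : ∀ {n} → Exp 𝓛 n → LExp n
  withoutLabels = convert id (λ _ → nothing)

  erase : ∀ {n} → LExp n → Exp 𝓛 n
  erase = convert id (λ _ → tt)

  -- Ctx g k n: contexts over n free variables whose hole lies in scope k.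
  mutual
    data Ctx (g : Lang) (k : ℕ) : ℕ → Set where
      hole    : Ctx g k k
      appˡ    : ∀ {n} {l : Ann g} → Ctx g k n → Exp g n → Ctx g k n
      appʳ    : ∀ {n} {l : Ann g} → Exp g n → Ctx g k n → Ctx g k n
      lam     : ∀ {n} {l : Ann g} → Ctx g k (suc n) → Ctx g k n
      letrecᵉ : ∀ {n} {h : HasLetrec g} {l : Ann g} {p : ℕ} →
                Ctxs g k (suc p + n) (suc p) → Exp g (suc p + n) → Ctx g k n
      letrecⁱ : ∀ {n} {h : HasLetrec g} {l : Ann g} {p : ℕ} →
                Vec (Exp g (suc p + n)) (suc p) → Ctx g k (suc p + n) → Ctx g k n
      con     : ∀ {n} {l : Ann g} (τ : Type) (c : Con τ) → Ctxs g k n (ar τ c) → Ctx g k n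
      seqˡ    : ∀ {n} {l : Ann g} → Ctx g k n → Exp g n → Ctx g k n
      seqʳ    : ∀ {n} {l : Ann g} → Exp g n → Ctx g k n → Ctx g k n
      caseˢ   : ∀ {n} {l : Ann g} (τ : Type) → Ctx g k n → Alts g n (arities τ) → Ctx g k n
      caseᵃ   : ∀ {n} {l : Ann g} (τ : Type) → Exp g n → AltsCtx g k n (arities τ) → Ctx g k n

    data Ctxs (g : Lang) (k n : ℕ) : ℕ → Set where
      here  : ∀ {j} → Ctx g k n → Vec (Exp g n) j → Ctxs g k n (suc j)
      there : ∀ {j} → Exp g n → Ctxs g k n j → Ctxs g k n (suc j)

    data AltsCtx (g : Lang) (k n : ℕ) : List ℕ → Set where
      here  : ∀ {j js} → Ctx g k (j + n) → Alts g n js → AltsCtx g k n (j ∷ js)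
      there : ∀ {j js} → Exp g (j + n) → AltsCtx g k n js → AltsCtx g k n (j ∷ js)

  mutual
    plug : ∀ {g k n} → Ctx g k n → Exp g k → Exp g n
    plug hole                  u = u
    plug (appˡ {l = l} C t)    u = app {l = l} (plug C u) t
    plug (appʳ {l = l} s C)    u = app {l = l} s (plug C u)
    plug (lam {l = l} C)       u = lam {l = l} (plug C u)
    plug (letrecᵉ {h = h} {l = l} C t) u = letrec {h = h} {l = l} (plug* C u) t
    plug (letrecⁱ {h = h} {l = l} E C) u = letrec {h = h} {l = l} E (plug C u)
    plug (con {l = l} τ c C)   u = con {l = l} τ c (plug* C u)
    plug (seqˡ {l = l} C t)    u = seq {l = l} (plug C u) t
    plug (seqʳ {l = l} s C)    u = seq {l = l} s (plug C u)
    plug (caseˢ {l = l} τ C rs) u = case {l = l} τ (plug C u) rs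
    plug (caseᵃ {l = l} τ s C) u = case {l = l} τ s (plugᵃ C u)

    plug* : ∀ {g k n j} → Ctxs g k n j → Exp g k → Vec (Exp g n) j
    plug* (here C ss) u = plug C u ∷ ss
    plug* (there s C) u = s ∷ plug* C u

    plugᵃ : ∀ {g k n js} → AltsCtx g k n js → Exp g k → Alts g n js
    plugᵃ (here C rs) u = plug C u ∷ rs
    plugᵃ (there r C) u = r ∷ plugᵃ C u

  -- The position at the hole of a variable from outside the context.
  mutual
    wk : ∀ {g k n} → Ctx g k n → Fin n → Fin k
    wk hole              = id
    wk (appˡ C t)        = wk C
    wk (appʳ s C)        = wk C
    wk (lam C)           = wk C ∘ suc
    wk (letrecᵉ {p = p} C t) = wk* C ∘ (suc p ↑ʳ_)
    wk (letrecⁱ {p = p} E C) = wk C ∘ (suc p ↑ʳ_)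
    wk (con τ c C)       = wk* C
    wk (seqˡ C t)        = wk C
    wk (seqʳ s C)        = wk C
    wk (caseˢ τ C rs)    = wk C
    wk (caseᵃ τ s C)     = wkᵃ C

    wk* : ∀ {g k n j} → Ctxs g k n j → Fin n → Fin k
    wk* (here C ss) = wk C
    wk* (there s C) = wk* C

    wkᵃ : ∀ {g k n js} → AltsCtx g k n js → Fin n → Fin k
    wkᵃ (here {j = j} C rs) = wk C ∘ (j ↑ʳ_)
    wkᵃ (there r C)         = wkᵃ C

  -- Renaming a context along ρ : Fin n → Fin n′ moves its hole from scope k to
  -- scope holeScope C n′, along holeRenaming C ρ.
  mutual
    holeScope : ∀ {g k n} → Ctx g k n → ℕ → ℕ
    holeScope hole              n′ = n′
    holeScope (appˡ C t)        n′ = holeScope C n′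
    holeScope (appʳ s C)        n′ = holeScope C n′
    holeScope (lam C)           n′ = holeScope C (suc n′)
    holeScope (letrecᵉ {p = p} C t) n′ = holeScope* C (suc p + n′)
    holeScope (letrecⁱ {p = p} E C) n′ = holeScope C (suc p + n′)
    holeScope (con τ c C)       n′ = holeScope* C n′
    holeScope (seqˡ C t)        n′ = holeScope C n′
    holeScope (seqʳ s C)        n′ = holeScope C n′
    holeScope (caseˢ τ C rs)    n′ = holeScope C n′
    holeScope (caseᵃ τ s C)     n′ = holeScopeᵃ C n′

    holeScope* : ∀ {g k n j} → Ctxs g k n j → ℕ → ℕ
    holeScope* (here C ss) n′ = holeScope C n′
    holeScope* (there s C) n′ = holeScope* C n′

    holeScopeᵃ : ∀ {g k n js} → AltsCtx g k n js → ℕ → ℕ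
    holeScopeᵃ (here {j = j} C rs) n′ = holeScope C (j + n′)
    holeScopeᵃ (there r C)         n′ = holeScopeᵃ C n′

  mutual
    holeRenaming : ∀ {g k n n′} (C : Ctx g k n) → (Fin n → Fin n′) →
                   Fin k → Fin (holeScope C n′)
    holeRenaming hole              ρ = ρ
    holeRenaming (appˡ C t)        ρ = holeRenaming C ρ
    holeRenaming (appʳ s C)        ρ = holeRenaming C ρ
    holeRenaming (lam C)           ρ = holeRenaming C (lift 1 ρ)
    holeRenaming (letrecᵉ {p = p} C t) ρ = holeRenaming* C (lift (suc p) ρ)
    holeRenaming (letrecⁱ {p = p} E C) ρ = holeRenaming C (lift (suc p) ρ)
    holeRenaming (con τ c C)       ρ = holeRenaming* C ρ
    holeRenaming (seqˡ C t)        ρ = holeRenaming C ρ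
    holeRenaming (seqʳ s C)        ρ = holeRenaming C ρ
    holeRenaming (caseˢ τ C rs)    ρ = holeRenaming C ρ
    holeRenaming (caseᵃ τ s C)     ρ = holeRenamingᵃ C ρ

    holeRenaming* : ∀ {g k n n′ j} (C : Ctxs g k n j) → (Fin n → Fin n′) →
                    Fin k → Fin (holeScope* C n′)
    holeRenaming* (here C ss) ρ = holeRenaming C ρ
    holeRenaming* (there s C) ρ = holeRenaming* C ρ

    holeRenamingᵃ : ∀ {g k n n′ js} (C : AltsCtx g k n js) → (Fin n → Fin n′) →
                    Fin k → Fin (holeScopeᵃ C n′)
    holeRenamingᵃ (here {j = j} C rs) ρ = holeRenaming C (lift j ρ)
    holeRenamingᵃ (there r C)         ρ = holeRenamingᵃ C ρ

  mutual
    renameᶜ : ∀ {g k n n′} → (Fin n → Fin n′) → (C : Ctx g k n) → Ctx g (holeScope C n′) n′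
    renameᶜ ρ hole                  = hole
    renameᶜ ρ (appˡ {l = l} C t)    = appˡ {l = l} (renameᶜ ρ C) (rename ρ t)
    renameᶜ ρ (appʳ {l = l} s C)    = appʳ {l = l} (rename ρ s) (renameᶜ ρ C)
    renameᶜ ρ (lam {l = l} C)       = lam {l = l} (renameᶜ (lift 1 ρ) C)
    renameᶜ ρ (letrecᵉ {h = h} {l = l} {p = p} C t) =
      letrecᵉ {h = h} {l = l} (renameᶜ* (lift (suc p) ρ) C) (rename (lift (suc p) ρ) t)
    renameᶜ ρ (letrecⁱ {h = h} {l = l} {p = p} E C) =
      letrecⁱ {h = h} {l = l} (rename* (lift (suc p) ρ) E) (renameᶜ (lift (suc p) ρ) C)
    renameᶜ ρ (con {l = l} τ c C)   = con {l = l} τ c (renameᶜ* ρ C)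
    renameᶜ ρ (seqˡ {l = l} C t)    = seqˡ {l = l} (renameᶜ ρ C) (rename ρ t)
    renameᶜ ρ (seqʳ {l = l} s C)    = seqʳ {l = l} (rename ρ s) (renameᶜ ρ C)
    renameᶜ ρ (caseˢ {l = l} τ C rs) = caseˢ {l = l} τ (renameᶜ ρ C) (renameᵃ ρ rs)
    renameᶜ ρ (caseᵃ {l = l} τ s C) = caseᵃ {l = l} τ (rename ρ s) (renameᶜᵃ ρ C)

    renameᶜ* : ∀ {g k n n′ j} → (Fin n → Fin n′) → (C : Ctxs g k n j) →
               Ctxs g (holeScope* C n′) n′ j
    renameᶜ* ρ (here C ss) = here (renameᶜ ρ C) (rename* ρ ss)
    renameᶜ* ρ (there s C) = there (rename ρ s) (renameᶜ* ρ C)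

    renameᶜᵃ : ∀ {g k n n′ js} → (Fin n → Fin n′) → (C : AltsCtx g k n js) →
               AltsCtx g (holeScopeᵃ C n′) n′ js
    renameᶜᵃ ρ (here {j = j} C rs) = here (renameᶜ (lift j ρ) C) (renameᵃ ρ rs)
    renameᶜᵃ ρ (there {j = j} r C) = there (rename (lift j ρ) r) (renameᶜᵃ ρ C)

  Converges : ∀ {g} → (∀ {n} → Exp g n → Exp g n → Set) → (∀ {n} → Exp g n → Set) →
              ∀ {n} → Exp g n → Set
  Converges _⟶_ Answer s = ∃ λ v → Star _⟶_ s v × Answer v

  -- Plugging into a context with named variables lets it capture some of the m
  -- free variables of s and t, leaves the others free, and may put binders of
  -- unrelated names above the hole.  The injection ρ records to which variable
  -- in scope at the hole each of the m (distinct) names refers.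
  ContextualPreorder : ∀ {g} → (∀ {n} → Exp g n → Set) → ∀ {m} → Exp g m → Exp g m → Set
  ContextualPreorder {g} _↓ {m} s t =
    ∀ {k n} (C : Ctx g k n) (ρ : Fin m ↣ Fin k) →
    plug C (rename (Injection.to ρ) s) ↓ → plug C (rename (Injection.to ρ) t) ↓

  -- Chain E x₁ xₘ: E contains x₂ = x₁, …, xₘ = xₘ₋₁, with any labels on the right-hand sides.
  data Chain {g p n} (E : Vec (Exp g (p + n)) p) (x₁ : Fin p) : Fin p → Set where
    []  : Chain E x₁ x₁
    _▸_ : ∀ {x y l} → Chain E x₁ x → Vec.lookup E y ≡ var {l = l} (x ↑ˡ n) → Chain E x₁ y

  infix 30 _^_
  _^_ : ∀ {n} → LExp n → Label → LExp n
  var x ^ l      = var {l = just l} x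
  app s t ^ l    = app {l = just l} s t
  lam s ^ l      = lam {l = just l} s
  letrec E t ^ l = letrec {l = just l} E t
  con τ c ss ^ l = con {l = just l} τ c ss
  seq s t ^ l    = seq {l = just l} s t
  case τ s rs ^ l = case {l = just l} τ s rs

  labelOf : ∀ {n} → LExp n → Maybe Label
  labelOf (var {l} x)       = l
  labelOf (app {l} s t)     = l
  labelOf (lam {l} s)       = l
  labelOf (letrec {l = l} E t) = l
  labelOf (con {l} τ c ss)  = l
  labelOf (seq {l} s t)     = l
  labelOf (case {l} τ s rs) = l

  data S∨T : Maybe Label → Set where
    S : S∨T (just S)
    T : S∨T (just T)

  data V∨W : Maybe Label → Set where
    V : V∨W (just V)
    W : V∨W (just W)

  -- The occurrence x^l, inside C, of the variable x of an enclosing letrec.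
  occ : ∀ {k p n} → Ctx 𝓛ˡ k (p + n) → Fin p → Label → LExp k
  occ {n = n} C x l = var {l = just l} (wk C (x ↑ˡ n))

  data FailsAt {n} : LExp n → Set where
    visited : ∀ {l k p t} {E : Vec (LExp (suc p + n)) (suc p)} {x y} {C : Ctx 𝓛ˡ k (suc p + n)} →
              x ≢ y → V∨W (labelOf (Vec.lookup E x)) →
              Vec.lookup E y ≡ plug C (occ C x S) →
              FailsAt (letrec {l = l} E t)
    self    : ∀ {l k p t} {E : Vec (LExp (suc p + n)) (suc p)} {x} {C : Ctx 𝓛ˡ k (suc p + n)} →
              Vec.lookup E x ≡ plug C (occ C x S) →
              FailsAt (letrec {l = l} E t)

  data Fails {n} : LExp n → Set where
    at : ∀ {k} (C : Ctx 𝓛ˡ k n) {a} → FailsAt a → Fails (plug C a)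

  infix 4 _⇝₀_ _⇝_
  data _⇝₀_ {n} : LExp n → LExp n → Set where
    letrecᵀ : ∀ {p} {E : Vec (LExp (suc p + n)) (suc p)} {s} →
              letrec {l = just T} E s ⇝₀ letrec {l = just V} E (s ^ S)
    app     : ∀ {l s t} → S∨T l → app {l = l} s t ⇝₀ app {l = just V} (s ^ S) t
    seq     : ∀ {l s t} → S∨T l → seq {l = l} s t ⇝₀ seq {l = just V} (s ^ S) t
    case    : ∀ {l τ s rs} → S∨T l → case {l = l} τ s rs ⇝₀ case {l = just V} τ (s ^ S) rs
    var-in  : ∀ {l k p} {E : Vec (LExp (suc p + n)) (suc p)} {x} {C : Ctx 𝓛ˡ k (suc p + n)} →
              letrec {l = l} E (plug C (occ C x S)) ⇝₀
              letrec {l = l} (E [ x ]%= (_^ S)) (plug C (occ C x V))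
    var-e   : ∀ {l k p t} {E : Vec (LExp (suc p + n)) (suc p)} {x y} {C : Ctx 𝓛ˡ k (suc p + n)} →
              x ≢ y → Vec.lookup E y ≡ plug C (occ C x S) →
              plug C (occ C x S) ≢ occ hole x S →
              letrec {l = l} E t ⇝₀
              letrec {l = l} (E [ x ]%= (_^ S) [ y ]≔ plug C (occ C x V)) t
    var-var : ∀ {l p t} {E : Vec (LExp (suc p + n)) (suc p)} {x y} →
              x ≢ y → Vec.lookup E y ≡ occ hole x S →
              letrec {l = l} E t ⇝₀
              letrec {l = l} (E [ x ]%= (_^ S) [ y ]≔ occ hole x W) t

  -- The labelling rules apply to any subexpression; the fail rules take precedence.
  data _⇝_ {n} : LExp n → LExp n → Set where
    at : ∀ {k} (C : Ctx 𝓛ˡ k n) {a b} → ¬ Fails (plug C a) → a ⇝₀ b → plug C a ⇝ plug C b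

  -- letrec y₁ = s₁, …, yₖ = sₖ in t, where the yᵢ do not occur in the sᵢ; just t if k = 0.
  bind : ∀ {n k} → Vec (LExp n) k → LExp (k + n) → LExp n
  bind []               t = t
  bind {k = k} (s ∷ ss) t = letrec {l = nothing} (weaken* k (s ∷ ss)) t

  -- case-in and case-e add the bindings y₁ = s₁, …, yₖ = sₖ to the letrec:
  -- caseEnv is x₁ = c y₁ … yₖ, y₁ = s₁, …, yₖ = sₖ, Env, and caseBody is
  -- C[letrec z₁ = y₁, …, zₖ = yₖ in t].  For k = 0 both leave the letrec with
  -- its bindings, and caseBody is C[t].
  caseEnv : ∀ {p n} → Vec (LExp (suc p + n)) (suc p) → Fin (suc p) →
            (τ : Type) (c : Con τ) → Vec (LExp (suc p + n)) (ar τ c) →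
            Vec (LExp ((suc p + ar τ c) + n)) (suc p + ar τ c)
  caseEnv {p} {n} E x₁ τ c ss =
    (rename* (old {suc p}) E [ x₁ ]≔
       con {l = nothing} τ c (tabulate λ i → var {l = nothing} ((suc p ↑ʳ i) ↑ˡ n)))
    ++ rename* (old {suc p}) ss

  caseBody : ∀ {k p q n} → Ctx 𝓛ˡ k (suc p + n) → LExp (q + k) → LExp ((suc p + q) + n)
  caseBody {p = p} {q} {n} C t =
    plug C′ (bind (tabulate λ i → var {l = nothing} (wk C′ ((suc p ↑ʳ i) ↑ˡ n)))
                  (rename (lift q (holeRenaming C ρ)) t))
    where
    ρ  = old {suc p} {q} {n}
    C′ = renameᶜ ρ C

  infix 4 _⇒_
  data _⇒_ {n} : LExp n → LExp n → Set where
    lbeta   : ∀ {k} (C : Ctx 𝓛ˡ k n) {l s t} →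
              plug C (app {l = l} (lam {l = just S} s) t) ⇒ plug C (bind (t ∷ []) s)

    cp-in   : ∀ {l l′ k p} {E : Vec (LExp (suc p + n)) (suc p)} {x₁ xₘ s}
              (C : Ctx 𝓛ˡ k (suc p + n)) →
              Vec.lookup E x₁ ≡ lam {l = just S} s → Chain E x₁ xₘ →
              letrec {l = l} E (plug C (occ C xₘ V)) ⇒
              letrec {l = l} E (plug C (rename (wk C) (lam {l = l′} s)))
    cp-e    : ∀ {l l′ k p t} {E : Vec (LExp (suc p + n)) (suc p)} {x₁ xₘ y s}
              (C : Ctx 𝓛ˡ k (suc p + n)) →
              Vec.lookup E x₁ ≡ lam {l = just S} s → Chain E x₁ xₘ →
              x₁ ≢ y → Vec.lookup E y ≡ plug C (occ C xₘ V) →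
              letrec {l = l} E t ⇒
              letrec {l = l} (E [ y ]≔ plug C (rename (wk C) (lam {l = l′} s))) t

    lapp    : ∀ {k} (C : Ctx 𝓛ˡ k n) {l p t} {E : Vec (LExp (suc p + k)) (suc p)} {s} →
              plug C (app {l = l} (letrec {l = just S} E s) t) ⇒
              plug C (letrec {l = nothing} E (app {l = l} s (weaken (suc p) t)))
    lcase   : ∀ {k} (C : Ctx 𝓛ˡ k n) {l p τ rs} {E : Vec (LExp (suc p + k)) (suc p)} {s} →
              plug C (case {l = l} τ (letrec {l = just S} E s) rs) ⇒
              plug C (letrec {l = nothing} E (case {l = l} τ s (weakenᵃ (suc p) rs)))
    lseq    : ∀ {k} (C : Ctx 𝓛ˡ k n) {l p t} {E : Vec (LExp (suc p + k)) (suc p)} {s} →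
              plug C (seq {l = l} (letrec {l = just S} E s) t) ⇒
              plug C (letrec {l = nothing} E (seq {l = l} s (weaken (suc p) t)))

    llet-in : ∀ {l p q} {E₁ : Vec (LExp (suc p + n)) (suc p)}
              {E₂ : Vec (LExp (suc q + (suc p + n))) (suc q)} {s} →
              letrec {l = l} E₁ (letrec {l = just S} E₂ s) ⇒
              letrec {l = l} (rename* (old {suc p}) E₁ ++ rename* (new {suc p}) E₂)
                             (rename (new {suc p}) s)
    llet-e  : ∀ {l p q t} {E₁ : Vec (LExp (suc p + n)) (suc p)} {x}
              {E₂ : Vec (LExp (suc q + (suc p + n))) (suc q)} {s} →
              Vec.lookup E₁ x ≡ letrec {l = just S} E₂ s →
              letrec {l = l} E₁ t ⇒
              letrec {l = l} ((rename* (old {suc p}) E₁ [ x ]≔ rename (new {suc p}) s)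
                                ++ rename* (new {suc p}) E₂)
                             (rename (old {suc p} {suc q}) t)

    seq-c   : ∀ {k} (C : Ctx 𝓛ˡ k n) {l v s} → Value v → labelOf v ≡ just S →
              plug C (seq {l = l} v s) ⇒ plug C s
    seq-in  : ∀ {l l′ k p} {E : Vec (LExp (suc p + n)) (suc p)} {x₁ xₘ τ c ss s}
              (C : Ctx 𝓛ˡ k (suc p + n)) →
              Vec.lookup E x₁ ≡ con {l = just S} τ c ss → Chain E x₁ xₘ →
              letrec {l = l} E (plug C (seq {l = l′} (occ C xₘ V) s)) ⇒
              letrec {l = l} E (plug C s)
    seq-e   : ∀ {l l′ k p t} {E : Vec (LExp (suc p + n)) (suc p)} {x₁ xₘ y τ c ss s}
              (C : Ctx 𝓛ˡ k (suc p + n)) →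
              Vec.lookup E x₁ ≡ con {l = just S} τ c ss → Chain E x₁ xₘ →
              x₁ ≢ y → Vec.lookup E y ≡ plug C (seq {l = l′} (occ C xₘ V) s) →
              letrec {l = l} E t ⇒
              letrec {l = l} (E [ y ]≔ plug C s) t

    case-c  : ∀ {k} (C : Ctx 𝓛ˡ k n) {l τ c ss rs} →
              plug C (case {l = l} τ (con {l = just S} τ c ss) rs) ⇒
              plug C (bind ss (alternative rs c))
    case-in : ∀ {l l′ k p} {E : Vec (LExp (suc p + n)) (suc p)} {x₁ xₘ τ c ss rs}
              (C : Ctx 𝓛ˡ k (suc p + n)) →
              Vec.lookup E x₁ ≡ con {l = just S} τ c ss → Chain E x₁ xₘ →
              letrec {l = l} E (plug C (case {l = l′} τ (occ C xₘ V) rs)) ⇒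
              letrec {l = l} (caseEnv E x₁ τ c ss) (caseBody {p = p} {n = n} C (alternative rs c))
    case-e  : ∀ {l l′ k p r} {E : Vec (LExp (suc p + n)) (suc p)} {x₁ xₘ u τ c ss rs}
              (C : Ctx 𝓛ˡ k (suc p + n)) →
              Vec.lookup E x₁ ≡ con {l = just S} τ c ss → Chain E x₁ xₘ →
              x₁ ≢ u → Vec.lookup E u ≡ plug C (case {l = l′} τ (occ C xₘ V) rs) →
              letrec {l = l} E r ⇒
              letrec {l = l} (caseEnv E x₁ τ c ss
                                [ u ↑ˡ ar τ c ]≔ caseBody {p = p} {n = n} C (alternative rs c))
                             (rename (old {suc p} {ar τ c}) r)

  infix 4 _⟶LR_ _⟶name_ _⟶lcc_
  data _⟶LR_ {n} (s : Exp 𝓛 n) : Exp 𝓛 n → Set where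
    step : ∀ {a b} → Star _⇝_ (withoutLabels s ^ T) a →
           ¬ Fails a → (∀ {a′} → ¬ (a ⇝ a′)) →
           a ⇒ b → s ⟶LR erase b

  data AnswerLR {n} : Exp 𝓛 n → Set where
    value      : ∀ {v} → Value v → AnswerLR v
    letrec-val : ∀ {p} {E : Vec (Exp 𝓛 (suc p + n)) (suc p)} {v} →
                 Value v → AnswerLR (letrec E v)
    letrec-con : ∀ {p} {E : Vec (Exp 𝓛 (suc p + n)) (suc p)} {x₁ xₘ τ c ss} →
                 Vec.lookup E x₁ ≡ con τ c ss → Chain E x₁ xₘ →
                 AnswerLR (letrec E (var (xₘ ↑ˡ n)))

  infix 5 _↓LR _↓name _↓lcc
  infix 4 _≤LR_ _≤name_ _≤lcc_

  _↓LR : ∀ {n} → Exp 𝓛 n → Set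
  _↓LR = Converges _⟶LR_ AnswerLR

  _≤LR_ : ∀ {n} → Exp 𝓛 n → Exp 𝓛 n → Set
  _≤LR_ = ContextualPreorder _↓LR

  data LCtx (k : ℕ) : ℕ → Set where
    hole   : LCtx k k
    letrec : ∀ {n p} → Vec (Exp 𝓛 (suc p + n)) (suc p) → LCtx k (suc p + n) → LCtx k n

  data ACtx (g : Lang) (n : ℕ) : Set where
    hole : ACtx g n
    app  : {l : Ann g} → ACtx g n → Exp g n → ACtx g n
    case : {l : Ann g} (τ : Type) → ACtx g n → Alts g n (arities τ) → ACtx g n
    seq  : {l : Ann g} → ACtx g n → Exp g n → ACtx g n

  plugL : ∀ {k n} → LCtx k n → Exp 𝓛 k → Exp 𝓛 n
  plugL hole         u = u
  plugL (letrec E L) u = letrec E (plugL L u)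

  wkL : ∀ {k n} → LCtx k n → Fin n → Fin k
  wkL hole                 = id
  wkL (letrec {p = p} E L) = wkL L ∘ (suc p ↑ʳ_)

  plugA : ∀ {g n} → ACtx g n → Exp g n → Exp g n
  plugA hole                u = u
  plugA (app {l = l} A t)     u = app {l = l} (plugA A u) t
  plugA (case {l = l} τ A rs) u = case {l = l} τ (plugA A u) rs
  plugA (seq {l = l} A t)     u = seq {l = l} (plugA A u) t

  RCtx : ℕ → ℕ → Set
  RCtx k n = LCtx k n × ACtx 𝓛 k

  plugR : ∀ {k n} → RCtx k n → Exp 𝓛 k → Exp 𝓛 n
  plugR (L , A) u = plugL L (plugA A u)

  wkR : ∀ {k n} → RCtx k n → Fin n → Fin k
  wkR (L , _) = wkL L

  data _⟶name_ {n} : Exp 𝓛 n → Exp 𝓛 n → Set where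
    beta  : ∀ {k} (R : RCtx k n) {s t} →
            plugR R (app (lam s) t) ⟶name plugR R (s [ t ∷ [] /x])
    gcp   : ∀ {k j p} (L : LCtx j n) {E : Vec (Exp 𝓛 (suc p + j)) (suc p)} {x}
            (R : RCtx k (suc p + j)) →
            plugL L (letrec E (plugR R (var (wkR R (x ↑ˡ j))))) ⟶name
            plugL L (letrec E (plugR R (rename (wkR R) (Vec.lookup E x))))
    lapp  : ∀ {k p} (R : RCtx k n) {E : Vec (Exp 𝓛 (suc p + k)) (suc p)} {s t} →
            plugR R (app (letrec E s) t) ⟶name
            plugR R (letrec E (app s (weaken (suc p) t)))
    lcase : ∀ {k p τ} (R : RCtx k n) {E : Vec (Exp 𝓛 (suc p + k)) (suc p)} {s rs} →
            plugR R (case τ (letrec E s) rs) ⟶name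
            plugR R (letrec E (case τ s (weakenᵃ (suc p) rs)))
    lseq  : ∀ {k p} (R : RCtx k n) {E : Vec (Exp 𝓛 (suc p + k)) (suc p)} {s t} →
            plugR R (seq (letrec E s) t) ⟶name
            plugR R (letrec E (seq s (weaken (suc p) t)))
    seq   : ∀ {k} (R : RCtx k n) {v s} → Value v →
            plugR R (seq v s) ⟶name plugR R s
    case  : ∀ {k} (R : RCtx k n) {τ c ss rs} →
            plugR R (case τ (con τ c ss) rs) ⟶name plugR R (alternative rs c [ ss /x])

  data Answername {n} : Exp 𝓛 n → Set where
    L[v] : ∀ {k} (L : LCtx k n) {v} → Value v → Answername (plugL L v)

  _↓name : ∀ {n} → Exp 𝓛 n → Set
  _↓name = Converges _⟶name_ Answername

  _≤name_ : ∀ {n} → Exp 𝓛 n → Exp 𝓛 n → Set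
  _≤name_ = ContextualPreorder _↓name

  data _⟶lcc_ {n} : Exp Λ n → Exp Λ n → Set where
    beta : ∀ (R : ACtx Λ n) {s t} →
           plugA R (app (lam s) t) ⟶lcc plugA R (s [ t ∷ [] /x])
    case : ∀ (R : ACtx Λ n) {τ c ss rs} →
           plugA R (case τ (con τ c ss) rs) ⟶lcc plugA R (alternative rs c [ ss /x])
    seq  : ∀ (R : ACtx Λ n) {v s} → Value v →
           plugA R (seq v s) ⟶lcc plugA R s

  _↓lcc : ∀ {n} → Exp Λ n → Set
  _↓lcc = Converges _⟶lcc_ Value

  _≤lcc_ : ∀ {n} → Exp Λ n → Exp Λ n → Set
  _≤lcc_ = ContextualPreorder _↓lcc

  -- The bindings of a letrec are unordered, so their order x₁, …, xₖ in N can
  -- be chosen: xₖ is the variable with index 0, bound by the innermost λ.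
  -- lams k s = λx₁.⋯λxₖ.s, and apps passes the last entry of the vector first.
  lams : ∀ {n} k → Exp Λ (k + n) → Exp Λ n
  lams zero    s = s
  lams (suc k) s = lams k (lam s)

  apps : ∀ {n k} → Exp Λ n → Vec (Exp Λ n) k → Exp Λ n
  apps f []       = f
  apps f (s ∷ ss) = app (apps f ss) s

  xs : ∀ {n} k → Vec (Exp Λ (k + n)) k
  xs {n} k = tabulate λ i → var (i ↑ˡ n)

  -- λx₁.⋯λxₖ. F (x₁ x₁ … xₖ) … (xₖ x₁ … xₖ)  with  F = λx₁.⋯λxₖ.s.
  -- For s = N(sᵢ) this is Xᵢ′; for s = N(t), and up to the names of the outer
  -- variables, λx₁′.⋯λxₖ′.(λx₁.⋯λxₖ.N(t)) U₁ … Uₖ.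
  knot : ∀ {n} k → Exp Λ (k + n) → Exp Λ n
  knot k s = lams k (apps (weaken k (lams k s)) (Vec.map (λ x → apps x (xs k)) (xs k)))

  mutual
    N : ∀ {n} → Exp 𝓛 n → Exp Λ n
    N (var x)              = var x
    N (app s t)            = app (N s) (N t)
    N (lam s)              = lam (N s)
    N (letrec {p = p} E t) = apps (knot (suc p) (N t)) (Vec.map (knot (suc p)) (N* E))
    N (con τ c ss)         = con τ c (N* ss)
    N (seq s t)            = seq (N s) (N t)
    N (case τ s rs)        = case τ (N s) (Nᵃ rs)

    N* : ∀ {n k} → Vec (Exp 𝓛 n) k → Vec (Exp Λ n) k
    N* []       = []
    N* (s ∷ ss) = N s ∷ N* ss

    Nᵃ : ∀ {n ks} → Alts 𝓛 n ks → Alts Λ n ks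
    Nᵃ []       = []
    Nᵃ (r ∷ rs) = N r ∷ Nᵃ rs

  W⟦_⟧ : ∀ {n} → Exp 𝓛 n → Exp 𝓛 n
  W⟦ s ⟧ = s

{-# OPTIONS --safe #-}
module Submission where

-- Both equivalences follow from s ↓name ⇔ N s ↓lcc and s ↓LR ⇔ N s ↓lcc for all
-- s: N acts on contexts, and a letrec-free context is the N-image of itself.
--
-- L_name.  N (letrec E t) reduces in 2p steps exactly to N t with each xᵢ replaced
-- by N (letrec E Eᵢ).  Hence N s and N s′ meet for every step s → s′ of L_name, after
-- the same number of steps for lapp, lcase and lseq, and with fewer steps from N s′
-- otherwise.  Since lcc is deterministic, the number of lcc-steps of N s is a
-- termination measure for evaluating s in L_name.
--
-- L_LR.  Sharing is removed by Kleene approximants: ⟦ s ⟧ k unfolds every letrec k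
-- times, starting from a diverging Ω, and s converges if some ⟦ s ⟧ k does.  They are
-- compared by a simulation that never increases the number of lcc-steps; all
-- letrec-laws (llet, cp, the new bindings of case-in) become inductions on the
-- iteration index.  Used in all contexts, these laws show that an LR-step reflects
-- convergence, without looking at the labels.  Conversely, the labelling of a
-- convergent expression finds a redex, because k bounds the length of the path of
-- demanded bindings; lbeta, case and seq then decrease the number of steps of the
-- approximants, and the other rules keep it and decrease a syntactic measure.

open import Defs
open import Data.Bool using (Bool; true; false)
open import Data.Empty using (⊥-elim)
open import Data.Fin using (Fin; zero; suc; _↑ˡ_; _↑ʳ_; splitAt; lift)
open import Data.Fin.Properties using (splitAt-↑ˡ; splitAt-↑ʳ; splitAt⁻¹-↑ˡ; splitAt⁻¹-↑ʳ; ↑ʳ-injective; ↑ˡ-injective; suc-injective; _≟_)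
open import Data.List as List using (List; []; _∷_)
open import Data.Maybe using (Maybe; just; nothing)
open import Data.Nat using (ℕ; zero; suc; _+_; _*_; _≤_; _<_; z≤n; s≤s; s≤s⁻¹)
open import Data.Nat.Properties using (+-assoc; +-comm; +-suc; +-identityʳ; ≤-refl; ≤-trans; ≤-reflexive; m≤m+n; m≤n+m; +-mono-≤; +-monoʳ-≤; +-monoˡ-≤; n≤1+n; +-cancelʳ-≡; m≤m*n)
open import Data.Product using (∃; _×_; _,_; proj₁; proj₂)
open import Data.Sum using (_⊎_; inj₁; inj₂; [_,_]′)
open import Data.Unit using (⊤; tt)
open import Data.Vec as Vec using (Vec; []; _∷_; _++_; tabulate; lookup; _[_]≔_; _[_]%=_)
open import Data.Vec.Properties using (tabulate-cong; tabulate∘lookup; lookup∘tabulate; lookup-map; lookup∘update; lookup∘update′; lookup∘updateAt; lookup∘updateAt′; []≔-lookup; lookup-++ˡ; lookup-++ʳ; map-[]≔)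
open import Function using (_∘_; id)
open import Function.Bundles using (_⇔_; mk⇔; Injection; mk↣)
open import Relation.Binary.Construct.Closure.ReflexiveTransitive using (Star; ε; _◅_; _◅◅_)
open import Relation.Binary.PropositionalEquality using (_≡_; _≢_; _≗_; refl; sym; trans; cong; cong₂) renaming (subst to transport; subst₂ to transport₂)
open import Relation.Nullary using (¬_; Dec; yes; no)

-- The comparison by common reducts that serves L_name breaks down for L_LR. A step inside a binding
-- acts on a shared expression, of which N makes a new copy at every unfolding of the knot, so in
-- general N s and N s′ keep different copies however far they are reduced. Moreover every letrec
-- costs lcc-steps in N s, so that llet and the new bindings of case-in change the count. Both
-- obstacles disappear for approximants: they contain finitely many copies, and the interpretation
-- unfolds a letrec without any lcc-step, so that only β, case and seq are counted. The price is
-- that the two sides of a letrec-law distribute their unfoldings differently. A law therefore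
-- compares index k on the left with every index from some h(k) on at the right, where h reflects
-- how many iterations a binding needs to be reached. The simulation has two forms because the two
-- directions ask for different things: going back along a step, only convergence matters and the
-- right side may run on; termination of the normal-order reduction needs a count that does not
-- grow.

module Development (Sig : Signature) where
  open Calculus Sig

  -- Renaming and substitution

  -- Replaces a case analysis on `splitAt` in pointwise equations: with the variable in the form
  -- `i ↑ˡ n` or `k ↑ʳ j`, the equations for `inst`, `env`, `old` and `new` apply directly.
  splitCases : ∀ k {n} {P : Fin (k + n) → Set} →
               (∀ i → P (i ↑ˡ n)) → (∀ j → P (k ↑ʳ j)) → ∀ x → P x
  splitCases zero    f g x       = g x
  splitCases (suc k) f g zero    = f zero
  splitCases (suc k) {P = P} f g (suc x) = splitCases k {P = P ∘ suc} (f ∘ suc) g x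

  lift-cong : ∀ {m n} k {ρ ρ′ : Fin m → Fin n} → ρ ≗ ρ′ → lift k ρ ≗ lift k ρ′
  lift-cong zero    e x       = e x
  lift-cong (suc k) e zero    = refl
  lift-cong (suc k) e (suc x) = cong suc (lift-cong k e x)

  lift-∘ : ∀ {l m n} k {ρ : Fin m → Fin n} {π : Fin l → Fin m} {θ : Fin l → Fin n} →
           ρ ∘ π ≗ θ → lift k ρ ∘ lift k π ≗ lift k θ
  lift-∘ zero    e x       = e x
  lift-∘ (suc k) e zero    = refl
  lift-∘ (suc k) e (suc x) = cong suc (lift-∘ k e x)

  lift-↑ˡ : ∀ {m n k} (ρ : Fin m → Fin n) (i : Fin k) → lift k ρ (i ↑ˡ m) ≡ i ↑ˡ n
  lift-↑ˡ ρ zero    = refl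
  lift-↑ˡ ρ (suc i) = cong suc (lift-↑ˡ ρ i)

  lift-↑ʳ : ∀ {m n} k (ρ : Fin m → Fin n) j → lift k ρ (k ↑ʳ j) ≡ k ↑ʳ ρ j
  lift-↑ʳ zero    ρ j = refl
  lift-↑ʳ (suc k) ρ j = cong suc (lift-↑ʳ k ρ j)

  mutual
    rename-cong : ∀ {g m n} {ρ ρ′ : Fin m → Fin n} → (e : ρ ≗ ρ′) → (s : Exp g m) →
                  rename ρ s ≡ rename ρ′ s
    rename-cong e (var {l} x) = cong (var {l = l}) (e x)
    rename-cong e (app {l} s t) = cong₂ (app {l = l}) (rename-cong e s) (rename-cong e t)
    rename-cong e (lam {l} s) = cong (lam {l = l}) (rename-cong (lift-cong 1 e) s)
    rename-cong e (letrec {_} {l} {p} E t) =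
      cong₂ (letrec {l = l}) (rename-cong* (lift-cong (suc p) e) E) (rename-cong (lift-cong (suc p) e) t)
    rename-cong e (con {l} τ c ss) = cong (con {l = l} τ c) (rename-cong* e ss)
    rename-cong e (seq {l} s t) = cong₂ (seq {l = l}) (rename-cong e s) (rename-cong e t)
    rename-cong e (case {l} τ s rs) = cong₂ (case {l = l} τ) (rename-cong e s) (rename-congᵃ e rs)

    rename-cong* : ∀ {g m n} {ρ ρ′ : Fin m → Fin n} → (e : ρ ≗ ρ′) → ∀ {k} (ss : Vec (Exp g m) k) →
                   rename* ρ ss ≡ rename* ρ′ ss
    rename-cong* e [] = refl
    rename-cong* e (s ∷ ss) = cong₂ _∷_ (rename-cong e s) (rename-cong* e ss)

    rename-congᵃ : ∀ {g m n} {ρ ρ′ : Fin m → Fin n} → (e : ρ ≗ ρ′) → ∀ {ks} (rs : Alts g m ks) →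
                   renameᵃ ρ rs ≡ renameᵃ ρ′ rs
    rename-congᵃ e [] = refl
    rename-congᵃ e (_∷_ {k = k} r rs) = cong₂ _∷_ (rename-cong (lift-cong k e) r) (rename-congᵃ e rs)

  mutual
    -- The composite is a separate parameter, known only pointwise. The induction can then pass
    -- binders by `lift-∘` without function extensionality, and callers choose the form of the
    -- composite. The other fusion lemmas are stated in the same way.
    rename-∘ : ∀ {g l m n} {ρ : Fin m → Fin n} {π : Fin l → Fin m} {θ : Fin l → Fin n} →
               (e : ρ ∘ π ≗ θ) → (s : Exp g l) → rename ρ (rename π s) ≡ rename θ s
    rename-∘ e (var {l} x) = cong (var {l = l}) (e x)
    rename-∘ e (app {l} s t) = cong₂ (app {l = l}) (rename-∘ e s) (rename-∘ e t)
    rename-∘ e (lam {l} s) = cong (lam {l = l}) (rename-∘ (lift-∘ 1 e) s)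
    rename-∘ e (letrec {_} {l} {p} E t) =
      cong₂ (letrec {l = l}) (rename-∘* (lift-∘ (suc p) e) E) (rename-∘ (lift-∘ (suc p) e) t)
    rename-∘ e (con {l} τ c ss) = cong (con {l = l} τ c) (rename-∘* e ss)
    rename-∘ e (seq {l} s t) = cong₂ (seq {l = l}) (rename-∘ e s) (rename-∘ e t)
    rename-∘ e (case {l} τ s rs) = cong₂ (case {l = l} τ) (rename-∘ e s) (rename-∘ᵃ e rs)

    rename-∘* : ∀ {g l m n} {ρ : Fin m → Fin n} {π : Fin l → Fin m} {θ : Fin l → Fin n} →
                (e : ρ ∘ π ≗ θ) → ∀ {k} (ss : Vec (Exp g l) k) →
                rename* ρ (rename* π ss) ≡ rename* θ ss
    rename-∘* e [] = refl
    rename-∘* e (s ∷ ss) = cong₂ _∷_ (rename-∘ e s) (rename-∘* e ss)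

    rename-∘ᵃ : ∀ {g l m n} {ρ : Fin m → Fin n} {π : Fin l → Fin m} {θ : Fin l → Fin n} →
                (e : ρ ∘ π ≗ θ) → ∀ {ks} (rs : Alts g l ks) → renameᵃ ρ (renameᵃ π rs) ≡ renameᵃ θ rs
    rename-∘ᵃ e [] = refl
    rename-∘ᵃ e (_∷_ {k = k} r rs) = cong₂ _∷_ (rename-∘ (lift-∘ k e) r) (rename-∘ᵃ e rs)

  lifts-cong : ∀ {g m n} k {σ σ′ : Fin m → Exp g n} → σ ≗ σ′ → lifts k σ ≗ lifts k σ′
  lifts-cong zero    e x       = e x
  lifts-cong (suc k) e zero    = refl
  lifts-cong (suc k) e (suc x) = cong (weaken 1) (lifts-cong k e x)

  lifts-lift : ∀ {g l m n} k {σ : Fin m → Exp g n} {ρ : Fin l → Fin m} {τ : Fin l → Exp g n} →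
               σ ∘ ρ ≗ τ → lifts k σ ∘ lift k ρ ≗ lifts k τ
  lifts-lift zero    e x       = e x
  lifts-lift (suc k) e zero    = refl
  lifts-lift (suc k) e (suc x) = cong (weaken 1) (lifts-lift k e x)

  rename-lifts : ∀ {g l m n} k {ρ : Fin m → Fin n} {σ : Fin l → Exp g m} {τ : Fin l → Exp g n} →
                 rename ρ ∘ σ ≗ τ → rename (lift k ρ) ∘ lifts k σ ≗ lifts k τ
  rename-lifts zero    e x    = e x
  rename-lifts (suc k) e zero = refl
  rename-lifts (suc k) {σ = σ} e (suc x) =
    trans (rename-∘ (λ _ → refl) (lifts k σ x))
          (trans (sym (rename-∘ (λ _ → refl) (lifts k σ x))) (cong (weaken 1) (rename-lifts k e x)))

  lifts-↑ˡ : ∀ {g m n k} (σ : Fin m → Exp g n) (i : Fin k) →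
             lifts k σ (i ↑ˡ m) ≡ var {l = unlabelled} (i ↑ˡ n)
  lifts-↑ˡ σ zero    = refl
  lifts-↑ˡ σ (suc i) = cong (weaken 1) (lifts-↑ˡ σ i)

  lift-id : ∀ {n} k {ρ : Fin n → Fin n} → ρ ≗ id → lift k ρ ≗ id
  lift-id zero    e x       = e x
  lift-id (suc k) e zero    = refl
  lift-id (suc k) e (suc x) = cong suc (lift-id k e x)

  mutual
    rename-id : ∀ {g n} {ρ : Fin n → Fin n} → (e : ρ ≗ id) → (s : Exp g n) → rename ρ s ≡ s
    rename-id e (var {l} x) = cong (var {l = l}) (e x)
    rename-id e (app {l} s t) = cong₂ (app {l = l}) (rename-id e s) (rename-id e t)
    rename-id e (lam {l} s) = cong (lam {l = l}) (rename-id (lift-id 1 e) s)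
    rename-id e (letrec {_} {l} {p} E t) =
      cong₂ (letrec {l = l}) (rename-id* (lift-id (suc p) e) E) (rename-id (lift-id (suc p) e) t)
    rename-id e (con {l} τ c ss) = cong (con {l = l} τ c) (rename-id* e ss)
    rename-id e (seq {l} s t) = cong₂ (seq {l = l}) (rename-id e s) (rename-id e t)
    rename-id e (case {l} τ s rs) = cong₂ (case {l = l} τ) (rename-id e s) (rename-idᵃ e rs)

    rename-id* : ∀ {g n} {ρ : Fin n → Fin n} → (e : ρ ≗ id) → ∀ {k} (ss : Vec (Exp g n) k) →
                 rename* ρ ss ≡ ss
    rename-id* e [] = refl
    rename-id* e (s ∷ ss) = cong₂ _∷_ (rename-id e s) (rename-id* e ss)

    rename-idᵃ : ∀ {g n} {ρ : Fin n → Fin n} → (e : ρ ≗ id) → ∀ {ks} (rs : Alts g n ks) →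
                 renameᵃ ρ rs ≡ rs
    rename-idᵃ e [] = refl
    rename-idᵃ e (_∷_ {k = k} r rs) = cong₂ _∷_ (rename-id (lift-id k e) r) (rename-idᵃ e rs)

  lifts-↑ʳ : ∀ {g m n} k (σ : Fin m → Exp g n) j → lifts k σ (k ↑ʳ j) ≡ weaken k (σ j)
  lifts-↑ʳ zero    σ j = sym (rename-id (λ _ → refl) (σ j))
  lifts-↑ʳ (suc k) σ j = trans (cong (weaken 1) (lifts-↑ʳ k σ j)) (rename-∘ (λ _ → refl) (σ j))

  mutual
    subst-cong : ∀ {g m n} {σ σ′ : Fin m → Exp g n} → (e : σ ≗ σ′) → (s : Exp g m) →
                 subst σ s ≡ subst σ′ s
    subst-cong e (var {l} x) = e x
    subst-cong e (app {l} s t) = cong₂ (app {l = l}) (subst-cong e s) (subst-cong e t)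
    subst-cong e (lam {l} s) = cong (lam {l = l}) (subst-cong (lifts-cong 1 e) s)
    subst-cong e (letrec {_} {l} {p} E t) =
      cong₂ (letrec {l = l}) (subst-cong* (lifts-cong (suc p) e) E) (subst-cong (lifts-cong (suc p) e) t)
    subst-cong e (con {l} τ c ss) = cong (con {l = l} τ c) (subst-cong* e ss)
    subst-cong e (seq {l} s t) = cong₂ (seq {l = l}) (subst-cong e s) (subst-cong e t)
    subst-cong e (case {l} τ s rs) = cong₂ (case {l = l} τ) (subst-cong e s) (subst-congᵃ e rs)

    subst-cong* : ∀ {g m n} {σ σ′ : Fin m → Exp g n} → (e : σ ≗ σ′) → ∀ {k} (ss : Vec (Exp g m) k) →
                  subst* σ ss ≡ subst* σ′ ss
    subst-cong* e [] = refl
    subst-cong* e (s ∷ ss) = cong₂ _∷_ (subst-cong e s) (subst-cong* e ss)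

    subst-congᵃ : ∀ {g m n} {σ σ′ : Fin m → Exp g n} → (e : σ ≗ σ′) → ∀ {ks} (rs : Alts g m ks) →
                  substᵃ σ rs ≡ substᵃ σ′ rs
    subst-congᵃ e [] = refl
    subst-congᵃ e (_∷_ {k = k} r rs) = cong₂ _∷_ (subst-cong (lifts-cong k e) r) (subst-congᵃ e rs)

  mutual
    subst-rename : ∀ {g l m n} {σ : Fin m → Exp g n} {ρ : Fin l → Fin m} {τ : Fin l → Exp g n} →
                   (e : σ ∘ ρ ≗ τ) → (s : Exp g l) → subst σ (rename ρ s) ≡ subst τ s
    subst-rename e (var {l} x) = e x
    subst-rename e (app {l} s t) = cong₂ (app {l = l}) (subst-rename e s) (subst-rename e t)
    subst-rename e (lam {l} s) = cong (lam {l = l}) (subst-rename (lifts-lift 1 e) s)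
    subst-rename e (letrec {_} {l} {p} E t) =
      cong₂ (letrec {l = l}) (subst-rename* (lifts-lift (suc p) e) E) (subst-rename (lifts-lift (suc p) e) t)
    subst-rename e (con {l} τ c ss) = cong (con {l = l} τ c) (subst-rename* e ss)
    subst-rename e (seq {l} s t) = cong₂ (seq {l = l}) (subst-rename e s) (subst-rename e t)
    subst-rename e (case {l} τ s rs) = cong₂ (case {l = l} τ) (subst-rename e s) (subst-renameᵃ e rs)

    subst-rename* : ∀ {g l m n} {σ : Fin m → Exp g n} {ρ : Fin l → Fin m} {τ : Fin l → Exp g n} →
                    (e : σ ∘ ρ ≗ τ) → ∀ {k} (ss : Vec (Exp g l) k) →
                    subst* σ (rename* ρ ss) ≡ subst* τ ss
    subst-rename* e [] = refl
    subst-rename* e (s ∷ ss) = cong₂ _∷_ (subst-rename e s) (subst-rename* e ss)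

    subst-renameᵃ : ∀ {g l m n} {σ : Fin m → Exp g n} {ρ : Fin l → Fin m} {τ : Fin l → Exp g n} →
                    (e : σ ∘ ρ ≗ τ) → ∀ {ks} (rs : Alts g l ks) →
                    substᵃ σ (renameᵃ ρ rs) ≡ substᵃ τ rs
    subst-renameᵃ e [] = refl
    subst-renameᵃ e (_∷_ {k = k} r rs) =
      cong₂ _∷_ (subst-rename (lifts-lift k e) r) (subst-renameᵃ e rs)

  mutual
    rename-subst : ∀ {g l m n} {ρ : Fin m → Fin n} {σ : Fin l → Exp g m} {τ : Fin l → Exp g n} →
                   (e : rename ρ ∘ σ ≗ τ) → (s : Exp g l) → rename ρ (subst σ s) ≡ subst τ s
    rename-subst e (var {l} x) = e x
    rename-subst e (app {l} s t) = cong₂ (app {l = l}) (rename-subst e s) (rename-subst e t)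
    rename-subst e (lam {l} s) = cong (lam {l = l}) (rename-subst (rename-lifts 1 e) s)
    rename-subst e (letrec {_} {l} {p} E t) =
      cong₂ (letrec {l = l}) (rename-subst* (rename-lifts (suc p) e) E) (rename-subst (rename-lifts (suc p) e) t)
    rename-subst e (con {l} τ c ss) = cong (con {l = l} τ c) (rename-subst* e ss)
    rename-subst e (seq {l} s t) = cong₂ (seq {l = l}) (rename-subst e s) (rename-subst e t)
    rename-subst e (case {l} τ s rs) = cong₂ (case {l = l} τ) (rename-subst e s) (rename-substᵃ e rs)

    rename-subst* : ∀ {g l m n} {ρ : Fin m → Fin n} {σ : Fin l → Exp g m} {τ : Fin l → Exp g n} →
                    (e : rename ρ ∘ σ ≗ τ) → ∀ {k} (ss : Vec (Exp g l) k) →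
                    rename* ρ (subst* σ ss) ≡ subst* τ ss
    rename-subst* e [] = refl
    rename-subst* e (s ∷ ss) = cong₂ _∷_ (rename-subst e s) (rename-subst* e ss)

    rename-substᵃ : ∀ {g l m n} {ρ : Fin m → Fin n} {σ : Fin l → Exp g m} {τ : Fin l → Exp g n} →
                    (e : rename ρ ∘ σ ≗ τ) → ∀ {ks} (rs : Alts g l ks) →
                    renameᵃ ρ (substᵃ σ rs) ≡ substᵃ τ rs
    rename-substᵃ e [] = refl
    rename-substᵃ e (_∷_ {k = k} r rs) =
      cong₂ _∷_ (rename-subst (rename-lifts k e) r) (rename-substᵃ e rs)

  subst-lifts : ∀ {g l m n} k {τ : Fin m → Exp g n} {σ : Fin l → Exp g m} {υ : Fin l → Exp g n} →
                subst τ ∘ σ ≗ υ → subst (lifts k τ) ∘ lifts k σ ≗ lifts k υ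
  subst-lifts zero    e x    = e x
  subst-lifts (suc k) e zero = refl
  subst-lifts (suc k) {σ = σ} e (suc x) =
    trans (subst-rename (λ _ → refl) (lifts k σ x))
          (trans (sym (rename-subst (λ _ → refl) (lifts k σ x))) (cong (weaken 1) (subst-lifts k e x)))

  mutual
    subst-∘ : ∀ {g l m n} {τ : Fin m → Exp g n} {σ : Fin l → Exp g m} {υ : Fin l → Exp g n} →
              (e : subst τ ∘ σ ≗ υ) → (s : Exp g l) → subst τ (subst σ s) ≡ subst υ s
    subst-∘ e (var {l} x) = e x
    subst-∘ e (app {l} s t) = cong₂ (app {l = l}) (subst-∘ e s) (subst-∘ e t)
    subst-∘ e (lam {l} s) = cong (lam {l = l}) (subst-∘ (subst-lifts 1 e) s)
    subst-∘ e (letrec {_} {l} {p} E t) =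
      cong₂ (letrec {l = l}) (subst-∘* (subst-lifts (suc p) e) E) (subst-∘ (subst-lifts (suc p) e) t)
    subst-∘ e (con {l} τ c ss) = cong (con {l = l} τ c) (subst-∘* e ss)
    subst-∘ e (seq {l} s t) = cong₂ (seq {l = l}) (subst-∘ e s) (subst-∘ e t)
    subst-∘ e (case {l} τ s rs) = cong₂ (case {l = l} τ) (subst-∘ e s) (subst-∘ᵃ e rs)

    subst-∘* : ∀ {g l m n} {τ : Fin m → Exp g n} {σ : Fin l → Exp g m} {υ : Fin l → Exp g n} →
               (e : subst τ ∘ σ ≗ υ) → ∀ {k} (ss : Vec (Exp g l) k) →
               subst* τ (subst* σ ss) ≡ subst* υ ss
    subst-∘* e [] = refl
    subst-∘* e (s ∷ ss) = cong₂ _∷_ (subst-∘ e s) (subst-∘* e ss)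

    subst-∘ᵃ : ∀ {g l m n} {τ : Fin m → Exp g n} {σ : Fin l → Exp g m} {υ : Fin l → Exp g n} →
               (e : subst τ ∘ σ ≗ υ) → ∀ {ks} (rs : Alts g l ks) →
               substᵃ τ (substᵃ σ rs) ≡ substᵃ υ rs
    subst-∘ᵃ e [] = refl
    subst-∘ᵃ e (_∷_ {k = k} r rs) = cong₂ _∷_ (subst-∘ (subst-lifts k e) r) (subst-∘ᵃ e rs)

  lifts-var : ∀ {n m} k {σ : Fin m → Exp Λ n} {ρ : Fin m → Fin n} →
              (∀ x → σ x ≡ var (ρ x)) → ∀ x → lifts k σ x ≡ var (lift k ρ x)
  lifts-var zero    e x       = e x
  lifts-var (suc k) e zero    = refl
  lifts-var (suc k) e (suc x) = cong (weaken 1) (lifts-var k e x)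

  mutual
    subst-var : ∀ {m n} {σ : Fin m → Exp Λ n} {ρ : Fin m → Fin n} → (e : ∀ x → σ x ≡ var (ρ x)) →
                (s : Exp Λ m) → subst σ s ≡ rename ρ s
    subst-var e (var {l} x) = e x
    subst-var e (app {l} s t) = cong₂ (app {l = l}) (subst-var e s) (subst-var e t)
    subst-var e (lam {l} s) = cong (lam {l = l}) (subst-var (lifts-var 1 e) s)
    subst-var e (con {l} τ c ss) = cong (con {l = l} τ c) (subst-var* e ss)
    subst-var e (seq {l} s t) = cong₂ (seq {l = l}) (subst-var e s) (subst-var e t)
    subst-var e (case {l} τ s rs) = cong₂ (case {l = l} τ) (subst-var e s) (subst-varᵃ e rs)

    subst-var* : ∀ {m n} {σ : Fin m → Exp Λ n} {ρ : Fin m → Fin n} → (e : ∀ x → σ x ≡ var (ρ x)) →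
                 ∀ {k} (ss : Vec (Exp Λ m) k) → subst* σ ss ≡ rename* ρ ss
    subst-var* e [] = refl
    subst-var* e (s ∷ ss) = cong₂ _∷_ (subst-var e s) (subst-var* e ss)

    subst-varᵃ : ∀ {m n} {σ : Fin m → Exp Λ n} {ρ : Fin m → Fin n} → (e : ∀ x → σ x ≡ var (ρ x)) →
                 ∀ {ks} (rs : Alts Λ m ks) → substᵃ σ rs ≡ renameᵃ ρ rs
    subst-varᵃ e [] = refl
    subst-varᵃ e (_∷_ {k = k} r rs) = cong₂ _∷_ (subst-var (lifts-var k e) r) (subst-varᵃ e rs)

  subst-id : ∀ {n} {σ : Fin n → Exp Λ n} → (∀ x → σ x ≡ var x) → ∀ s → subst σ s ≡ s
  subst-id e s = trans (subst-var e s) (rename-id (λ _ → refl) s)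

  -- `t [ ss /x]` is by definition `subst (inst (lookup ss)) t`. With a function in place of the
  -- vector, the same lemmas serve β, case and the unfolding of letrec.
  inst : ∀ {g n k} → (Fin k → Exp g n) → Fin (k + n) → Exp g n
  inst {k = k} f = [ f , (λ j → var {l = unlabelled} j) ]′ ∘ splitAt k

  inst-↑ˡ : ∀ {g n k} (f : Fin k → Exp g n) i → inst f (i ↑ˡ n) ≡ f i
  inst-↑ˡ {n = n} {k} f i = cong [ f , _ ]′ (splitAt-↑ˡ k i n)

  inst-↑ʳ : ∀ {g n} k (f : Fin k → Exp g n) j → inst f (k ↑ʳ j) ≡ var {l = unlabelled} j
  inst-↑ʳ {n = n} k f j = cong [ f , _ ]′ (splitAt-↑ʳ k n j)

  inst-unique : ∀ {g n k} {f : Fin k → Exp g n} {σ : Fin (k + n) → Exp g n} →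
                (∀ i → σ (i ↑ˡ n) ≡ f i) → (∀ j → σ (k ↑ʳ j) ≡ var {l = unlabelled} j) →
                σ ≗ inst f
  inst-unique {k = k} {f} p q = splitCases k
    (λ i → trans (p i) (sym (inst-↑ˡ f i))) (λ j → trans (q j) (sym (inst-↑ʳ k f j)))

  subst-weaken : ∀ {n k} (f : Fin k → Exp Λ n) s → subst (inst f) (weaken k s) ≡ s
  subst-weaken {k = k} f s = trans (subst-rename (inst-↑ʳ k f) s) (subst-id (λ _ → refl) s)

  subst-inst-lifts : ∀ {m n k} (τ : Fin m → Exp Λ n) (f : Fin k → Exp Λ m) →
                     subst (inst (subst τ ∘ f)) ∘ lifts k τ ≗ subst τ ∘ inst f
  subst-inst-lifts {k = k} τ f = splitCases k
    (λ i → trans (cong (subst (inst (subst τ ∘ f))) (lifts-↑ˡ τ i))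
             (trans (inst-↑ˡ (subst τ ∘ f) i) (sym (cong (subst τ) (inst-↑ˡ f i)))))
    (λ j → trans (cong (subst (inst (subst τ ∘ f))) (lifts-↑ʳ k τ j))
             (trans (subst-weaken (subst τ ∘ f) (τ j)) (sym (cong (subst τ) (inst-↑ʳ k f j)))))

  subst-inst : ∀ {m n k} (τ : Fin m → Exp Λ n) (f : Fin k → Exp Λ m) s →
               subst τ (subst (inst f) s) ≡ subst (inst (subst τ ∘ f)) (subst (lifts k τ) s)
  subst-inst τ f s = trans (subst-∘ (λ _ → refl) s) (sym (subst-∘ (subst-inst-lifts τ f) s))

  rename≗subst : ∀ {m n} (ρ : Fin m → Fin n) (s : Exp Λ m) → rename ρ s ≡ subst (λ x → var (ρ x)) s
  rename≗subst ρ s = sym (subst-var (λ _ → refl) s)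

  inst-cong : ∀ {g n k} {f f′ : Fin k → Exp g n} → f ≗ f′ → inst f ≗ inst f′
  inst-cong {k = k} {f} {f′} e = inst-unique (λ i → trans (inst-↑ˡ f i) (e i)) (inst-↑ʳ k f)

  lookup-rename* : ∀ {g m n k} (ρ : Fin m → Fin n) (ss : Vec (Exp g m) k) i →
                   lookup (rename* ρ ss) i ≡ rename ρ (lookup ss i)
  lookup-rename* ρ (s ∷ ss) zero    = refl
  lookup-rename* ρ (s ∷ ss) (suc i) = lookup-rename* ρ ss i

  lookup-subst* : ∀ {g m n k} (σ : Fin m → Exp g n) (ss : Vec (Exp g m) k) i →
                  lookup (subst* σ ss) i ≡ subst σ (lookup ss i)
  lookup-subst* σ (s ∷ ss) zero    = refl
  lookup-subst* σ (s ∷ ss) (suc i) = lookup-subst* σ ss i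

  alternative-subst : ∀ {g m n ks} (σ : Fin m → Exp g n) (rs : Alts g m ks) c →
                      alternative (substᵃ σ rs) c ≡ subst (lifts (List.lookup ks c) σ) (alternative rs c)
  alternative-subst σ (r ∷ rs) zero    = refl
  alternative-subst σ (r ∷ rs) (suc c) = alternative-subst σ rs c

  alternative-rename : ∀ {g m n ks} (ρ : Fin m → Fin n) (rs : Alts g m ks) c →
                       alternative (renameᵃ ρ rs) c ≡ rename (lift (List.lookup ks c) ρ) (alternative rs c)
  alternative-rename ρ (r ∷ rs) zero    = refl
  alternative-rename ρ (r ∷ rs) (suc c) = alternative-rename ρ rs c

  -- The calculus L_lcc and the translation N

  -- One type for the three strict positions, so that lapp, lcase and lseq become instances of a
  -- single law.
  data Frame (g : Lang) (n : ℕ) : Set where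
    app  : {l : Ann g} → Exp g n → Frame g n
    seq  : {l : Ann g} → Exp g n → Frame g n
    case : {l : Ann g} (τ : Type) → Alts g n (arities τ) → Frame g n

  plugF : ∀ {g n} → Frame g n → Exp g n → Exp g n
  plugF (app {l} t)     u = app {l = l} u t
  plugF (seq {l} t)     u = seq {l = l} u t
  plugF (case {l} τ rs) u = case {l = l} τ u rs

  -- A reduction context as the stack of its frames, innermost frame first.
  Stack : Lang → ℕ → Set
  Stack g n = List (Frame g n)

  plugS : ∀ {g n} → Stack g n → Exp g n → Exp g n
  plugS []       u = u
  plugS (f ∷ fs) u = plugS fs (plugF f u)

  renameF : ∀ {g m n} → (Fin m → Fin n) → Frame g m → Frame g n
  renameF ρ (app {l} t)     = app {l = l} (rename ρ t)
  renameF ρ (seq {l} t)     = seq {l = l} (rename ρ t)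
  renameF ρ (case {l} τ rs) = case {l = l} τ (renameᵃ ρ rs)

  substF : ∀ {g m n} → (Fin m → Exp g n) → Frame g m → Frame g n
  substF σ (app {l} t)     = app {l = l} (subst σ t)
  substF σ (seq {l} t)     = seq {l = l} (subst σ t)
  substF σ (case {l} τ rs) = case {l = l} τ (substᵃ σ rs)

  subst-plugF : ∀ {g m n} (σ : Fin m → Exp g n) f u →
                subst σ (plugF f u) ≡ plugF (substF σ f) (subst σ u)
  subst-plugF σ (app t)     u = refl
  subst-plugF σ (seq t)     u = refl
  subst-plugF σ (case τ rs) u = refl

  subst-plugS : ∀ {g m n} (σ : Fin m → Exp g n) fs u →
                subst σ (plugS fs u) ≡ plugS (List.map (substF σ) fs) (subst σ u)
  subst-plugS σ []       u = refl
  subst-plugS σ (f ∷ fs) u =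
    trans (subst-plugS σ fs (plugF f u)) (cong (plugS (List.map (substF σ) fs)) (subst-plugF σ f u))

  infix 4 _↦_ _↦⟨_⟩_
  -- The relation `⟶lcc` with congruence rules instead of an explicit reduction context, which makes
  -- determinism and closure under substitution plain inductions. `lcc⇒↦` and `↦⇒lcc` connect the
  -- two.
  data _↦_ {n} : Exp Λ n → Exp Λ n → Set where
    beta  : ∀ {s t} → app (lam s) t ↦ s [ t ∷ [] /x]
    case  : ∀ {τ c ss rs} → case τ (con τ c ss) rs ↦ alternative rs c [ ss /x]
    seq   : ∀ {v s} → Value v → seq v s ↦ s
    appˡ  : ∀ {s s′ t} → s ↦ s′ → app s t ↦ app s′ t
    seqˡ  : ∀ {s s′ t} → s ↦ s′ → seq s t ↦ seq s′ t
    caseˢ : ∀ {τ s s′ rs} → s ↦ s′ → case τ s rs ↦ case τ s′ rs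

  value-stuck : ∀ {n} {v e : Exp Λ n} → Value v → ¬ (v ↦ e)
  value-stuck (lam s)      ()
  value-stuck (con τ c ss) ()

  ↦-deterministic : ∀ {n} {s t u : Exp Λ n} → s ↦ t → s ↦ u → t ≡ u
  ↦-deterministic beta      beta      = refl
  ↦-deterministic case      case      = refl
  ↦-deterministic (seq _)   (seq _)   = refl
  ↦-deterministic (seq v)   (seqˡ r)  = ⊥-elim (value-stuck v r)
  ↦-deterministic (seqˡ r)  (seq v)   = ⊥-elim (value-stuck v r)
  ↦-deterministic (appˡ r)  (appˡ r′) = cong (λ s → app s _) (↦-deterministic r r′)
  ↦-deterministic (seqˡ r)  (seqˡ r′) = cong (λ s → seq s _) (↦-deterministic r r′)
  ↦-deterministic (caseˢ r) (caseˢ r′) = cong (λ s → case _ s _) (↦-deterministic r r′)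

  ↦-plugF : ∀ {n} (f : Frame Λ n) {s s′} → s ↦ s′ → plugF f s ↦ plugF f s′
  ↦-plugF (app t)     = appˡ
  ↦-plugF (seq t)     = seqˡ
  ↦-plugF (case τ rs) = caseˢ

  ↦-plugS : ∀ {n} (fs : Stack Λ n) {s s′} → s ↦ s′ → plugS fs s ↦ plugS fs s′
  ↦-plugS []       r = r
  ↦-plugS (f ∷ fs) r = ↦-plugS fs (↦-plugF f r)

  value-subst : ∀ {g m n} (σ : Fin m → Exp g n) {v} → Value v → Value (subst σ v)
  value-subst σ (lam s)      = lam _
  value-subst σ (con τ c ss) = con τ c _

  subst-[/x] : ∀ {m n k} (σ : Fin m → Exp Λ n) t (ss : Vec (Exp Λ m) k) →
               subst σ (t [ ss /x]) ≡ subst (lifts k σ) t [ subst* σ ss /x]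
  subst-[/x] {k = k} σ t ss = trans (subst-inst σ (lookup ss) t)
    (subst-cong (inst-cong (λ i → sym (lookup-subst* σ ss i))) (subst (lifts k σ) t))

  ↦-subst : ∀ {m n} (σ : Fin m → Exp Λ n) {s s′} → s ↦ s′ → subst σ s ↦ subst σ s′
  ↦-subst σ (beta {s} {t}) =
    transport (subst σ (app (lam s) t) ↦_) (sym (subst-[/x] σ s (t ∷ []))) beta
  ↦-subst σ (case {τ} {c} {ss} {rs}) =
    transport (subst σ (case τ (con τ c ss) rs) ↦_)
      (trans (cong (_[ subst* σ ss /x]) (alternative-subst σ rs c)) (sym (subst-[/x] σ (alternative rs c) ss))) case
  ↦-subst σ (seq v)   = seq (value-subst σ v)
  ↦-subst σ (appˡ r)  = appˡ (↦-subst σ r)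
  ↦-subst σ (seqˡ r)  = seqˡ (↦-subst σ r)
  ↦-subst σ (caseˢ r) = caseˢ (↦-subst σ r)

  data _↦⟨_⟩_ {n} (e : Exp Λ n) : ℕ → Exp Λ n → Set where
    []  : e ↦⟨ 0 ⟩ e
    _∷_ : ∀ {e′ e″ a} → e ↦ e′ → e′ ↦⟨ a ⟩ e″ → e ↦⟨ suc a ⟩ e″

  _⊕_ : ∀ {n a b} {s t u : Exp Λ n} → s ↦⟨ a ⟩ t → t ↦⟨ b ⟩ u → s ↦⟨ a + b ⟩ u
  []       ⊕ rs′ = rs′
  (r ∷ rs) ⊕ rs′ = r ∷ (rs ⊕ rs′)

  ↦*-subst : ∀ {m n a} (σ : Fin m → Exp Λ n) {s s′} → s ↦⟨ a ⟩ s′ → subst σ s ↦⟨ a ⟩ subst σ s′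
  ↦*-subst σ []       = []
  ↦*-subst σ (r ∷ rs) = ↦-subst σ r ∷ ↦*-subst σ rs

  ↦*-plugS : ∀ {n a} (fs : Stack Λ n) {s s′} → s ↦⟨ a ⟩ s′ → plugS fs s ↦⟨ a ⟩ plugS fs s′
  ↦*-plugS fs []       = []
  ↦*-plugS fs (r ∷ rs) = ↦-plugS fs r ∷ ↦*-plugS fs rs

  infix 4 _⇓[_]
  data _⇓[_] {n} : Exp Λ n → ℕ → Set where
    done : ∀ {v} → Value v → v ⇓[ 0 ]
    step : ∀ {e e′ m} → e ↦ e′ → e′ ⇓[ m ] → e ⇓[ suc m ]

  ⇓-expand : ∀ {n a m} {e e′ : Exp Λ n} → e ↦⟨ a ⟩ e′ → e′ ⇓[ m ] → e ⇓[ a + m ]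
  ⇓-expand []       d = d
  ⇓-expand (r ∷ rs) d = step r (⇓-expand rs d)

  -- Determinism makes the given sequence a prefix of the evaluation, so the remaining number of
  -- steps is known exactly and not merely bounded.
  ⇓-reduce : ∀ {n a m} {e e′ : Exp Λ n} → e ↦⟨ a ⟩ e′ → e ⇓[ m ] → ∃ λ m′ → e′ ⇓[ m′ ] × m ≡ a + m′
  ⇓-reduce []       d          = _ , d , refl
  ⇓-reduce (r ∷ rs) (done v)   = ⊥-elim (value-stuck v r)
  ⇓-reduce (r ∷ rs) (step r′ d) with refl ← ↦-deterministic r r′ with ⇓-reduce rs d
  ... | m′ , d′ , eq = m′ , d′ , cong suc eq

  -- Frames are strict: the evaluation can consume the frame only when its head has become a value.
  ⇓-plugF : ∀ {n m} (f : Frame Λ n) {e} → plugF f e ⇓[ m ] → ∃ λ m′ → e ⇓[ m′ ]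
  ⇓-plugF (app t)     (step beta d)      = 0 , done (lam _)
  ⇓-plugF (app t)     (step (appˡ r) d)  = _ , step r (proj₂ (⇓-plugF (app t) d))
  ⇓-plugF (seq t)     (step (seq v) d)   = 0 , done v
  ⇓-plugF (seq t)     (step (seqˡ r) d)  = _ , step r (proj₂ (⇓-plugF (seq t) d))
  ⇓-plugF (case τ rs) (step case d)      = 0 , done (con _ _ _)
  ⇓-plugF (case τ rs) (step (caseˢ r) d) = _ , step r (proj₂ (⇓-plugF (case τ rs) d))

  ⇓-plugS : ∀ {n m} (fs : Stack Λ n) {e} → plugS fs e ⇓[ m ] → ∃ λ m′ → e ⇓[ m′ ]
  ⇓-plugS []       d = _ , d
  ⇓-plugS (f ∷ fs) d = ⇓-plugF f (proj₂ (⇓-plugS fs d))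

  plugA-↦ : ∀ {n} (A : ACtx Λ n) {s s′} → s ↦ s′ → plugA A s ↦ plugA A s′
  plugA-↦ hole        r = r
  plugA-↦ (app A t)   r = appˡ (plugA-↦ A r)
  plugA-↦ (case τ A rs) r = caseˢ (plugA-↦ A r)
  plugA-↦ (seq A t)   r = seqˡ (plugA-↦ A r)

  lcc⇒↦ : ∀ {n} {s t : Exp Λ n} → s ⟶lcc t → s ↦ t
  lcc⇒↦ (beta R)  = plugA-↦ R beta
  lcc⇒↦ (case R)  = plugA-↦ R case
  lcc⇒↦ (seq R v) = plugA-↦ R (seq v)

  frame-lcc : ∀ {n} (B : ACtx Λ n → ACtx Λ n) (K : Exp Λ n → Exp Λ n) →
              (∀ A u → plugA (B A) u ≡ K (plugA A u)) → ∀ {s t} → s ⟶lcc t → K s ⟶lcc K t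
  frame-lcc B K e (beta R)  = transport₂ _⟶lcc_ (e R _) (e R _) (beta (B R))
  frame-lcc B K e (case R)  = transport₂ _⟶lcc_ (e R _) (e R _) (case (B R))
  frame-lcc B K e (seq R v) = transport₂ _⟶lcc_ (e R _) (e R _) (seq (B R) v)

  ↦⇒lcc : ∀ {n} {s t : Exp Λ n} → s ↦ t → s ⟶lcc t
  ↦⇒lcc beta      = beta hole
  ↦⇒lcc case      = case hole
  ↦⇒lcc (seq v)   = seq hole v
  ↦⇒lcc (appˡ r)  = frame-lcc (λ A → app A _) (λ s → app s _) (λ _ _ → refl) (↦⇒lcc r)
  ↦⇒lcc (seqˡ r)  = frame-lcc (λ A → seq A _) (λ s → seq s _) (λ _ _ → refl) (↦⇒lcc r)
  ↦⇒lcc (caseˢ r) = frame-lcc (λ A → case _ A _) (λ s → case _ s _) (λ _ _ → refl) (↦⇒lcc r)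

  ↓lcc⇒⇓ : ∀ {n} {s : Exp Λ n} → s ↓lcc → ∃ λ m → s ⇓[ m ]
  ↓lcc⇒⇓ (v , ε , val)      = 0 , done val
  ↓lcc⇒⇓ (v , r ◅ rs , val) = _ , step (lcc⇒↦ r) (proj₂ (↓lcc⇒⇓ (v , rs , val)))

  ⇓⇒↓lcc : ∀ {n m} {s : Exp Λ n} → s ⇓[ m ] → s ↓lcc
  ⇓⇒↓lcc (done val) = _ , ε , val
  ⇓⇒↓lcc (step r d) with ⇓⇒↓lcc d
  ... | v , rs , val = v , ↦⇒lcc r ◅ rs , val

  -- Unfolding the translation of a letrec

  subst-lams : ∀ {m n} k (σ : Fin m → Exp Λ n) s → subst σ (lams k s) ≡ lams k (subst (lifts k σ) s)
  subst-lams zero    σ s = refl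
  subst-lams (suc k) σ s = trans (subst-lams k σ (lam s))
    -- `lifts 1 (lifts k σ)` and `lifts (suc k) σ` agree only pointwise.
    (cong (λ s → lams k (lam s)) (subst-cong (λ { zero → refl ; (suc x) → refl }) s))

  subst-apps : ∀ {m n k} (σ : Fin m → Exp Λ n) f (ss : Vec _ k) →
               subst σ (apps f ss) ≡ apps (subst σ f) (subst* σ ss)
  subst-apps σ f []       = refl
  subst-apps σ f (s ∷ ss) = cong (λ t → app t (subst σ s)) (subst-apps σ f ss)

  subst*-tabulate : ∀ {g m n k} (σ : Fin m → Exp g n) (f : Fin k → Exp g m) →
                    subst* σ (tabulate f) ≡ tabulate (subst σ ∘ f)
  subst*-tabulate {k = zero}  σ f = refl
  subst*-tabulate {k = suc k} σ f = cong (subst σ (f zero) ∷_) (subst*-tabulate σ (f ∘ suc))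

  subst*-selfapps : ∀ {m n j k} (σ : Fin m → Exp Λ n) (us : Vec (Exp Λ m) j) (vs : Vec (Exp Λ m) k) →
                    subst* σ (Vec.map (λ x → apps x vs) us) ≡ Vec.map (λ x → apps x (subst* σ vs)) (subst* σ us)
  subst*-selfapps σ []       vs = refl
  subst*-selfapps σ (u ∷ us) vs = cong₂ _∷_ (subst-apps σ u vs) (subst*-selfapps σ us vs)

  subst-xs : ∀ {m n k} (σ : Fin m → Exp Λ n) → subst* (lifts k σ) (xs k) ≡ xs k
  subst-xs {k = k} σ = trans (subst*-tabulate (lifts k σ) _) (tabulate-cong (lifts-↑ˡ σ))

  subst-lifts-weaken : ∀ {m n} k (σ : Fin m → Exp Λ n) s →
                       subst (lifts k σ) (weaken k s) ≡ weaken k (subst σ s)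
  subst-lifts-weaken k σ s =
    trans (subst-rename (lifts-↑ʳ k σ) s) (sym (rename-subst (λ _ → refl) s))

  subst-knot : ∀ {m n} k (σ : Fin m → Exp Λ n) s → subst σ (knot k s) ≡ knot k (subst (lifts k σ) s)
  subst-knot k σ s = trans (subst-lams k σ _) (cong (lams k)
    (trans (subst-apps (lifts k σ) (weaken k (lams k s)) _)
      (cong₂ apps (trans (subst-lifts-weaken k σ (lams k s)) (cong (weaken k) (subst-lams k σ s)))
                  (trans (subst*-selfapps (lifts k σ) (xs k) (xs k))
                         (cong (λ us → Vec.map (λ x → apps x us) us) (subst-xs σ))))))

  subst-letrec : ∀ {m n k} (σ : Fin m → Exp Λ n) t (ss : Vec _ k) →
                 subst σ (apps (knot k t) (Vec.map (knot k) ss)) ≡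
                 apps (knot k (subst (lifts k σ) t)) (Vec.map (knot k) (subst* (lifts k σ) ss))
  subst-letrec {k = k} σ t ss = trans (subst-apps σ (knot k t) _)
    (cong₂ apps (subst-knot k σ t) (knots ss))
    where
    knots : ∀ {j} (ss : Vec _ j) →
            subst* σ (Vec.map (knot k) ss) ≡ Vec.map (knot k) (subst* (lifts k σ) ss)
    knots []       = refl
    knots (s ∷ ss) = cong₂ _∷_ (subst-knot k σ s) (knots ss)

  rename-letrec : ∀ {m n k} (ρ : Fin m → Fin n) t (ss : Vec _ k) →
                  rename ρ (apps (knot k t) (Vec.map (knot k) ss)) ≡
                  apps (knot k (rename (lift k ρ) t)) (Vec.map (knot k) (rename* (lift k ρ) ss))
  rename-letrec {k = k} ρ t ss = trans (rename≗subst ρ (apps (knot k t) (Vec.map (knot k) ss)))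
    (trans (subst-letrec (λ x → var (ρ x)) t ss)
      (cong₂ (λ t ss → apps (knot k t) (Vec.map (knot k) ss))
        (subst-var (lifts-var k (λ _ → refl)) t) (subst-var* (lifts-var k (λ _ → refl)) ss)))

  mutual
    N-rename : ∀ {m n} (ρ : Fin m → Fin n) s → N (rename ρ s) ≡ rename ρ (N s)
    N-rename ρ (var x)      = refl
    N-rename ρ (app s t)    = cong₂ app (N-rename ρ s) (N-rename ρ t)
    N-rename ρ (lam s)      = cong lam (N-rename _ s)
    N-rename ρ (letrec {p = p} E t) =
      trans (cong₂ (λ t ss → apps (knot (suc p) t) (Vec.map (knot (suc p)) ss)) (N-rename _ t) (N*-rename _ E))
            (sym (rename-letrec ρ (N t) (N* E)))
    N-rename ρ (con τ c ss) = cong (con τ c) (N*-rename ρ ss)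
    N-rename ρ (seq s t)    = cong₂ seq (N-rename ρ s) (N-rename ρ t)
    N-rename ρ (case τ s rs) = cong₂ (case τ) (N-rename ρ s) (Nᵃ-rename ρ rs)

    N*-rename : ∀ {m n k} (ρ : Fin m → Fin n) (ss : Vec _ k) → N* (rename* ρ ss) ≡ rename* ρ (N* ss)
    N*-rename ρ []       = refl
    N*-rename ρ (s ∷ ss) = cong₂ _∷_ (N-rename ρ s) (N*-rename ρ ss)

    Nᵃ-rename : ∀ {m n ks} (ρ : Fin m → Fin n) (rs : Alts 𝓛 m ks) →
                Nᵃ (renameᵃ ρ rs) ≡ renameᵃ ρ (Nᵃ rs)
    Nᵃ-rename ρ []       = refl
    Nᵃ-rename ρ (r ∷ rs) = cong₂ _∷_ (N-rename _ r) (Nᵃ-rename ρ rs)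

  N-lifts : ∀ {m n} k {σ : Fin m → Exp 𝓛 n} {τ : Fin m → Exp Λ n} → N ∘ σ ≗ τ →
            N ∘ lifts k σ ≗ lifts k τ
  N-lifts zero    e x       = e x
  N-lifts (suc k) e zero    = refl
  N-lifts (suc k) {σ} e (suc x) = trans (N-rename suc (lifts k σ x)) (cong (weaken 1) (N-lifts k e x))

  mutual
    N-subst : ∀ {m n} {σ : Fin m → Exp 𝓛 n} {τ : Fin m → Exp Λ n} → N ∘ σ ≗ τ → ∀ s →
              N (subst σ s) ≡ subst τ (N s)
    N-subst e (var x)      = e x
    N-subst e (app s t)    = cong₂ app (N-subst e s) (N-subst e t)
    N-subst e (lam s)      = cong lam (N-subst (N-lifts 1 e) s)
    N-subst {τ = τ} e (letrec {p = p} E t) =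
      trans (cong₂ (λ t ss → apps (knot (suc p) t) (Vec.map (knot (suc p)) ss))
                   (N-subst (N-lifts (suc p) e) t) (N*-subst (N-lifts (suc p) e) E))
            (sym (subst-letrec τ (N t) (N* E)))
    N-subst e (con τ c ss) = cong (con τ c) (N*-subst e ss)
    N-subst e (seq s t)    = cong₂ seq (N-subst e s) (N-subst e t)
    N-subst e (case τ s rs) = cong₂ (case τ) (N-subst e s) (Nᵃ-subst e rs)

    N*-subst : ∀ {m n k} {σ : Fin m → Exp 𝓛 n} {τ : Fin m → Exp Λ n} → N ∘ σ ≗ τ →
               (ss : Vec _ k) → N* (subst* σ ss) ≡ subst* τ (N* ss)
    N*-subst e []       = refl
    N*-subst e (s ∷ ss) = cong₂ _∷_ (N-subst e s) (N*-subst e ss)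

    Nᵃ-subst : ∀ {m n ks} {σ : Fin m → Exp 𝓛 n} {τ : Fin m → Exp Λ n} → N ∘ σ ≗ τ →
               (rs : Alts 𝓛 m ks) → Nᵃ (substᵃ σ rs) ≡ substᵃ τ (Nᵃ rs)
    Nᵃ-subst e []       = refl
    Nᵃ-subst e (r ∷ rs) = cong₂ _∷_ (N-subst (N-lifts _ e) r) (Nᵃ-subst e rs)

  lookup-N* : ∀ {n k} (ss : Vec (Exp 𝓛 n) k) i → lookup (N* ss) i ≡ N (lookup ss i)
  lookup-N* (s ∷ ss) zero    = refl
  lookup-N* (s ∷ ss) (suc i) = lookup-N* ss i

  alternative-N : ∀ {n ks} (rs : Alts 𝓛 n ks) c → alternative (Nᵃ rs) c ≡ N (alternative rs c)
  alternative-N (r ∷ rs) zero    = refl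
  alternative-N (r ∷ rs) (suc c) = alternative-N rs c

  N-inst : ∀ {n k} (f : Fin k → Exp 𝓛 n) → N ∘ inst f ≗ inst (N ∘ f)
  N-inst {k = k} f = inst-unique (λ i → cong N (inst-↑ˡ f i)) (λ j → cong N (inst-↑ʳ k f j))

  N-[/x] : ∀ {n k} (t : Exp 𝓛 (k + n)) (ss : Vec (Exp 𝓛 n) k) → N (t [ ss /x]) ≡ N t [ N* ss /x]
  N-[/x] t ss =
    N-subst (λ x → trans (N-inst (lookup ss) x) (inst-cong (λ i → sym (lookup-N* ss i)) x)) t

  -- `apps` passes the head of the vector last, to the innermost λ, which binds index 0. Hence the
  -- tail accounts for the first steps, and the final β is fused with the substitution made so far.
  apps-lams : ∀ {n} k (s : Exp Λ (k + n)) (es : Vec (Exp Λ n) k) →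
              apps (lams k s) es ↦⟨ k ⟩ subst (inst (lookup es)) s
  apps-lams zero    s []       = transport (s ↦⟨ 0 ⟩_) (sym (subst-id (λ _ → refl) s)) []
  apps-lams {n} (suc k) s (e ∷ es) =
    transport (λ a → apps (lams (suc k) s) (e ∷ es) ↦⟨ a ⟩ subst (inst (lookup (e ∷ es))) s) (+-comm k 1)
      (↦*-plugS (app e ∷ []) (apps-lams k (lam s) es) ⊕ last)
    where
    f : Fin (suc k + n) → Exp Λ n
    f = inst (lookup (e ∷ es))
    inst-suc : ∀ x → inst (lookup es) x ≡ inst (lookup (e ∷ es)) (suc x)
    inst-suc = splitCases k
      (λ i → trans (inst-↑ˡ (lookup es) i) (sym (inst-↑ˡ (lookup (e ∷ es)) (suc i))))
      (λ j → trans (inst-↑ʳ k (lookup es) j) (sym (inst-↑ʳ (suc k) (lookup (e ∷ es)) j)))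
    merge : subst (lifts 1 (inst (lookup es))) s [ e ∷ [] /x] ≡ subst f s
    merge =
      subst-∘ {υ = f} (λ { zero → refl ; (suc x) → trans (subst-weaken (lookup (e ∷ [])) (inst (lookup es) x)) (inst-suc x) }) s
    last : app (subst (inst (lookup es)) (lam s)) e ↦⟨ 1 ⟩ subst f s
    last = transport (app (subst (inst (lookup es)) (lam s)) e ↦⟨ 1 ⟩_) merge (beta ∷ [])

  -- In N (letrec E t) the argument Uᵢ = Xᵢ′ X₁′ … Xₖ′ of λx₁.⋯λxₖ.N t is itself
  -- the translation of letrec E Eᵢ.
  solution : ∀ {n p} → Vec (Exp 𝓛 (suc p + n)) (suc p) → Fin (suc p) → Exp Λ n
  solution E i = N (letrec E (lookup E i))

  -- Two rounds of β, one step per binding in each. The first passes the knots to the outer λs, the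
  -- second passes the self-applications of the knots, which are the terms `solution E i`
  -- themselves. The result is therefore reached exactly, with no reduction left inside the
  -- substituted terms.
  N-unfold : ∀ {n p} (E : Vec (Exp 𝓛 (suc p + n)) (suc p)) t →
             N (letrec E t) ↦⟨ suc p + suc p ⟩ subst (inst (solution E)) (N t)
  N-unfold {n} {p} E t =
    transport (apps (lams (suc p) B) X ↦⟨ suc p ⟩_) body (apps-lams (suc p) B X) ⊕
    transport (apps (lams (suc p) (N t)) (Vec.map (λ x → apps x X) X) ↦⟨ suc p ⟩_) (subst-cong (inst-cong entry) (N t)) (apps-lams (suc p) (N t) (Vec.map (λ x → apps x X) X))
    where
    X : Vec (Exp Λ n) (suc p)
    X = Vec.map (knot (suc p)) (N* E)
    ys : Vec (Exp Λ (suc p + n)) (suc p)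
    ys = xs (suc p)
    xs-X : subst* (inst (lookup X)) ys ≡ X
    xs-X = trans (subst*-tabulate (inst (lookup X)) (λ i → var (i ↑ˡ n)))
             (trans (tabulate-cong (inst-↑ˡ (lookup X))) (tabulate∘lookup X))
    B : Exp Λ (suc p + n)
    B = apps (weaken (suc p) (lams (suc p) (N t))) (Vec.map (λ x → apps x ys) ys)
    body : subst (inst (lookup X)) B ≡
           apps (lams (suc p) (N t)) (Vec.map (λ x → apps x X) X)
    body =
      trans (subst-apps (inst (lookup X)) (weaken (suc p) (lams (suc p) (N t))) (Vec.map (λ x → apps x ys) ys))
      (cong₂ apps (subst-weaken (lookup X) (lams (suc p) (N t)))
        (trans (subst*-selfapps (inst (lookup X)) ys ys) (cong (λ us → Vec.map (λ x → apps x us) us) xs-X)))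
    entry : lookup (Vec.map (λ x → apps x X) X) ≗ solution E
    entry i = trans (lookup-map i (λ x → apps x X) X)
      (cong (λ x → apps x X) (trans (lookup-map i (knot (suc p)) (N* E)) (cong (knot (suc p)) (lookup-N* E i))))

  -- Convergence in L_name

  ⇓-meet : ∀ {n a b c m} {s s′ u u′ e : Exp Λ n} (K : Stack Λ n) →
           s ↦⟨ c ⟩ plugS K u → s′ ↦⟨ c ⟩ plugS K u′ → u ↦⟨ a ⟩ e → u′ ↦⟨ b ⟩ e →
           s ⇓[ m ] → ∃ λ m₀ → m ≡ a + m₀ × s′ ⇓[ b + m₀ ]
  ⇓-meet {a = a} {b} {c} {s′ = s′} K rs rs′ u→e u′→e d with ⇓-reduce rs d
  ... | m₁ , d₁ , refl with ⇓-reduce (↦*-plugS K u→e) d₁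
  ... | m₂ , d₂ , refl =
    -- The c steps before and the m₂ steps after the meeting are common to both evaluations; only a
    -- is exchanged for b.
    c + m₂ , swap a , transport (s′ ⇓[_]) (swap b) (⇓-expand rs′ (⇓-expand (↦*-plugS K u′→e) d₂))
    where
    swap : ∀ x → c + (x + m₂) ≡ x + (c + m₂)
    swap x = trans (sym (+-assoc c x m₂)) (trans (cong (_+ m₂) (+-comm c x)) (+-assoc x c m₂))

  NF : ∀ {n} → Frame 𝓛 n → Frame Λ n
  NF (app t)     = app (N t)
  NF (seq t)     = seq (N t)
  NF (case τ rs) = case τ (Nᵃ rs)

  N-plugF : ∀ {n} (f : Frame 𝓛 n) u → N (plugF f u) ≡ plugF (NF f) (N u)
  N-plugF (app t)     u = refl
  N-plugF (seq t)     u = refl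
  N-plugF (case τ rs) u = refl

  N-plugS : ∀ {n} (fs : Stack 𝓛 n) u → N (plugS fs u) ≡ plugS (List.map NF fs) (N u)
  N-plugS []       u = refl
  N-plugS (f ∷ fs) u = trans (N-plugS fs (plugF f u)) (cong (plugS (List.map NF fs)) (N-plugF f u))

  -- An `ACtx` has its outermost frame first and a stack its innermost, so the conversions reverse
  -- the order with an accumulator.
  toA : ∀ {g n} → Stack g n → ACtx g n → ACtx g n
  toA []                    A = A
  toA (app {l} t ∷ fs)      A = toA fs (app {l = l} A t)
  toA (seq {l} t ∷ fs)      A = toA fs (seq {l = l} A t)
  toA (case {l} τ rs ∷ fs)  A = toA fs (case {l = l} τ A rs)

  plugA-toA : ∀ {g n} (fs : Stack g n) A u → plugA (toA fs A) u ≡ plugS fs (plugA A u)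
  plugA-toA []               A u = refl
  plugA-toA (app t ∷ fs)     A u = plugA-toA fs (app A t) u
  plugA-toA (seq t ∷ fs)     A u = plugA-toA fs (seq A t) u
  plugA-toA (case τ rs ∷ fs) A u = plugA-toA fs (case τ A rs) u

  fromA : ∀ {g n} → ACtx g n → Stack g n → Stack g n
  fromA hole                fs = fs
  fromA (app {l} A t)       fs = fromA A (app {l = l} t ∷ fs)
  fromA (seq {l} A t)       fs = fromA A (seq {l = l} t ∷ fs)
  fromA (case {l} τ A rs)   fs = fromA A (case {l = l} τ rs ∷ fs)

  plugS-fromA : ∀ {g n} (A : ACtx g n) fs u → plugS (fromA A fs) u ≡ plugS fs (plugA A u)
  plugS-fromA hole          fs u = refl
  plugS-fromA (app A t)     fs u = plugS-fromA A (app t ∷ fs) u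
  plugS-fromA (seq A t)     fs u = plugS-fromA A (seq t ∷ fs) u
  plugS-fromA (case τ A rs) fs u = plugS-fromA A (case τ rs ∷ fs) u

  infixr 5 _∘L_
  _∘L_ : ∀ {j k n} → LCtx j n → LCtx k j → LCtx k n
  hole       ∘L L′ = L′
  letrec E L ∘L L′ = letrec E (L ∘L L′)

  plugL-∘ : ∀ {j k n} (L : LCtx j n) (L′ : LCtx k j) u → plugL (L ∘L L′) u ≡ plugL L (plugL L′ u)
  plugL-∘ hole         L′ u = refl
  plugL-∘ (letrec E L) L′ u = cong (letrec E) (plugL-∘ L L′ u)

  -- The substitution that reaches the focus once all letrecs of `L` are unfolded. The solutions of
  -- an inner letrec mention outer variables, so the outer substitution is applied to them
  -- afterwards.
  closing : ∀ {k n} → LCtx k n → Fin k → Exp Λ n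
  closing hole         x = var x
  closing (letrec E L) x = subst (inst (solution E)) (closing L x)

  depth : ∀ {k n} → LCtx k n → ℕ
  depth hole                 = 0
  depth (letrec {p = p} E L) = (suc p + suc p) + depth L

  N-plugL : ∀ {k n} (L : LCtx k n) u → N (plugL L u) ↦⟨ depth L ⟩ subst (closing L) (N u)
  N-plugL hole         u = transport (N u ↦⟨ 0 ⟩_) (sym (subst-id (λ _ → refl) (N u))) []
  N-plugL (letrec E L) u = N-unfold E (plugL L u) ⊕
    transport (subst (inst (solution E)) (N (plugL L u)) ↦⟨ depth L ⟩_) (subst-∘ (λ _ → refl) (N u))
              (↦*-subst (inst (solution E)) (N-plugL L u))

  closing-∘ : ∀ {j k n} (L : LCtx j n) (L′ : LCtx k j) x →
              closing (L ∘L L′) x ≡ subst (closing L) (closing L′ x)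
  closing-∘ hole         L′ x = sym (subst-id (λ _ → refl) _)
  closing-∘ (letrec E L) L′ x =
    trans (cong (subst (inst (solution E))) (closing-∘ L L′ x)) (subst-∘ (λ _ → refl) (closing L′ x))

  closing-wkL : ∀ {k n} (L : LCtx k n) x → closing L (wkL L x) ≡ var x
  closing-wkL hole                 x = refl
  closing-wkL (letrec {p = p} E L) x =
    trans (cong (subst (inst (solution E))) (closing-wkL L (suc p ↑ʳ x))) (inst-↑ʳ (suc p) (solution E) x)

  closedS : ∀ {k n} → LCtx k n → Stack 𝓛 k → Stack Λ n
  closedS L fs = List.map (substF (closing L)) (List.map NF fs)

  N-focus : ∀ {k n} (L : LCtx k n) fs u →
            N (plugL L (plugS fs u)) ↦⟨ depth L ⟩ plugS (closedS L fs) (subst (closing L) (N u))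
  N-focus L fs u = transport (N (plugL L (plugS fs u)) ↦⟨ depth L ⟩_)
    (trans (cong (subst (closing L)) (N-plugS fs u)) (subst-plugS (closing L) (List.map NF fs) (N u)))
    (N-plugL L (plugS fs u))

  -- A common reduct of the two focused expressions under the letrecs of `L`. Unfolding `L` costs
  -- both sides the same, so `meet⇓` turns a and b into the exact difference of the evaluation
  -- lengths.
  data Meet {k n} (L : LCtx k n) (a b : ℕ) (u u′ : Exp 𝓛 k) : Set where
    meet : ∀ e → subst (closing L) (N u) ↦⟨ a ⟩ e → subst (closing L) (N u′) ↦⟨ b ⟩ e →
           Meet L a b u u′

  meet⇓ : ∀ {k n a b m} (L : LCtx k n) fs {u u′} → Meet L a b u u′ → N (plugL L (plugS fs u)) ⇓[ m ] →
          ∃ λ m₀ → m ≡ a + m₀ × N (plugL L (plugS fs u′)) ⇓[ b + m₀ ]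
  meet⇓ L fs {u} {u′} (meet e rs rs′) =
    ⇓-meet (closedS L fs) (N-focus L fs u) (N-focus L fs u′) rs rs′

  meet-sym : ∀ {k n a b} (L : LCtx k n) {u u′} → Meet L a b u u′ → Meet L b a u′ u
  meet-sym L (meet e rs rs′) = meet e rs′ rs

  value-N : ∀ {n} {v : Exp 𝓛 n} → Value v → Value (N v)
  value-N (lam s)      = lam (N s)
  value-N (con τ c ss) = con τ c (N* ss)

  meet-step : ∀ {k n} (L : LCtx k n) {u u′} → N u ↦ N u′ → Meet L 1 0 u u′
  meet-step L r = meet _ (↦-subst (closing L) r ∷ []) []

  meet-beta : ∀ {k n} (L : LCtx k n) {s t} → Meet L 1 0 (app (lam s) t) (s [ t ∷ [] /x])
  meet-beta L {s} {t} = meet-step L (transport (N (app (lam s) t) ↦_) (sym (N-[/x] s (t ∷ []))) beta)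

  meet-case : ∀ {k n} (L : LCtx k n) {τ c ss rs} →
              Meet L 1 0 (case τ (con τ c ss) rs) (alternative rs c [ ss /x])
  meet-case L {τ} {c} {ss} {rs} = meet-step L (transport (N (case τ (con τ c ss) rs) ↦_)
    (trans (cong (_[ N* ss /x]) (alternative-N rs c)) (sym (N-[/x] (alternative rs c) ss))) case)

  meet-seq : ∀ {k n} (L : LCtx k n) {v s} → Value v → Meet L 1 0 (seq v s) s
  meet-seq L v = meet-step L (seq (value-N v))

  inst-weakenF : ∀ {n k} (f : Fin k → Exp Λ n) (F : Frame Λ n) →
                 substF (inst f) (renameF (k ↑ʳ_) F) ≡ F
  inst-weakenF f (app t)     = cong app (subst-weaken f t)
  inst-weakenF f (seq t)     = cong seq (subst-weaken f t)
  inst-weakenF {k = k} f (case τ rs) = cong (case τ) (subst-weakenᵃ rs)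
    where
    subst-weakenᵃ : ∀ {ks} (rs : Alts Λ _ ks) → substᵃ (inst f) (weakenᵃ k rs) ≡ rs
    subst-weakenᵃ rs = trans (subst-renameᵃ (inst-↑ʳ k f) rs)
      (trans (subst-varᵃ (λ _ → refl) rs) (rename-idᵃ (λ _ → refl) rs))

  NF-rename : ∀ {m n} (ρ : Fin m → Fin n) F → NF (renameF ρ F) ≡ renameF ρ (NF F)
  NF-rename ρ (app t)     = cong app (N-rename ρ t)
  NF-rename ρ (seq t)     = cong seq (N-rename ρ t)
  NF-rename ρ (case τ rs) = cong (case τ) (Nᵃ-rename ρ rs)

  -- The frame was weakened when it moved below the letrec, so the solutions do not enter it and
  -- both sides unfold to the same term. They do so in equally many steps, which is why lapp, lcase
  -- and lseq leave the count unchanged.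
  meet-lift : ∀ {k n p} (L : LCtx k n) (F : Frame 𝓛 k) {E : Vec (Exp 𝓛 (suc p + k)) (suc p)} {s} →
              Meet L (suc p + suc p) (suc p + suc p)
                   (plugF F (letrec E s)) (letrec E (plugF (renameF (suc p ↑ʳ_) F) s))
  meet-lift {p = p} L F {E} {s} = meet _
    (↦*-subst (closing L) (transport (_↦⟨ suc p + suc p ⟩ plugF (NF F) (subst f (N s))) (sym (N-plugF F (letrec E s)))
      (↦*-plugS (NF F ∷ []) (N-unfold E s))))
    (↦*-subst (closing L) (transport (N (letrec E (plugF F′ s)) ↦⟨ suc p + suc p ⟩_)
      (trans (cong (subst f) (N-plugF F′ s))
        (trans (subst-plugF f (NF F′) (N s))
          (cong (λ G → plugF G (subst f (N s))) (trans (cong (substF f) (NF-rename _ F)) (inst-weakenF (solution E) (NF F))))))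
      (N-unfold E (plugF F′ s))))
    where
    f  = inst (solution E)
    F′ = renameF (suc p ↑ʳ_) F

  closing-↑ˡ : ∀ {j k n p} (L₁ : LCtx j n) (E : Vec (Exp 𝓛 (suc p + j)) (suc p)) (L₂ : LCtx k (suc p + j)) x →
               closing (L₁ ∘L letrec E L₂) (wkL L₂ x) ≡ subst (closing L₁) (inst (solution E) x)
  closing-↑ˡ L₁ E L₂ x = trans (closing-∘ L₁ (letrec E L₂) (wkL L₂ x))
    (cong (λ e → subst (closing L₁) (subst (inst (solution E)) e)) (closing-wkL L₂ x))

  -- After closing, the variable is the term `solution E x`, whose unfolding leads to the closed
  -- copy of the binding. The copy on the right is there already, so gcp saves precisely one
  -- unfolding.
  meet-gcp : ∀ {j k n p} (L₁ : LCtx j n) (E : Vec (Exp 𝓛 (suc p + j)) (suc p)) (L₂ : LCtx k (suc p + j)) x →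
             Meet (L₁ ∘L letrec E L₂) (suc p + suc p) 0 (var (wkL L₂ (x ↑ˡ j))) (rename (wkL L₂) (lookup E x))
  meet-gcp {j} {p = p} L₁ E L₂ x = meet _
    (transport (_↦⟨ suc p + suc p ⟩ subst (closing L₁) (subst (inst (solution E)) (N (lookup E x))))
      (sym (trans (closing-↑ˡ L₁ E L₂ (x ↑ˡ j)) (cong (subst (closing L₁)) (inst-↑ˡ (solution E) x))))
      (↦*-subst (closing L₁) (N-unfold E (lookup E x))))
    (transport (_↦⟨ 0 ⟩ subst (closing L₁) (subst (inst (solution E)) (N (lookup E x))))
      (sym (trans (cong (subst _) (N-rename (wkL L₂) (lookup E x)))
        (trans (subst-rename (closing-↑ˡ L₁ E L₂) (N (lookup E x))) (sym (subst-∘ (λ _ → refl) (N (lookup E x)))))))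
      [])

  name-reflects : ∀ {n} {s s′ : Exp 𝓛 n} → s ⟶name s′ → ∀ {m} → N s′ ⇓[ m ] → ∃ λ m′ → N s ⇓[ m′ ]
  name-reflects {n} r d = go r d
    where
    inR : ∀ {k a b m} (R : RCtx k n) {u u′} → Meet (proj₁ R) a b u u′ → N (plugR R u′) ⇓[ m ] →
          ∃ λ m′ → N (plugR R u) ⇓[ m′ ]
    inR {m = m} (L , A) {u} {u′} M d with
      meet⇓ L (fromA A []) (meet-sym L M) (transport (λ e → N (plugL L e) ⇓[ m ]) (sym (plugS-fromA A [] u′)) d)
    ... | m₀ , _ , d′ = _ , transport (λ e → N (plugL L e) ⇓[ _ ]) (plugS-fromA A [] u) d′

    go : ∀ {s s′ m} → s ⟶name s′ → N s′ ⇓[ m ] → ∃ λ m′ → N s ⇓[ m′ ]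
    go (beta R)  d = inR R (meet-beta (proj₁ R)) d
    go (gcp L {E} {x} (L₂ , A)) d =
      let m , d′ = inR (L ∘L letrec E L₂ , A) (meet-gcp L E L₂ x)
                      (transport (λ e → N e ⇓[ _ ]) (sym (plugL-∘ L (letrec E L₂) _)) d)
      in m , transport (λ e → N e ⇓[ m ]) (plugL-∘ L (letrec E L₂) _) d′
    go (lapp R {t = t})  d = inR R (meet-lift (proj₁ R) (app t)) d
    go (lcase R {rs = rs}) d = inR R (meet-lift (proj₁ R) (case _ rs)) d
    go (lseq R {t = t})  d = inR R (meet-lift (proj₁ R) (seq t)) d
    go (seq R v) d = inR R (meet-seq (proj₁ R) v) d
    go (case R)  d = inR R (meet-case (proj₁ R)) d

  ↓name⇒N⇓ : ∀ {n} {s : Exp 𝓛 n} → s ↓name → ∃ λ m → N s ⇓[ m ]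
  ↓name⇒N⇓ (_ , ε , L[v] L v)  =
    _ , ⇓-expand (N-plugL L _) (done (value-subst (closing L) (value-N v)))
  ↓name⇒N⇓ (v , r ◅ rs , ans) = name-reflects r (proj₂ (↓name⇒N⇓ (v , rs , ans)))

  data VarView {k n} (L : LCtx k n) (x : Fin k) : Set where
    free  : ∀ v → x ≡ wkL L v → VarView L x
    bound : ∀ {j p} (L₁ : LCtx j n) (E : Vec (Exp 𝓛 (suc p + j)) (suc p)) (L₂ : LCtx k (suc p + j)) i →
            L ≡ L₁ ∘L letrec E L₂ → x ≡ wkL L₂ (i ↑ˡ j) → VarView L x

  varView : ∀ {k n} (L : LCtx k n) x → VarView L x
  varView hole x = free x refl
  varView (letrec {p = p} E L) x with varView L x
  ... | bound L₁ E′ L₂ i e e′ = bound (letrec E L₁) E′ L₂ i (cong (letrec E) e) e′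
  ... | free v refl with splitAt (suc p) v in eq
  ...   | inj₁ i = bound hole E L i refl (cong (wkL L) (sym (splitAt⁻¹-↑ˡ eq)))
  ...   | inj₂ j = free j (cong (wkL L) (sym (splitAt⁻¹-↑ʳ eq)))

  name-step : ∀ {k n} (L : LCtx k n) fs {u u′} →
              plugR (L , toA fs hole) u ⟶name plugR (L , toA fs hole) u′ →
              plugL L (plugS fs u) ⟶name plugL L (plugS fs u′)
  name-step L fs {u} {u′} =
    transport₂ _⟶name_ (cong (plugL L) (plugA-toA fs hole u)) (cong (plugL L) (plugA-toA fs hole u′))

  name-lift : ∀ {k n p} (L : LCtx k n) fs F {E : Vec (Exp 𝓛 (suc p + k)) (suc p)} {s} →
              plugL L (plugS fs (plugF F (letrec E s))) ⟶name
              plugL L (plugS fs (letrec E (plugF (renameF (suc p ↑ʳ_) F) s)))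
  name-lift L fs (app t)     = name-step L fs (lapp (L , toA fs hole))
  name-lift L fs (seq t)     = name-step L fs (lseq (L , toA fs hole))
  name-lift L fs (case τ rs) = name-step L fs (lcase (L , toA fs hole))

  expand-name : ∀ {n} {s s′ : Exp 𝓛 n} → Star _⟶name_ s s′ → s′ ↓name → s ↓name
  expand-name rs (v , rs′ , ans) = v , rs ◅◅ rs′ , ans

  -- There is one lifting step per frame and `meet-lift` preserves m, so moving a letrec out of the
  -- whole stack terminates by recursion on the stack and uses up no fuel.
  letrec-out : ∀ {k n p m} (L : LCtx k n) fs (E : Vec (Exp 𝓛 (suc p + k)) (suc p)) s →
               N (plugL L (plugS fs (letrec E s))) ⇓[ m ] →
               ∃ λ fs′ → Star _⟶name_ (plugL L (plugS fs (letrec E s))) (plugL (L ∘L letrec E hole) (plugS fs′ s)) ×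
                         N (plugL (L ∘L letrec E hole) (plugS fs′ s)) ⇓[ m ]
  letrec-out L []       E s d =
    [] , transport (Star _⟶name_ _) (sym (plugL-∘ L (letrec E hole) s)) ε ,
    transport (λ e → N e ⇓[ _ ]) (sym (plugL-∘ L (letrec E hole) s)) d
  letrec-out {p = p} L (F ∷ fs) E s d with meet⇓ L fs (meet-lift L F) d
  ... | m₀ , refl , d′ with letrec-out L fs E (plugF (renameF (suc p ↑ʳ_) F) s) d′
  ... | fs′ , rs , d″ = renameF (suc p ↑ʳ_) F ∷ fs′ , name-lift L fs F ◅ rs , d″

  closed-⇓ : ∀ {k n m} (L : LCtx k n) fs u → N (plugL L (plugS fs u)) ⇓[ m ] → ∃ λ m′ →
             subst (closing L) (N u) ⇓[ m′ ]
  closed-⇓ L fs u d with ⇓-reduce (N-focus L fs u) d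
  ... | _ , d′ , _ = ⇓-plugS (closedS L fs) d′

  -- The recursion is lexicographic: `reduce-name` spends fuel at each β, case, seq and gcp, since
  -- these lower the count; in between, t shrinks while its frames move to the stack and its letrecs
  -- to `L`. Ill-typed heads and free variables in head position are refuted by the given
  -- evaluation, through `closed-⇓`.
  N⇓⇒↓name : ∀ fuel {k n m} (L : LCtx k n) fs t → N (plugL L (plugS fs t)) ⇓[ m ] → m < fuel →
             plugL L (plugS fs t) ↓name
  reduce-name : ∀ fuel {k n a m} (L : LCtx k n) fs {u u′} →
                plugL L (plugS fs u) ⟶name plugL L (plugS fs u′) →
                Meet L (suc a) 0 u u′ → N (plugL L (plugS fs u)) ⇓[ m ] → m < suc fuel → plugL L (plugS fs u) ↓name

  N⇓⇒↓name (suc f) L fs (app s t)     d lt = N⇓⇒↓name (suc f) L (app t ∷ fs) s d lt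
  N⇓⇒↓name (suc f) L fs (seq s t)     d lt = N⇓⇒↓name (suc f) L (seq t ∷ fs) s d lt
  N⇓⇒↓name (suc f) L fs (case τ s rs) d lt = N⇓⇒↓name (suc f) L (case τ rs ∷ fs) s d lt
  N⇓⇒↓name (suc f) L fs (letrec E s)  d lt =
    let fs′ , rs , d′ = letrec-out L fs E s d
    in expand-name rs (N⇓⇒↓name (suc f) (L ∘L letrec E hole) fs′ s d′ lt)
  N⇓⇒↓name (suc f) L []              (lam s) d lt = _ , ε , L[v] L (lam s)
  N⇓⇒↓name (suc f) L (app t ∷ fs)    (lam s) d lt =
    reduce-name f L fs (name-step L fs (beta (L , toA fs hole))) (meet-beta L) d lt
  N⇓⇒↓name (suc f) L (seq t ∷ fs)    (lam s) d lt =
    reduce-name f L fs (name-step L fs (seq (L , toA fs hole) (lam s))) (meet-seq L (lam s)) d lt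
  N⇓⇒↓name (suc f) L (case τ rs ∷ fs) (lam s) d lt with closed-⇓ L fs (case τ (lam s) rs) d
  ... | _ , step (caseˢ ()) _
  N⇓⇒↓name (suc f) L []              (con τ c ss) d lt = _ , ε , L[v] L (con τ c ss)
  N⇓⇒↓name (suc f) L (app t ∷ fs)    (con τ c ss) d lt with closed-⇓ L fs (app (con τ c ss) t) d
  ... | _ , step (appˡ ()) _
  N⇓⇒↓name (suc f) L (seq t ∷ fs)    (con τ c ss) d lt =
    reduce-name f L fs (name-step L fs (seq (L , toA fs hole) (con τ c ss))) (meet-seq L (con τ c ss)) d lt
  N⇓⇒↓name (suc f) L (case τ′ rs ∷ fs) (con τ c ss) d lt with closed-⇓ L fs (case τ′ (con τ c ss) rs) d
  ... | _ , step (caseˢ ()) _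
  ... | _ , step case _ =
    reduce-name f L fs (name-step L fs (case (L , toA fs hole))) (meet-case L) d lt
  N⇓⇒↓name (suc f) L fs (var x) d lt with varView L x
  N⇓⇒↓name (suc f) L fs (var x) d lt | free v refl with closed-⇓ L fs (var x) d
  ... | _ , d′ with transport (_⇓[ _ ]) (closing-wkL L v) d′
  ...   | step () _
  N⇓⇒↓name (suc f) _ fs (var x) d lt | bound L₁ E L₂ i refl refl =
    reduce-name f L fs (transport₂ _⟶name_
        (trans (sym (plugL-∘ L₁ (letrec E L₂) _)) (cong (plugL L) (plugA-toA fs hole _)))
        (trans (sym (plugL-∘ L₁ (letrec E L₂) _)) (cong (plugL L) (plugA-toA fs hole _)))
        (gcp L₁ (L₂ , toA fs hole)))
      (meet-gcp L₁ E L₂ i) d lt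
    where L = L₁ ∘L letrec E L₂

  reduce-name f L fs {u′ = u′} r M d lt =
    let m₀ , m≡ , d′ = meet⇓ L fs M d
    -- The redex costs at least one step more than its contractum, so m₀ < m and the smaller fuel
    -- suffices.
    in expand-name (r ◅ ε) (N⇓⇒↓name f L fs u′ d′ (s≤s⁻¹ (≤-trans (s≤s (≤-trans (s≤s (m≤n+m m₀ _)) (≤-reflexive (sym m≡)))) lt)))

  -- Simulation and Kleene approximants

  Ω : ∀ {n} → Exp Λ n
  Ω = app (lam (app (var zero) (var zero))) (lam (app (var zero) (var zero)))

  -- Simulation up to reduction of the left side and, if b = true, of the right
  -- side; for b = false it does not increase the number of steps.
  infix 4 _⊴[_]_ _⊴*[_]_ _⊴ᵃ[_]_
  mutual
    data _⊴[_]_ {n} : Exp Λ n → Bool → Exp Λ n → Set where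
      Ω⊴    : ∀ {b e} → Ω ⊴[ b ] e
      var   : ∀ {b} x → var x ⊴[ b ] var x
      app   : ∀ {b s s′ t t′} → s ⊴[ b ] s′ → t ⊴[ b ] t′ → app s t ⊴[ b ] app s′ t′
      lam   : ∀ {b s s′} → s ⊴[ b ] s′ → lam s ⊴[ b ] lam s′
      con   : ∀ {b} τ c {ss ss′} → ss ⊴*[ b ] ss′ → con τ c ss ⊴[ b ] con τ c ss′
      seq   : ∀ {b s s′ t t′} → s ⊴[ b ] s′ → t ⊴[ b ] t′ → seq s t ⊴[ b ] seq s′ t′
      case  : ∀ {b} τ {s s′ rs rs′} → s ⊴[ b ] s′ → rs ⊴ᵃ[ b ] rs′ → case τ s rs ⊴[ b ] case τ s′ rs′
      left  : ∀ {b e r e′} → e ↦ r → r ⊴[ b ] e′ → e ⊴[ b ] e′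
      right : ∀ {e r e′} → e′ ↦ r → e ⊴[ true ] r → e ⊴[ true ] e′

    data _⊴*[_]_ {n} : ∀ {k} → Vec (Exp Λ n) k → Bool → Vec (Exp Λ n) k → Set where
      []  : ∀ {b} → [] ⊴*[ b ] []
      _∷_ : ∀ {b k s s′} {ss ss′ : Vec (Exp Λ n) k} → s ⊴[ b ] s′ → ss ⊴*[ b ] ss′ →
            (s ∷ ss) ⊴*[ b ] (s′ ∷ ss′)

    data _⊴ᵃ[_]_ {n} : ∀ {ks} → Alts Λ n ks → Bool → Alts Λ n ks → Set where
      []  : ∀ {b} → [] ⊴ᵃ[ b ] []
      _∷_ : ∀ {b k ks} {r r′ : Exp Λ (k + n)} {rs rs′ : Alts Λ n ks} →
            r ⊴[ b ] r′ → rs ⊴ᵃ[ b ] rs′ → (r ∷ rs) ⊴ᵃ[ b ] (r′ ∷ rs′)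

  mutual
    ⊴-refl : ∀ {n b} (s : Exp Λ n) → s ⊴[ b ] s
    ⊴-refl (var x)       = var x
    ⊴-refl (app s t)     = app (⊴-refl s) (⊴-refl t)
    ⊴-refl (lam s)       = lam (⊴-refl s)
    ⊴-refl (con τ c ss)  = con τ c (⊴*-refl ss)
    ⊴-refl (seq s t)     = seq (⊴-refl s) (⊴-refl t)
    ⊴-refl (case τ s rs) = case τ (⊴-refl s) (⊴ᵃ-refl rs)

    ⊴*-refl : ∀ {n b k} (ss : Vec (Exp Λ n) k) → ss ⊴*[ b ] ss
    ⊴*-refl []       = []
    ⊴*-refl (s ∷ ss) = ⊴-refl s ∷ ⊴*-refl ss

    ⊴ᵃ-refl : ∀ {n b ks} (rs : Alts Λ n ks) → rs ⊴ᵃ[ b ] rs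
    ⊴ᵃ-refl []       = []
    ⊴ᵃ-refl (r ∷ rs) = ⊴-refl r ∷ ⊴ᵃ-refl rs

  ⊴-lookup : ∀ {n b k} {ss ss′ : Vec (Exp Λ n) k} → ss ⊴*[ b ] ss′ → ∀ i →
             lookup ss i ⊴[ b ] lookup ss′ i
  ⊴-lookup (r ∷ rs) zero    = r
  ⊴-lookup (r ∷ rs) (suc i) = ⊴-lookup rs i

  ⊴-alternative : ∀ {n b ks} {rs rs′ : Alts Λ n ks} → rs ⊴ᵃ[ b ] rs′ → ∀ c →
                  alternative rs c ⊴[ b ] alternative rs′ c
  ⊴-alternative (r ∷ rs) zero    = r
  ⊴-alternative (r ∷ rs) (suc c) = ⊴-alternative rs c

  ↦-rename : ∀ {m n} (ρ : Fin m → Fin n) {s s′} → s ↦ s′ → rename ρ s ↦ rename ρ s′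
  ↦-rename ρ {s} {s′} r =
    transport₂ _↦_ (sym (rename≗subst ρ s)) (sym (rename≗subst ρ s′)) (↦-subst _ r)

  mutual
    ⊴-rename : ∀ {m n b} (ρ : Fin m → Fin n) {s s′} → s ⊴[ b ] s′ → rename ρ s ⊴[ b ] rename ρ s′
    ⊴-rename ρ Ω⊴           = Ω⊴
    ⊴-rename ρ (var x)      = var (ρ x)
    ⊴-rename ρ (app r r′)   = app (⊴-rename ρ r) (⊴-rename ρ r′)
    ⊴-rename ρ (lam r)      = lam (⊴-rename (lift 1 ρ) r)
    ⊴-rename ρ (con τ c rs) = con τ c (⊴-rename* ρ rs)
    ⊴-rename ρ (seq r r′)   = seq (⊴-rename ρ r) (⊴-rename ρ r′)
    ⊴-rename ρ (case τ r rs) = case τ (⊴-rename ρ r) (⊴-renameᵃ ρ rs)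
    ⊴-rename ρ (left r d)   = left (↦-rename ρ r) (⊴-rename ρ d)
    ⊴-rename ρ (right r d)  = right (↦-rename ρ r) (⊴-rename ρ d)

    ⊴-rename* : ∀ {m n b} (ρ : Fin m → Fin n) {k} {ss ss′ : Vec _ k} → ss ⊴*[ b ] ss′ →
                rename* ρ ss ⊴*[ b ] rename* ρ ss′
    ⊴-rename* ρ []       = []
    ⊴-rename* ρ (r ∷ rs) = ⊴-rename ρ r ∷ ⊴-rename* ρ rs

    ⊴-renameᵃ : ∀ {m n b} (ρ : Fin m → Fin n) {ks} {rs rs′ : Alts Λ m ks} → rs ⊴ᵃ[ b ] rs′ →
                renameᵃ ρ rs ⊴ᵃ[ b ] renameᵃ ρ rs′
    ⊴-renameᵃ ρ []       = []
    ⊴-renameᵃ ρ (_∷_ {k = k} r rs) = ⊴-rename (lift k ρ) r ∷ ⊴-renameᵃ ρ rs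

  infix 4 _⊑[_]_
  _⊑[_]_ : ∀ {A : Set} {n} → (A → Exp Λ n) → Bool → (A → Exp Λ n) → Set
  σ ⊑[ b ] τ = ∀ x → σ x ⊴[ b ] τ x

  ⊑-lifts : ∀ {m n b} k {σ τ : Fin m → Exp Λ n} → σ ⊑[ b ] τ → lifts k σ ⊑[ b ] lifts k τ
  ⊑-lifts zero    e x       = e x
  ⊑-lifts (suc k) e zero    = var zero
  ⊑-lifts (suc k) e (suc x) = ⊴-rename suc (⊑-lifts k e x)

  mutual
    ⊴-subst : ∀ {m n b} {σ τ : Fin m → Exp Λ n} → (e : σ ⊑[ b ] τ) → ∀ {s s′} → s ⊴[ b ] s′ →
              subst σ s ⊴[ b ] subst τ s′
    ⊴-subst e Ω⊴           = Ω⊴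
    ⊴-subst e (var x)      = e x
    ⊴-subst e (app r r′)   = app (⊴-subst e r) (⊴-subst e r′)
    ⊴-subst e (lam r)      = lam (⊴-subst (⊑-lifts 1 e) r)
    ⊴-subst e (con τ c rs) = con τ c (⊴-subst* e rs)
    ⊴-subst e (seq r r′)   = seq (⊴-subst e r) (⊴-subst e r′)
    ⊴-subst e (case τ r rs) = case τ (⊴-subst e r) (⊴-substᵃ e rs)
    ⊴-subst e (left r d)   = left (↦-subst _ r) (⊴-subst e d)
    ⊴-subst e (right r d)  = right (↦-subst _ r) (⊴-subst e d)

    ⊴-subst* : ∀ {m n b} {σ τ : Fin m → Exp Λ n} → (e : σ ⊑[ b ] τ) → ∀ {k} {ss ss′ : Vec _ k} →
               ss ⊴*[ b ] ss′ → subst* σ ss ⊴*[ b ] subst* τ ss′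
    ⊴-subst* e []       = []
    ⊴-subst* e (r ∷ rs) = ⊴-subst e r ∷ ⊴-subst* e rs

    ⊴-substᵃ : ∀ {m n b} {σ τ : Fin m → Exp Λ n} → (e : σ ⊑[ b ] τ) → ∀ {ks} {rs rs′ : Alts Λ m ks} →
               rs ⊴ᵃ[ b ] rs′ → substᵃ σ rs ⊴ᵃ[ b ] substᵃ τ rs′
    ⊴-substᵃ e []       = []
    ⊴-substᵃ e (_∷_ {k = k} r rs) = ⊴-subst (⊑-lifts k e) r ∷ ⊴-substᵃ e rs

  env : ∀ {n m p} → (Fin p → Exp Λ m) → (Fin n → Exp Λ m) → Fin (p + n) → Exp Λ m
  env {p = p} f σ = [ f , σ ]′ ∘ splitAt p

  env-↑ˡ : ∀ {n m p} (f : Fin p → Exp Λ m) (σ : Fin n → Exp Λ m) i → env f σ (i ↑ˡ n) ≡ f i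
  env-↑ˡ {n} {p = p} f σ i = cong [ f , σ ]′ (splitAt-↑ˡ p i n)

  env-↑ʳ : ∀ {n m} p (f : Fin p → Exp Λ m) (σ : Fin n → Exp Λ m) j → env f σ (p ↑ʳ j) ≡ σ j
  env-↑ʳ {n} p f σ j = cong [ f , σ ]′ (splitAt-↑ʳ p n j)

  env-rel : ∀ {n m m′ p} (R : Exp Λ m → Exp Λ m′ → Set) {f : Fin p → Exp Λ m} {g : Fin p → Exp Λ m′} {σ : Fin n → Exp Λ m} {τ : Fin n → Exp Λ m′} →
            (∀ i → R (f i) (g i)) → (∀ j → R (σ j) (τ j)) → ∀ x → R (env f σ x) (env g τ x)
  env-rel {p = p} R {f} {g} {σ} {τ} rf rσ = splitCases p
    (λ i → transport₂ R (sym (env-↑ˡ f σ i)) (sym (env-↑ˡ g τ i)) (rf i))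
    (λ j → transport₂ R (sym (env-↑ʳ p f σ j)) (sym (env-↑ʳ p g τ j)) (rσ j))

  env-cong : ∀ {n m p} {f g : Fin p → Exp Λ m} {σ τ : Fin n → Exp Λ m} → f ≗ g → σ ≗ τ →
             env f σ ≗ env g τ
  env-cong = env-rel _≡_

  env-⊑ : ∀ {b n m p} {f g : Fin p → Exp Λ m} {σ τ : Fin n → Exp Λ m} → f ⊑[ b ] g → σ ⊑[ b ] τ →
          env f σ ⊑[ b ] env g τ
  env-⊑ {b} = env-rel (_⊴[ b ]_)

  env-lift : ∀ {n n′ m p} {f g : Fin p → Exp Λ m} {σ : Fin n → Exp Λ m} {τ : Fin n′ → Exp Λ m} {ρ : Fin n′ → Fin n} →
             f ≗ g → σ ∘ ρ ≗ τ → env f σ ∘ lift p ρ ≗ env g τ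
  env-lift {p = p} {f} {g} {σ} {τ} {ρ} ef e = splitCases p
    (λ i → trans (cong (env f σ) (lift-↑ˡ ρ i)) (trans (env-↑ˡ f σ i) (trans (ef i) (sym (env-↑ˡ g τ i)))))
    (λ j → trans (cong (env f σ) (lift-↑ʳ p ρ j)) (trans (env-↑ʳ p f σ (ρ j)) (trans (e j) (sym (env-↑ʳ p g τ j)))))

  fix : ∀ {n p} → ((Fin p → Exp Λ n) → Fin p → Exp Λ n) → ℕ → Fin p → Exp Λ n
  fix F zero    i = Ω
  fix F (suc j) i = F (fix F j) i

  -- Fixed point induction with both sides at the same stage. It is used for equality and for the
  -- graph of a substitution; `fix-⊑` is the variant in which the right side may be further ahead.
  fix-rel : ∀ {n m p} {F : (Fin p → Exp Λ n) → Fin p → Exp Λ n} {G : (Fin p → Exp Λ m) → Fin p → Exp Λ m}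
            (R : Exp Λ n → Exp Λ m → Set) → R Ω Ω →
            (∀ {f g} → (∀ i → R (f i) (g i)) → ∀ i → R (F f i) (G g i)) → ∀ j i → R (fix F j i) (fix G j i)
  fix-rel R Ω′ h zero    i = Ω′
  fix-rel R Ω′ h (suc j) i = h (fix-rel R Ω′ h j) i

  -- The Kleene approximants of an expression whose variables stand for σ: every
  -- letrec is unfolded k times.
  mutual
    ⟦_⟧ : ∀ {g n m} → Exp g n → ℕ → (Fin n → Exp Λ m) → Exp Λ m
    ⟦ var x ⟧       k σ = σ x
    ⟦ app s t ⟧     k σ = app (⟦ s ⟧ k σ) (⟦ t ⟧ k σ)
    ⟦ lam s ⟧       k σ = lam (⟦ s ⟧ k (lifts 1 σ))
    ⟦ letrec E t ⟧  k σ = ⟦ t ⟧ k (env (fix (λ f → lookup (⟦ E ⟧* k (env f σ))) k) σ)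
    ⟦ con τ c ss ⟧  k σ = con τ c (⟦ ss ⟧* k σ)
    ⟦ seq s t ⟧     k σ = seq (⟦ s ⟧ k σ) (⟦ t ⟧ k σ)
    ⟦ case τ s rs ⟧ k σ = case τ (⟦ s ⟧ k σ) (⟦ rs ⟧ᵃ k σ)

    ⟦_⟧* : ∀ {g n m j} → Vec (Exp g n) j → ℕ → (Fin n → Exp Λ m) → Vec (Exp Λ m) j
    ⟦ [] ⟧*     k σ = []
    ⟦ s ∷ ss ⟧* k σ = ⟦ s ⟧ k σ ∷ ⟦ ss ⟧* k σ

    ⟦_⟧ᵃ : ∀ {g n m ks} → Alts g n ks → ℕ → (Fin n → Exp Λ m) → Alts Λ m ks
    ⟦ [] ⟧ᵃ     k σ = []
    ⟦ r ∷ rs ⟧ᵃ k σ = ⟦ r ⟧ k (lifts _ σ) ∷ ⟦ rs ⟧ᵃ k σ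

  lookup-⟦⟧ : ∀ {g n m j} (ss : Vec (Exp g n) j) {k} {σ : Fin n → Exp Λ m} i →
              lookup (⟦ ss ⟧* k σ) i ≡ ⟦ lookup ss i ⟧ k σ
  lookup-⟦⟧ (s ∷ ss) zero    = refl
  lookup-⟦⟧ (s ∷ ss) (suc i) = lookup-⟦⟧ ss i

  alternative-⟦⟧ : ∀ {g n m ks} (rs : Alts g n ks) {k} {σ : Fin n → Exp Λ m} c →
                   alternative (⟦ rs ⟧ᵃ k σ) c ≡ ⟦ alternative rs c ⟧ k (lifts (List.lookup ks c) σ)
  alternative-⟦⟧ (r ∷ rs) zero    = refl
  alternative-⟦⟧ (r ∷ rs) (suc c) = alternative-⟦⟧ rs c

  mutual
    ⟦⟧-rename : ∀ {g n n′ m k} {σ : Fin n′ → Exp Λ m} {ρ : Fin n → Fin n′} {τ : Fin n → Exp Λ m} →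
                σ ∘ ρ ≗ τ → (s : Exp g n) → ⟦ rename ρ s ⟧ k σ ≡ ⟦ s ⟧ k τ
    ⟦⟧-rename e (var x)       = e x
    ⟦⟧-rename e (app s t)     = cong₂ app (⟦⟧-rename e s) (⟦⟧-rename e t)
    ⟦⟧-rename e (lam s)       = cong lam (⟦⟧-rename (lifts-lift 1 e) s)
    ⟦⟧-rename {k = k} {ρ = ρ} e (letrec {p = p} E t)  =
      ⟦⟧-rename (env-lift (fix-rel _≡_ refl (λ fg i → cong (λ v → lookup v i) (⟦⟧-rename* {k = k} {ρ = lift (suc p) ρ} (env-lift fg e) E)) k) e) t
    ⟦⟧-rename e (con τ c ss)  = cong (con τ c) (⟦⟧-rename* e ss)
    ⟦⟧-rename e (seq s t)     = cong₂ seq (⟦⟧-rename e s) (⟦⟧-rename e t)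
    ⟦⟧-rename e (case τ s rs) = cong₂ (case τ) (⟦⟧-rename e s) (⟦⟧-renameᵃ e rs)

    ⟦⟧-rename* : ∀ {g n n′ m k} {σ : Fin n′ → Exp Λ m} {ρ : Fin n → Fin n′} {τ : Fin n → Exp Λ m} →
                 σ ∘ ρ ≗ τ → ∀ {j} (ss : Vec (Exp g n) j) → ⟦ rename* ρ ss ⟧* k σ ≡ ⟦ ss ⟧* k τ
    ⟦⟧-rename* e []       = refl
    ⟦⟧-rename* e (s ∷ ss) = cong₂ _∷_ (⟦⟧-rename e s) (⟦⟧-rename* e ss)

    ⟦⟧-renameᵃ : ∀ {g n n′ m k} {σ : Fin n′ → Exp Λ m} {ρ : Fin n → Fin n′} {τ : Fin n → Exp Λ m} →
                 σ ∘ ρ ≗ τ → ∀ {ks} (rs : Alts g n ks) → ⟦ renameᵃ ρ rs ⟧ᵃ k σ ≡ ⟦ rs ⟧ᵃ k τ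
    ⟦⟧-renameᵃ e []       = refl
    ⟦⟧-renameᵃ e (_∷_ {k = k} r rs) = cong₂ _∷_ (⟦⟧-rename (lifts-lift k e) r) (⟦⟧-renameᵃ e rs)

  env-subst : ∀ {n m m′ p} {θ : Fin m → Exp Λ m′} {f : Fin p → Exp Λ m} {g : Fin p → Exp Λ m′} {σ : Fin n → Exp Λ m} {τ : Fin n → Exp Λ m′} →
              subst θ ∘ f ≗ g → subst θ ∘ σ ≗ τ → subst θ ∘ env f σ ≗ env g τ
  env-subst {θ = θ} = env-rel (λ s t → subst θ s ≡ t)

  mutual
    subst-⟦⟧ : ∀ {g n m m′ k} {θ : Fin m → Exp Λ m′} {σ : Fin n → Exp Λ m} {τ : Fin n → Exp Λ m′} →
               subst θ ∘ σ ≗ τ → (s : Exp g n) → subst θ (⟦ s ⟧ k σ) ≡ ⟦ s ⟧ k τ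
    subst-⟦⟧ e (var x)       = e x
    subst-⟦⟧ e (app s t)     = cong₂ app (subst-⟦⟧ e s) (subst-⟦⟧ e t)
    subst-⟦⟧ e (lam s)       = cong lam (subst-⟦⟧ (subst-lifts 1 e) s)
    subst-⟦⟧ {k = k} e (letrec {p = p} E t)  =
      subst-⟦⟧ (env-subst (fix-rel (λ s t → subst _ s ≡ t) refl (λ fg i → trans (sym (lookup-subst* _ (⟦ E ⟧* k _) i)) (cong (λ v → lookup v i) (subst-⟦⟧* {k = k} (env-subst fg e) E))) k) e) t
    subst-⟦⟧ e (con τ c ss)  = cong (con τ c) (subst-⟦⟧* e ss)
    subst-⟦⟧ e (seq s t)     = cong₂ seq (subst-⟦⟧ e s) (subst-⟦⟧ e t)
    subst-⟦⟧ e (case τ s rs) = cong₂ (case τ) (subst-⟦⟧ e s) (subst-⟦⟧ᵃ e rs)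

    subst-⟦⟧* : ∀ {g n m m′ k} {θ : Fin m → Exp Λ m′} {σ : Fin n → Exp Λ m} {τ : Fin n → Exp Λ m′} →
                subst θ ∘ σ ≗ τ → ∀ {j} (ss : Vec (Exp g n) j) → subst* θ (⟦ ss ⟧* k σ) ≡ ⟦ ss ⟧* k τ
    subst-⟦⟧* e []       = refl
    subst-⟦⟧* e (s ∷ ss) = cong₂ _∷_ (subst-⟦⟧ e s) (subst-⟦⟧* e ss)

    subst-⟦⟧ᵃ : ∀ {g n m m′ k} {θ : Fin m → Exp Λ m′} {σ : Fin n → Exp Λ m} {τ : Fin n → Exp Λ m′} →
                subst θ ∘ σ ≗ τ → ∀ {ks} (rs : Alts g n ks) → substᵃ θ (⟦ rs ⟧ᵃ k σ) ≡ ⟦ rs ⟧ᵃ k τ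
    subst-⟦⟧ᵃ e []       = refl
    subst-⟦⟧ᵃ e (_∷_ {k = k} r rs) = cong₂ _∷_ (subst-⟦⟧ (subst-lifts k e) r) (subst-⟦⟧ᵃ e rs)

  rename-⟦⟧ : ∀ {g n m m′ k} {ρ : Fin m → Fin m′} {σ : Fin n → Exp Λ m} {τ : Fin n → Exp Λ m′} →
              rename ρ ∘ σ ≗ τ →
              (s : Exp g n) → rename ρ (⟦ s ⟧ k σ) ≡ ⟦ s ⟧ k τ
  rename-⟦⟧ {k = k} {ρ} {σ} e s =
    trans (rename≗subst ρ (⟦ s ⟧ k σ)) (subst-⟦⟧ (λ x → trans (sym (rename≗subst ρ (σ x))) (e x)) s)

  lifts-⟦⟧ : ∀ {g n n′ m k} j {σ : Fin n′ → Exp Λ m} {π : Fin n → Exp g n′} {τ : Fin n → Exp Λ m} →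
             (λ x → ⟦ π x ⟧ k σ) ≗ τ → (λ x → ⟦ lifts j π x ⟧ k (lifts j σ)) ≗ lifts j τ
  lifts-⟦⟧ zero    e x    = e x
  lifts-⟦⟧ (suc j) e zero = refl
  lifts-⟦⟧ (suc j) {π = π} e (suc x) = trans (⟦⟧-rename (λ _ → refl) (lifts j π x))
    (trans (sym (rename-⟦⟧ (λ _ → refl) (lifts j π x))) (cong (weaken 1) (lifts-⟦⟧ j e x)))

  env-lifts : ∀ {g n n′ m k p} {f h : Fin p → Exp Λ m} {σ : Fin n′ → Exp Λ m} {π : Fin n → Exp g n′} {τ : Fin n → Exp Λ m} →
              f ≗ h → (λ x → ⟦ π x ⟧ k σ) ≗ τ → (λ x → ⟦ lifts p π x ⟧ k (env f σ)) ≗ env h τ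
  env-lifts {k = k} {p} {f} {h} {σ} {π} {τ} ef e = splitCases p
    (λ i → trans (cong (λ s → ⟦ s ⟧ k (env f σ)) (lifts-↑ˡ π i)) (trans (env-↑ˡ f σ i) (trans (ef i) (sym (env-↑ˡ h τ i)))))
    (λ j → trans (cong (λ s → ⟦ s ⟧ k (env f σ)) (lifts-↑ʳ p π j))
             (trans (⟦⟧-rename (env-↑ʳ p f σ) (π j)) (trans (e j) (sym (env-↑ʳ p h τ j)))))

  mutual
    ⟦⟧-subst : ∀ {g n n′ m k} {σ : Fin n′ → Exp Λ m} {π : Fin n → Exp g n′} {τ : Fin n → Exp Λ m} →
               (λ x → ⟦ π x ⟧ k σ) ≗ τ → (s : Exp g n) → ⟦ subst π s ⟧ k σ ≡ ⟦ s ⟧ k τ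
    ⟦⟧-subst e (var x)       = e x
    ⟦⟧-subst e (app s t)     = cong₂ app (⟦⟧-subst e s) (⟦⟧-subst e t)
    ⟦⟧-subst e (lam s)       = cong lam (⟦⟧-subst (lifts-⟦⟧ 1 e) s)
    ⟦⟧-subst {k = k} {π = π} e (letrec {p = p} E t)  =
      ⟦⟧-subst (env-lifts (fix-rel _≡_ refl (λ fg i → cong (λ v → lookup v i) (⟦⟧-subst* {k = k} {π = lifts (suc p) π} (env-lifts fg e) E)) k) e) t
    ⟦⟧-subst e (con τ c ss)  = cong (con τ c) (⟦⟧-subst* e ss)
    ⟦⟧-subst e (seq s t)     = cong₂ seq (⟦⟧-subst e s) (⟦⟧-subst e t)
    ⟦⟧-subst e (case τ s rs) = cong₂ (case τ) (⟦⟧-subst e s) (⟦⟧-substᵃ e rs)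

    ⟦⟧-subst* : ∀ {g n n′ m k} {σ : Fin n′ → Exp Λ m} {π : Fin n → Exp g n′} {τ : Fin n → Exp Λ m} →
                (λ x → ⟦ π x ⟧ k σ) ≗ τ → ∀ {j} (ss : Vec (Exp g n) j) →
                ⟦ subst* π ss ⟧* k σ ≡ ⟦ ss ⟧* k τ
    ⟦⟧-subst* e []       = refl
    ⟦⟧-subst* e (s ∷ ss) = cong₂ _∷_ (⟦⟧-subst e s) (⟦⟧-subst* e ss)

    ⟦⟧-substᵃ : ∀ {g n n′ m k} {σ : Fin n′ → Exp Λ m} {π : Fin n → Exp g n′} {τ : Fin n → Exp Λ m} →
                (λ x → ⟦ π x ⟧ k σ) ≗ τ → ∀ {ks} (rs : Alts g n ks) →
                ⟦ substᵃ π rs ⟧ᵃ k σ ≡ ⟦ rs ⟧ᵃ k τ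
    ⟦⟧-substᵃ e []       = refl
    ⟦⟧-substᵃ e (_∷_ {k = k} r rs) = cong₂ _∷_ (⟦⟧-subst (lifts-⟦⟧ k e) r) (⟦⟧-substᵃ e rs)

  mutual
    -- This is what allows all laws to be proved for labelled expressions and then used for the
    -- unlabelled ones between two LR-steps.
    ⟦⟧-convert : ∀ {g g′ n m k} {h : HasLetrec g → HasLetrec g′} {a : Ann g → Ann g′} {σ τ : Fin n → Exp Λ m} →
                 σ ≗ τ → (s : Exp g n) → ⟦ convert h a s ⟧ k σ ≡ ⟦ s ⟧ k τ
    ⟦⟧-convert e (var x)       = e x
    ⟦⟧-convert e (app s t)     = cong₂ app (⟦⟧-convert e s) (⟦⟧-convert e t)
    ⟦⟧-convert e (lam s)       = cong lam (⟦⟧-convert (lifts-cong 1 e) s)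
    ⟦⟧-convert {k = k} {h} {a} e (letrec {p = p} E t)  =
      ⟦⟧-convert (env-cong (fix-rel _≡_ refl (λ fg i → cong (λ v → lookup v i) (⟦⟧-convert* {k = k} {h} {a} (env-cong fg e) E)) k) e) t
    ⟦⟧-convert e (con τ c ss)  = cong (con τ c) (⟦⟧-convert* e ss)
    ⟦⟧-convert e (seq s t)     = cong₂ seq (⟦⟧-convert e s) (⟦⟧-convert e t)
    ⟦⟧-convert e (case τ s rs) = cong₂ (case τ) (⟦⟧-convert e s) (⟦⟧-convertᵃ e rs)

    ⟦⟧-convert* : ∀ {g g′ n m k} {h : HasLetrec g → HasLetrec g′} {a : Ann g → Ann g′} {σ τ : Fin n → Exp Λ m} →
                  σ ≗ τ → ∀ {j} (ss : Vec (Exp g n) j) → ⟦ convert* h a ss ⟧* k σ ≡ ⟦ ss ⟧* k τ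
    ⟦⟧-convert* e []       = refl
    ⟦⟧-convert* e (s ∷ ss) = cong₂ _∷_ (⟦⟧-convert e s) (⟦⟧-convert* e ss)

    ⟦⟧-convertᵃ : ∀ {g g′ n m k} {h : HasLetrec g → HasLetrec g′} {a : Ann g → Ann g′} {σ τ : Fin n → Exp Λ m} →
                  σ ≗ τ → ∀ {ks} (rs : Alts g n ks) → ⟦ convertᵃ h a rs ⟧ᵃ k σ ≡ ⟦ rs ⟧ᵃ k τ
    ⟦⟧-convertᵃ e []       = refl
    ⟦⟧-convertᵃ e (_∷_ {k = k} r rs) = cong₂ _∷_ (⟦⟧-convert (lifts-cong k e) r) (⟦⟧-convertᵃ e rs)

  -- An abstraction does not reduce, so `left` is impossible, and the steps of the right side are
  -- those recorded by `right`; for b = false there are none.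
  lam-⊴ : ∀ {n b} {s : Exp Λ (suc n)} {f} → lam s ⊴[ b ] f →
          ∃ λ c → ∃ λ s′ → f ↦⟨ c ⟩ lam s′ × s ⊴[ b ] s′ × (b ≡ false → c ≡ 0)
  lam-⊴ (lam r)     = 0 , _ , [] , r , λ _ → refl
  lam-⊴ (left () _)
  lam-⊴ (right q d) with lam-⊴ d
  ... | c , s′ , qs , r , _ = suc c , s′ , q ∷ qs , r , λ ()

  con-⊴ : ∀ {n b τ c} {ss : Vec (Exp Λ n) (ar τ c)} {f} → con τ c ss ⊴[ b ] f →
          ∃ λ a → ∃ λ ss′ → f ↦⟨ a ⟩ con τ c ss′ × ss ⊴*[ b ] ss′ × (b ≡ false → a ≡ 0)
  con-⊴ (con τ c rs) = 0 , _ , [] , rs , λ _ → refl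
  con-⊴ (left () _)
  con-⊴ (right q d) with con-⊴ d
  ... | a , ss′ , qs , rs , _ = suc a , ss′ , q ∷ qs , rs , λ ()

  value-⊴ : ∀ {n b} {v f : Exp Λ n} → Value v → v ⊴[ b ] f →
            ∃ λ a → ∃ λ v′ → f ↦⟨ a ⟩ v′ × Value v′ × (b ≡ false → a ≡ 0)
  value-⊴ (lam s) d with lam-⊴ d
  ... | a , s′ , qs , _ , z = a , lam s′ , qs , lam s′ , z
  value-⊴ (con τ c ss) d with con-⊴ d
  ... | a , ss′ , qs , _ , z = a , con τ c ss′ , qs , con τ c ss′ , z

  one-more : ∀ {b c} → (b ≡ false → c ≡ 0) → b ≡ false → c + 1 ≤ 1
  one-more z b rewrite z b = ≤-refl

  inst-lookup-⊑ : ∀ {b n k} {ss ss′ : Vec (Exp Λ n) k} → ss ⊴*[ b ] ss′ →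
                  inst (lookup ss) ⊑[ b ] inst (lookup ss′)
  inst-lookup-⊑ rs = env-⊑ (⊴-lookup rs) var

  -- Before a redex can be matched, the right side may first have to run until its head is the
  -- corresponding value. For b = false this preparation is empty, which leaves at most one step.
  ⊴-step : ∀ {n b} {e e′ e₁ : Exp Λ n} → e ⊴[ b ] e′ → e ↦ e₁ →
           ∃ λ c → ∃ λ e₁′ → e′ ↦⟨ c ⟩ e₁′ × e₁ ⊴[ b ] e₁′ × (b ≡ false → c ≤ 1)
  -- Ω reduces to itself, and the right side waits.
  ⊴-step Ω⊴ beta = 0 , _ , [] , Ω⊴ , λ _ → z≤n
  ⊴-step (app r r′) beta with lam-⊴ r
  ... | c , s′ , qs , r₁ , z = _ , _ , ↦*-plugS (app _ ∷ []) qs ⊕ (beta ∷ []) ,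
        ⊴-subst (inst-lookup-⊑ (r′ ∷ [])) r₁ , one-more z
  ⊴-step (app r r′) (appˡ q) with ⊴-step r q
  ... | c , e₁′ , qs , r₁ , z = c , _ , ↦*-plugS (app _ ∷ []) qs , app r₁ r′ , z
  ⊴-step (seq r r′) (seq v) with value-⊴ v r
  ... | c , v′ , qs , val , z = _ , _ , ↦*-plugS (seq _ ∷ []) qs ⊕ (seq val ∷ []) , r′ , one-more z
  ⊴-step (seq r r′) (seqˡ q) with ⊴-step r q
  ... | c , e₁′ , qs , r₁ , z = c , _ , ↦*-plugS (seq _ ∷ []) qs , seq r₁ r′ , z
  ⊴-step (case τ r rs) (case {c = c}) with con-⊴ r
  ... | a , ss′ , qs , rs₁ , z = _ , _ , ↦*-plugS (case τ _ ∷ []) qs ⊕ (case ∷ []) ,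
        ⊴-subst (inst-lookup-⊑ rs₁) (⊴-alternative rs c) , one-more z
  ⊴-step (case τ r rs) (caseˢ q) with ⊴-step r q
  ... | c , e₁′ , qs , r₁ , z = c , _ , ↦*-plugS (case τ _ ∷ []) qs , case τ r₁ rs , z
  -- The derivation has anticipated this very step, by determinism, so the right side need not move.
  ⊴-step (left q d) q′ with refl ← ↦-deterministic q q′ = 0 , _ , [] , d , λ _ → z≤n
  ⊴-step (right q d) q′ with ⊴-step d q′
  ... | c , e₁′ , qs , r₁ , _ = suc c , e₁′ , q ∷ qs , r₁ , λ ()

  ⊴-⇓ : ∀ {n b m} {e e′ : Exp Λ n} → e ⊴[ b ] e′ → e ⇓[ m ] → ∃ λ m′ →
        e′ ⇓[ m′ ] × (b ≡ false → m′ ≤ m)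
  ⊴-⇓ r (done v) with value-⊴ v r
  ... | a , v′ , qs , val , z =
    a + 0 , ⇓-expand qs (done val) , λ b → ≤-reflexive (trans (+-identityʳ a) (z b))
  ⊴-⇓ r (step q d) with ⊴-step r q
  ... | c , e₁′ , qs , r₁ , z with ⊴-⇓ r₁ d
  ... | m′ , d′ , z′ = c + m′ , ⇓-expand qs d′ , λ b → +-mono-≤ (z b) (z′ b)

  -- Monotonicity and congruence of the approximants

  fix-⊑ : ∀ {b n p} {F G : (Fin p → Exp Λ n) → Fin p → Exp Λ n} →
          (∀ {f g} → f ⊑[ b ] g → F f ⊑[ b ] G g) → ∀ {j j′} → j ≤ j′ → fix F j ⊑[ b ] fix G j′
  fix-⊑ h z≤n      i = Ω⊴
  fix-⊑ h (s≤s le) i = h (fix-⊑ h le) i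

  mutual
    ⟦⟧-mono : ∀ {b g n m k k′} {σ τ : Fin n → Exp Λ m} → k ≤ k′ → σ ⊑[ b ] τ → (s : Exp g n) →
              ⟦ s ⟧ k σ ⊴[ b ] ⟦ s ⟧ k′ τ
    ⟦⟧-mono le e (var x)       = e x
    ⟦⟧-mono le e (app s t)     = app (⟦⟧-mono le e s) (⟦⟧-mono le e t)
    ⟦⟧-mono le e (lam s)       = lam (⟦⟧-mono le (⊑-lifts 1 e) s)
    ⟦⟧-mono le e (letrec E t)  =
      ⟦⟧-mono le (env-⊑ (fix-⊑ (λ fg → ⊴-lookup (⟦⟧-mono* le (env-⊑ fg e) E)) le) e) t
    ⟦⟧-mono le e (con τ c ss)  = con τ c (⟦⟧-mono* le e ss)
    ⟦⟧-mono le e (seq s t)     = seq (⟦⟧-mono le e s) (⟦⟧-mono le e t)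
    ⟦⟧-mono le e (case τ s rs) = case τ (⟦⟧-mono le e s) (⟦⟧-monoᵃ le e rs)

    ⟦⟧-mono* : ∀ {b g n m k k′} {σ τ : Fin n → Exp Λ m} → k ≤ k′ → σ ⊑[ b ] τ →
               ∀ {j} (ss : Vec (Exp g n) j) → ⟦ ss ⟧* k σ ⊴*[ b ] ⟦ ss ⟧* k′ τ
    ⟦⟧-mono* le e []       = []
    ⟦⟧-mono* le e (s ∷ ss) = ⟦⟧-mono le e s ∷ ⟦⟧-mono* le e ss

    ⟦⟧-monoᵃ : ∀ {b g n m k k′} {σ τ : Fin n → Exp Λ m} → k ≤ k′ → σ ⊑[ b ] τ →
               ∀ {ks} (rs : Alts g n ks) → ⟦ rs ⟧ᵃ k σ ⊴ᵃ[ b ] ⟦ rs ⟧ᵃ k′ τ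
    ⟦⟧-monoᵃ le e []       = []
    ⟦⟧-monoᵃ le e (r ∷ rs) = ⟦⟧-mono le (⊑-lifts _ e) r ∷ ⟦⟧-monoᵃ le e rs

  -- Hypotheses about the pair of environments, such as a bound on the value of one variable, that
  -- have to travel from the top of a context down to its hole. Binders rename the environments,
  -- hence `Stable`; `along` restates the hypothesis in the larger scope.
  Rel : ℕ → Set₁
  Rel n = ∀ {m} → (Fin n → Exp Λ m) → (Fin n → Exp Λ m) → Set

  Stable : ∀ {n} → Rel n → Set
  Stable {n} Q = ∀ {m m′} {ρ : Fin m → Fin m′} {σ τ : Fin n → Exp Λ m} {σ′ τ′ : Fin n → Exp Λ m′} →
                 rename ρ ∘ σ ≗ σ′ → rename ρ ∘ τ ≗ τ′ → Q σ τ → Q σ′ τ′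

  along : ∀ {k n} → (Fin n → Fin k) → Rel n → Rel k
  along w Q σ τ = Q (σ ∘ w) (τ ∘ w)

  along-stable : ∀ {k n} (w : Fin n → Fin k) {Q : Rel n} → Stable Q → Stable (along w Q)
  along-stable w st e e′ = st (e ∘ w) (e′ ∘ w)

  along-lifts : ∀ {n m} j {Q : Rel n} → Stable Q → {σ τ : Fin n → Exp Λ m} → Q σ τ →
                along (j ↑ʳ_) Q (lifts j σ) (lifts j τ)
  along-lifts j st {σ} {τ} = st (λ x → sym (lifts-↑ʳ j σ x)) (λ x → sym (lifts-↑ʳ j τ x))

  along-env : ∀ {n m p} {Q : Rel n} → Stable Q → {f g : Fin p → Exp Λ m} {σ τ : Fin n → Exp Λ m} →
              Q σ τ →
              along (p ↑ʳ_) Q (env f σ) (env g τ)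
  along-env {p = p} st {f} {g} {σ} {τ} = st {ρ = id}
    (λ x → trans (rename-id (λ _ → refl) (σ x)) (sym (env-↑ʳ p f σ x)))
    (λ x → trans (rename-id (λ _ → refl) (τ x)) (sym (env-↑ʳ p g τ x)))

  Below : ∀ {g n} → Bool → ℕ → ℕ → Rel n → Exp g n → Exp g n → Set
  Below {n = n} b k k′ Q u u′ =
    ∀ {m} {σ τ : Fin n → Exp Λ m} → σ ⊑[ b ] τ → Q σ τ → ⟦ u ⟧ k σ ⊴[ b ] ⟦ u′ ⟧ k′ τ

  mutual
    -- Congruence in which the premise at the hole is asked only for environments that the context
    -- can produce, so it may rely on Q. With the trivial Q it gives compatibility of `≲`, with a
    -- bound on one variable it gives the copying laws. If the hole lies in a binding, the claim is
    -- applied in every iteration.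
    plug-below : ∀ {b g j n k k′} → k ≤ k′ → (C : Ctx g j n) (Q : Rel n) → Stable Q → ∀ {u u′} →
                 Below b k k′ (along (wk C) Q) u u′ → Below b k k′ Q (plug C u) (plug C u′)
    plug-below le hole          Q st h e q = h e q
    plug-below le (appˡ C t)    Q st h e q = app (plug-below le C Q st h e q) (⟦⟧-mono le e t)
    plug-below le (appʳ s C)    Q st h e q = app (⟦⟧-mono le e s) (plug-below le C Q st h e q)
    plug-below le (lam C)       Q st h e q =
      lam (plug-below le C (along suc Q) (along-stable suc st) h (⊑-lifts 1 e) (along-lifts 1 st q))
    plug-below le (letrecᵉ {p = p} C t) Q st h e q =
      ⟦⟧-mono le (env-⊑ (fix-⊑ (λ fg → ⊴-lookup (plug-below* le C (along (suc p ↑ʳ_) Q) (along-stable (suc p ↑ʳ_) st)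
        h (env-⊑ fg e) (along-env {p = suc p} {Q} st q))) le) e) t
    plug-below le (letrecⁱ {p = p} E C) Q st h e q =
      plug-below le C (along (suc p ↑ʳ_) Q) (along-stable (suc p ↑ʳ_) st) h
        (env-⊑ (fix-⊑ (λ fg → ⊴-lookup (⟦⟧-mono* le (env-⊑ fg e) E)) le) e) (along-env {p = suc p} {Q} st q)
    plug-below le (con τ c C)   Q st h e q = con τ c (plug-below* le C Q st h e q)
    plug-below le (seqˡ C t)    Q st h e q = seq (plug-below le C Q st h e q) (⟦⟧-mono le e t)
    plug-below le (seqʳ s C)    Q st h e q = seq (⟦⟧-mono le e s) (plug-below le C Q st h e q)
    plug-below le (caseˢ τ C rs) Q st h e q = case τ (plug-below le C Q st h e q) (⟦⟧-monoᵃ le e rs)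
    plug-below le (caseᵃ τ s C) Q st h e q = case τ (⟦⟧-mono le e s) (plug-belowᵃ le C Q st h e q)

    plug-below* : ∀ {b g i n j k k′} → k ≤ k′ → (C : Ctxs g i n j) (Q : Rel n) → Stable Q → ∀ {u u′} →
                  Below b k k′ (along (wk* C) Q) u u′ → ∀ {m} {σ τ : Fin n → Exp Λ m} → σ ⊑[ b ] τ → Q σ τ →
                  ⟦ plug* C u ⟧* k σ ⊴*[ b ] ⟦ plug* C u′ ⟧* k′ τ
    plug-below* le (here C ss) Q st h e q = plug-below le C Q st h e q ∷ ⟦⟧-mono* le e ss
    plug-below* le (there s C) Q st h e q = ⟦⟧-mono le e s ∷ plug-below* le C Q st h e q

    plug-belowᵃ : ∀ {b g i n ks k k′} → k ≤ k′ → (C : AltsCtx g i n ks) (Q : Rel n) → Stable Q →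
                  ∀ {u u′} →
                  Below b k k′ (along (wkᵃ C) Q) u u′ → ∀ {m} {σ τ : Fin n → Exp Λ m} → σ ⊑[ b ] τ → Q σ τ →
                  ⟦ plugᵃ C u ⟧ᵃ k σ ⊴ᵃ[ b ] ⟦ plugᵃ C u′ ⟧ᵃ k′ τ
    plug-belowᵃ le (here {j = j} C rs) Q st h e q =
      plug-below le C (along (j ↑ʳ_) Q) (along-stable (j ↑ʳ_) st) h (⊑-lifts j e) (along-lifts j st q) ∷ ⟦⟧-monoᵃ le e rs
    plug-belowᵃ le (there r C) Q st h e q = ⟦⟧-mono le (⊑-lifts _ e) r ∷ plug-belowᵃ le C Q st h e q

  infix 4 _≲[_]_
  -- `index` tells how many unfoldings the right side needs in order to cover k on the left. All
  -- letrecs of an expression share one index, so the claim must hold for every larger index too,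
  -- and k ≤ `index k` is what the surrounding context needs in `plug-≲`.
  record _≲[_]_ {g n} (s : Exp g n) (b : Bool) (t : Exp g n) : Set where
    constructor below
    field
      index     : ℕ → ℕ
      index-≤   : ∀ k → k ≤ index k
      approx    : ∀ {k k′} → index k ≤ k′ → ∀ {m} {σ τ : Fin n → Exp Λ m} → σ ⊑[ b ] τ → ⟦ s ⟧ k σ ⊴[ b ] ⟦ t ⟧ k′ τ

  plug-≲ : ∀ {g k n b} (C : Ctx g k n) {u u′} → u ≲[ b ] u′ → plug C u ≲[ b ] plug C u′
  plug-≲ C (below h h≤ r) = below h h≤ λ {k} le e →
    plug-below (≤-trans (h≤ k) le) C (λ _ _ → ⊤) (λ _ _ _ → tt) (λ e _ → r le e) e tt

  infix 4 _↓[_]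
  _↓[_] : ∀ {g n} → Exp g n → ℕ → Set
  s ↓[ m ] = ∃ λ k → ⟦ s ⟧ k var ⇓[ m ]

  ≲-↓ : ∀ {g n b m} {s t : Exp g n} → s ≲[ b ] t → s ↓[ m ] → ∃ λ m′ →
        t ↓[ m′ ] × (b ≡ false → m′ ≤ m)
  ≲-↓ (below h _ r) (k , d) with ⊴-⇓ (r ≤-refl (λ x → ⊴-refl (var x))) d
  ... | m′ , d′ , z = m′ , (h k , d′) , z

  -- Laws of letrec

  ⊴-≡ : ∀ {n b} {s s′ t t′ : Exp Λ n} → s ≡ s′ → t ≡ t′ → s′ ⊴[ b ] t′ → s ⊴[ b ] t
  ⊴-≡ refl refl r = r

  sol : ∀ {g n m p} → Vec (Exp g (p + n)) p → ℕ → (Fin n → Exp Λ m) → ℕ → Fin p → Exp Λ m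
  sol E k σ = fix (λ f → lookup (⟦ E ⟧* k (env f σ)))

  sol-suc : ∀ {g g′ b n n′ m p p′} (E : Vec (Exp g (p + n)) p) (E′ : Vec (Exp g′ (p′ + n′)) p′) {k k′ j j′}
            {σ : Fin n → Exp Λ m} {τ : Fin n′ → Exp Λ m} i i′ →
            ⟦ lookup E i ⟧ k (env (sol E k σ j) σ) ⊴[ b ] ⟦ lookup E′ i′ ⟧ k′ (env (sol E′ k′ τ j′) τ) →
            sol E k σ (suc j) i ⊴[ b ] sol E′ k′ τ (suc j′) i′
  sol-suc E E′ i i′ = ⊴-≡ (lookup-⟦⟧ E i) (lookup-⟦⟧ E′ i′)

  sol-mono : ∀ {b g n m p k k′ j j′} {σ τ : Fin n → Exp Λ m} (E : Vec (Exp g (p + n)) p) →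
             k ≤ k′ → σ ⊑[ b ] τ → j ≤ j′ → sol E k σ j ⊑[ b ] sol E k′ τ j′
  sol-mono E le e = fix-⊑ (λ fg → ⊴-lookup (⟦⟧-mono* le (env-⊑ fg e) E))

  chain-length : ∀ {g p n} {E : Vec (Exp g (p + n)) p} {x₁ x} → Chain E x₁ x → ℕ
  chain-length []      = 0
  chain-length (c ▸ _) = suc (chain-length c)

  -- A chain of length c delays the solution for its last variable by c iterations.
  chain-⊴ : ∀ {b g p n m k k′} {E : Vec (Exp g (p + n)) p} {x₁ x} {σ τ : Fin n → Exp Λ m} {h : Fin p → Exp Λ m} →
            Chain E x₁ x → k ≤ k′ → σ ⊑[ b ] τ → ∀ j → (∀ {i} → i ≤ j → sol E k σ i ⊑[ b ] h) →
            sol E k σ j x ⊴[ b ] ⟦ lookup E x₁ ⟧ k′ (env h τ)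
  chain-⊴ c le e zero hyp = Ω⊴
  chain-⊴ {E = E} {x₁} [] le e (suc j) hyp =
    ⊴-≡ (lookup-⟦⟧ E x₁) refl (⟦⟧-mono le (env-⊑ (hyp (n≤1+n j)) e) (lookup E x₁))
  chain-⊴ {k = k} {E = E} {x = y} {σ} (_▸_ {x = x} c eq) le e (suc j) hyp =
    ⊴-≡ (trans (lookup-⟦⟧ E y) (trans (cong (λ s → ⟦ s ⟧ k (env (sol E k σ j) σ)) eq) (env-↑ˡ (sol E k σ j) σ x))) refl
        (chain-⊴ c le e j (λ i≤j → hyp (≤-trans i≤j (n≤1+n j))))

  -- Each link of the chain uses one iteration and the binding of x₁ uses one more; i₀ iterations
  -- must remain for the variables inside that binding.
  chain-⊵ : ∀ {b g p n m k k′} {E : Vec (Exp g (p + n)) p} {x₁ x} {σ τ : Fin n → Exp Λ m} {h : Fin p → Exp Λ m} {i₀} →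
            (c : Chain E x₁ x) → k ≤ k′ → σ ⊑[ b ] τ → (∀ {i} → i₀ ≤ i → h ⊑[ b ] sol E k′ τ i) →
            ∀ {j} → suc (chain-length c + i₀) ≤ j → ⟦ lookup E x₁ ⟧ k (env h σ) ⊴[ b ] sol E k′ τ j x
  chain-⊵ {E = E} {x₁} [] le e hyp (s≤s lt) =
    ⊴-≡ refl (lookup-⟦⟧ E x₁) (⟦⟧-mono le (env-⊑ (hyp lt) e) (lookup E x₁))
  chain-⊵ {k′ = k′} {E} {x = y} {τ = τ} (_▸_ {x = x} c eq) le e hyp {suc j} (s≤s lt) =
    ⊴-≡ refl (trans (lookup-⟦⟧ E y) (trans (cong (λ s → ⟦ s ⟧ k′ (env (sol E k′ τ j) τ)) eq) (env-↑ˡ (sol E k′ τ j) τ x)))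
        (chain-⊵ c le e hyp lt)

  -- w′ arises from w by replacing an occurrence of the variable x of the context
  -- C by u.
  record Replaces {g j n} (C : Ctx g j n) (x : Fin n) (u : Exp g n) (w w′ : Exp g j) : Set where
    field
      replace   : ∀ {b k k′ m} {σ τ : Fin j → Exp Λ m} → k ≤ k′ → σ ⊑[ b ] τ →
                  σ (wk C x) ⊴[ b ] ⟦ u ⟧ k′ (τ ∘ wk C) → ⟦ w ⟧ k σ ⊴[ b ] ⟦ w′ ⟧ k′ τ
      unreplace : ∀ {b k k′ m} {σ τ : Fin j → Exp Λ m} → k ≤ k′ → σ ⊑[ b ] τ →
                  ⟦ u ⟧ k (σ ∘ wk C) ⊴[ b ] τ (wk C x) → ⟦ w′ ⟧ k σ ⊴[ b ] ⟦ w ⟧ k′ τ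
  open Replaces

  -- The bound on x is passed to the occurrence as the relation Q of `plug-below`; it is stable
  -- because renaming preserves the simulation.
  copy→ : ∀ {b g j n m k k′} → k ≤ k′ → (C : Ctx g j n) (x : Fin n) {u : Exp g n} {w w′ : Exp g j} →
          Replaces C x u w w′ →
          {σ τ : Fin n → Exp Λ m} → σ ⊑[ b ] τ → σ x ⊴[ b ] ⟦ u ⟧ k′ τ → ⟦ plug C w ⟧ k σ ⊴[ b ] ⟦ plug C w′ ⟧ k′ τ
  copy→ {b} {k′ = k′} le C x {u} r = plug-below le C (λ σ τ → σ x ⊴[ b ] ⟦ u ⟧ k′ τ)
    (λ {_} {_} {ρ} eσ eτ r → ⊴-≡ (sym (eσ x)) (sym (rename-⟦⟧ eτ u)) (⊴-rename ρ r))
    (λ e q → replace r le e q)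

  copy← : ∀ {b g j n m k k′} → k ≤ k′ → (C : Ctx g j n) (x : Fin n) {u : Exp g n} {w w′ : Exp g j} →
          Replaces C x u w w′ →
          {σ τ : Fin n → Exp Λ m} → σ ⊑[ b ] τ → ⟦ u ⟧ k σ ⊴[ b ] τ x → ⟦ plug C w′ ⟧ k σ ⊴[ b ] ⟦ plug C w ⟧ k′ τ
  copy← {b} {k = k} le C x {u} r = plug-below le C (λ σ τ → ⟦ u ⟧ k σ ⊴[ b ] τ x)
    (λ {_} {_} {ρ} eσ eτ r → ⊴-≡ (sym (rename-⟦⟧ eσ u)) (sym (eτ x)) (⊴-rename ρ r))
    (λ e q → unreplace r le e q)

  update-elim : ∀ {A : Set} {p} (E : Vec A p) y u (P : Fin p → A → Set) → P y u →
                (∀ i → P i (lookup E i)) →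
                ∀ i → P i (lookup (E [ y ]≔ u) i)
  update-elim E y u P py pi i with i ≟ y
  ... | yes refl = transport (P y) (sym (lookup∘update y E u)) py
  ... | no  i≢y  = transport (P i) (sym (lookup∘update′ i≢y E u)) (pi i)

  module _ {g n j p} {h h′ : HasLetrec g} {l l′ : Ann g} {E : Vec (Exp g (suc p + n)) (suc p)} {x₁ x}
           (C : Ctx g j (suc p + n)) (c : Chain E x₁ x) {w w′ : Exp g j} (R : Replaces C (x ↑ˡ n) (lookup E x₁) w w′) where

    private
      occurrence copied : Exp g (suc p + n)
      occurrence = plug C w
      copied     = plug C w′

    copy-in : ∀ {b} → letrec {h = h} {l = l} E occurrence ≲[ b ] letrec {h = h′} {l = l′} E copied
    copy-in = below id (λ _ → ≤-refl) λ {k} {k′} le {_} {σ} {τ} e →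
      copy→ le C (x ↑ˡ n) R (env-⊑ (sol-mono E le e le) e)
        (⊴-≡ (env-↑ˡ (sol E k σ k) σ x) refl (chain-⊴ c le e k (λ i≤k → sol-mono E le e (≤-trans i≤k le))))

    copy-in⁻¹ : ∀ {b} → letrec {h = h} {l = l} E copied ≲[ b ] letrec {h = h′} {l = l′} E occurrence
    -- Reading the value through the chain takes `suc (chain-length c)` iterations more than having
    -- the copy in place.
    copy-in⁻¹ = below (λ k → suc (chain-length c + k)) h≤ λ {k} {k′} le {_} {σ} {τ} e →
      let k≤ = ≤-trans (h≤ k) le in
      copy← k≤ C (x ↑ˡ n) R (env-⊑ (sol-mono E k≤ e k≤) e)
        (⊴-≡ refl (env-↑ˡ (sol E k′ τ k′) τ x) (chain-⊵ c k≤ e (sol-mono E k≤ e) le))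
      where
      h≤ : ∀ k → k ≤ suc (chain-length c + k)
      h≤ k = ≤-trans (m≤n+m k (chain-length c)) (n≤1+n _)

    module _ {y} (Ey : lookup E y ≡ occurrence) where
      private
        E′ : Vec (Exp g (suc p + n)) (suc p)
        E′ = E [ y ]≔ copied

      -- `chain-⊴` asks for the claim at all earlier stages, since it is not known at which stage
      -- the chain ends. The bound B turns this course-of-values induction into structural
      -- recursion.
      copy-e-sol : ∀ {b m k k′} {σ τ : Fin n → Exp Λ m} → k ≤ k′ → σ ⊑[ b ] τ →
                   ∀ B {j j′} → j ≤ B → j ≤ j′ → sol E k σ j ⊑[ b ] sol E′ k′ τ j′
      copy-e-sol le e B       {zero}               _          _        i = Ω⊴
      copy-e-sol {b} {k = k} {k′} {σ} {τ} le e (suc B) {suc j} {suc j′} (s≤s lt) (s≤s lt′) i =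
        sol-suc E E′ {j = j} {j′} i i (update-elim E y copied (λ i s → ⟦ lookup E i ⟧ k (env (sol E k σ j) σ) ⊴[ b ] ⟦ s ⟧ k′ (env (sol E′ k′ τ j′) τ))
          (⊴-≡ (cong (λ s → ⟦ s ⟧ k (env (sol E k σ j) σ)) Ey) refl
            (copy→ le C (x ↑ˡ n) R (env-⊑ (copy-e-sol le e B lt lt′) e)
              (⊴-≡ (env-↑ˡ (sol E k σ j) σ x) refl
                (chain-⊴ c le e j (λ i≤j → copy-e-sol le e B (≤-trans i≤j lt) (≤-trans i≤j lt′))))))
          (λ i → ⟦⟧-mono le (env-⊑ (copy-e-sol le e B lt lt′) e) (lookup E i)) i)

      copy-e : ∀ {b t} → letrec {h = h} {l = l} E t ≲[ b ] letrec {h = h′} {l = l′} E′ t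
      copy-e {t = t} =
        below id (λ _ → ≤-refl) λ {k} le e → ⟦⟧-mono le (env-⊑ (copy-e-sol le e k ≤-refl le) e) t

      private
        -- The iterations of E that replace one iteration of E′: one for the binding y and
        -- `suc (chain-length c)` to bring the value of x₁ through the chain.
        speed : ℕ
        speed = suc (suc (chain-length c))

      copy-e-sol⁻¹ : ∀ {b m k k′} {σ τ : Fin n → Exp Λ m} → k ≤ k′ → σ ⊑[ b ] τ →
                     ∀ j {j′} → j * speed ≤ j′ → sol E′ k σ j ⊑[ b ] sol E k′ τ j′
      copy-e-sol⁻¹ le e zero lt i = Ω⊴
      copy-e-sol⁻¹ {b} {k = k} {k′} {σ} {τ} le e (suc j) {suc j′} (s≤s lt) i =
        sol-suc E′ E {j = j} {j′} i i (update-elim E y copied (λ i s → ⟦ s ⟧ k (env (sol E′ k σ j) σ) ⊴[ b ] ⟦ lookup E i ⟧ k′ (env (sol E k′ τ j′) τ))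
          (⊴-≡ refl (cong (λ s → ⟦ s ⟧ k′ (env (sol E k′ τ j′) τ)) Ey)
            (copy← le C (x ↑ˡ n) R (env-⊑ (copy-e-sol⁻¹ le e j lt′) e)
              (⊴-≡ refl (env-↑ˡ (sol E k′ τ j′) τ x) (chain-⊵ c le e (copy-e-sol⁻¹ le e j) lt))))
          (λ i → ⟦⟧-mono le (env-⊑ (copy-e-sol⁻¹ le e j lt′) e) (lookup E i)) i)
        where
        lt′ : j * speed ≤ j′
        lt′ = ≤-trans (≤-trans (m≤n+m _ (chain-length c)) (n≤1+n _)) lt

      copy-e⁻¹ : ∀ {b t} → letrec {h = h} {l = l} E′ t ≲[ b ] letrec {h = h′} {l = l′} E t
      copy-e⁻¹ {t = t} = below (_* speed) (λ k → m≤m*n k speed) λ {k} le e →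
        ⟦⟧-mono (≤-trans (m≤m*n k speed) le) (env-⊑ (copy-e-sol⁻¹ (≤-trans (m≤m*n k speed) le) e k le) e) t

  -- Merging two groups of bindings

  env-old : ∀ {n m p q} (f : Fin (p + q) → Exp Λ m) (σ : Fin n → Exp Λ m) →
            env f σ ∘ old {p} {q} {n} ≗ env (f ∘ (_↑ˡ q)) σ
  env-old {n} {p = p} {q} f σ = splitCases p
    (λ i → trans (cong (env f σ) (cong [ _ , _ ]′ (splitAt-↑ˡ p i n)))
      (trans (env-↑ˡ f σ (i ↑ˡ q)) (sym (env-↑ˡ (f ∘ (_↑ˡ q)) σ i))))
    (λ j → trans (cong (env f σ) (cong [ _ , _ ]′ (splitAt-↑ʳ p n j)))
      (trans (env-↑ʳ (p + q) f σ j) (sym (env-↑ʳ p (f ∘ (_↑ˡ q)) σ j))))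

  env-new : ∀ {n m p q} (f : Fin (p + q) → Exp Λ m) (σ : Fin n → Exp Λ m) →
            env f σ ∘ new {p} {q} {n} ≗ env (f ∘ (p ↑ʳ_)) (env (f ∘ (_↑ˡ q)) σ)
  env-new {n} {p = p} {q} f σ = splitCases q
    (λ i → trans (cong (env f σ) (cong [ _ , _ ]′ (splitAt-↑ˡ q i (p + n))))
      (trans (env-↑ˡ f σ (p ↑ʳ i)) (sym (env-↑ˡ (f ∘ (p ↑ʳ_)) _ i))))
    (λ j → trans (cong (env f σ) (cong [ _ , _ ]′ (splitAt-↑ʳ q (p + n) j)))
      (trans (env-old {p = p} {q} f σ j) (sym (env-↑ʳ q (f ∘ (p ↑ʳ_)) _ j))))

  ⟦old⟧ : ∀ {g n m p q k} {f : Fin (p + q) → Exp Λ m} {σ : Fin n → Exp Λ m} (s : Exp g (p + n)) →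
          ⟦ rename (old {p} {q}) s ⟧ k (env f σ) ≡ ⟦ s ⟧ k (env (f ∘ (_↑ˡ q)) σ)
  ⟦old⟧ {p = p} {q} {f = f} {σ} s = ⟦⟧-rename (env-old {p = p} {q} f σ) s

  ⟦new⟧ : ∀ {g n m p q k} {f : Fin (p + q) → Exp Λ m} {σ : Fin n → Exp Λ m} (s : Exp g (q + (p + n))) →
          ⟦ rename (new {p} {q}) s ⟧ k (env f σ) ≡ ⟦ s ⟧ k (env (f ∘ (p ↑ʳ_)) (env (f ∘ (_↑ˡ q)) σ))
  ⟦new⟧ {p = p} {q} {f = f} {σ} s = ⟦⟧-rename (env-new {p = p} {q} f σ) s

  ⊴*-tabulate : ∀ {b n k} (ss ss′ : Vec (Exp Λ n) k) → lookup ss ⊑[ b ] lookup ss′ → ss ⊴*[ b ] ss′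
  ⊴*-tabulate []       []         h = []
  ⊴*-tabulate (s ∷ ss) (s′ ∷ ss′) h = h zero ∷ ⊴*-tabulate ss ss′ (h ∘ suc)

  ⟦at⟧ : ∀ {g n m} {s s′ : Exp g n} {k} {σ : Fin n → Exp Λ m} {e} → s ≡ s′ → ⟦ s′ ⟧ k σ ≡ e →
         ⟦ s ⟧ k σ ≡ e
  ⟦at⟧ refl eq = eq

  module _ {g n p q} {h h′ h″ : HasLetrec g} {l l′ l″ : Ann g} (E₁ : Vec (Exp g (suc p + n)) (suc p))
           (E₂ : Vec (Exp g (suc q + (suc p + n))) (suc q)) (s : Exp g (suc q + (suc p + n))) where

    private
      M : Vec (Exp g ((suc p + suc q) + n)) (suc p + suc q)
      M = rename* (old {suc p}) E₁ ++ rename* (new {suc p}) E₂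

      Mˡ : ∀ i → lookup M (i ↑ˡ suc q) ≡ rename (old {suc p}) (lookup E₁ i)
      Mˡ i =
        trans (lookup-++ˡ (rename* (old {suc p} {suc q}) E₁) _ i) (lookup-rename* (old {suc p} {suc q}) E₁ i)

      Mʳ : ∀ i → lookup M (suc p ↑ʳ i) ≡ rename (new {suc p}) (lookup E₂ i)
      Mʳ i =
        trans (lookup-++ʳ (rename* (old {suc p} {suc q}) E₁) _ i) (lookup-rename* (new {suc p} {suc q}) E₂ i)

      module _ {b m k k′} {σ τ : Fin n → Exp Λ m} (le : k ≤ k′) (e : σ ⊑[ b ] τ) where
        outer→ : ∀ {j j′} → j ≤ j′ → sol E₁ k σ j ⊑[ b ] sol M k′ τ j′ ∘ (_↑ˡ suc q)
        outer→ z≤n i = Ω⊴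
        outer→ {suc j} {suc j′} (s≤s lt) i = sol-suc E₁ M {j = j} {j′} i (i ↑ˡ suc q)
          (⊴-≡ refl (⟦at⟧ (Mˡ i) (⟦old⟧ {p = suc p} {suc q} (lookup E₁ i))) (⟦⟧-mono le (env-⊑ (outer→ lt) e) (lookup E₁ i)))

        -- The nested letrec iterates E₂ over outer bindings frozen at stage J, whereas in the
        -- merged group the outer stage falls together with the inner one. After j inner iterations
        -- it must still be at least J. For j = J = k this explains the index k + k of `llet-in-≲`.
        inner→ : ∀ J j {j′} → j + J ≤ j′ →
                 sol E₂ k (env (sol E₁ k σ J) σ) j ⊑[ b ] sol M k′ τ j′ ∘ (suc p ↑ʳ_)
        inner→ J zero lt i = Ω⊴
        inner→ J (suc j) {suc j′} (s≤s lt) i = sol-suc E₂ M {j = j} {j′} i (suc p ↑ʳ i)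
          (⊴-≡ refl (⟦at⟧ (Mʳ i) (⟦new⟧ {p = suc p} {suc q} (lookup E₂ i)))
            (⟦⟧-mono le (env-⊑ (inner→ J j lt) (env-⊑ (outer→ (≤-trans (m≤n+m J j) lt)) e)) (lookup E₂ i)))

        outer← : ∀ {j j′} → j ≤ j′ → sol M k σ j ∘ (_↑ˡ suc q) ⊑[ b ] sol E₁ k′ τ j′
        outer← z≤n i = Ω⊴
        outer← {suc j} {suc j′} (s≤s lt) i = sol-suc M E₁ {j = j} {j′} (i ↑ˡ suc q) i
          (⊴-≡ (⟦at⟧ (Mˡ i) (⟦old⟧ {p = suc p} {suc q} (lookup E₁ i))) refl (⟦⟧-mono le (env-⊑ (outer← lt) e) (lookup E₁ i)))

        inner← : ∀ {J j j′} → j ≤ j′ → j ≤ J →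
                 sol M k σ j ∘ (suc p ↑ʳ_) ⊑[ b ] sol E₂ k′ (env (sol E₁ k′ τ J) τ) j′
        inner← z≤n _ i = Ω⊴
        inner← {J} {suc j} {suc j′} (s≤s lt) lt′ i = sol-suc M E₂ {j = j} {j′} (suc p ↑ʳ i) i
          (⊴-≡ (⟦at⟧ (Mʳ i) (⟦new⟧ {p = suc p} {suc q} (lookup E₂ i))) refl
            (⟦⟧-mono le (env-⊑ (inner← lt (≤-trans (n≤1+n j) lt′)) (env-⊑ (outer← (≤-trans (n≤1+n j) lt′)) e)) (lookup E₂ i)))

    llet-in-≲ : ∀ {b} → letrec {h = h} {l = l} E₁ (letrec {h = h′} {l = l′} E₂ s) ≲[ b ]
                letrec {h = h″} {l = l″} M (rename (new {suc p}) s)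
    llet-in-≲ = below (λ k → k + k) (λ k → m≤m+n k k) λ {k} lt e →
      let le = ≤-trans (m≤m+n k k) lt in
      ⊴-≡ refl (⟦new⟧ {p = suc p} {suc q} s) (⟦⟧-mono le (env-⊑ (inner→ le e k k lt) (env-⊑ (outer→ le e le) e)) s)

    llet-in-≳ : ∀ {b} → letrec {h = h″} {l = l″} M (rename (new {suc p}) s) ≲[ b ]
                letrec {h = h} {l = l} E₁ (letrec {h = h′} {l = l′} E₂ s)
    llet-in-≳ = below id (λ _ → ≤-refl) λ le e →
      ⊴-≡ (⟦new⟧ {p = suc p} {suc q} s) refl (⟦⟧-mono le (env-⊑ (inner← le e le le) (env-⊑ (outer← le e le) e)) s)

  module _ {g n p q} {h h′ : HasLetrec g} {l l′ : Ann g} (E₁ : Vec (Exp g (suc p + n)) (suc p)) {x}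
           {E₂ : Vec (Exp g (suc q + (suc p + n))) (suc q)} {s : Exp g (suc q + (suc p + n))}
           {h₀ : HasLetrec g} {l₀ : Ann g} (eq : lookup E₁ x ≡ letrec {h = h₀} {l = l₀} E₂ s) (t : Exp g (suc p + n)) where

    private
      U : Vec (Exp g ((suc p + suc q) + n)) (suc p)
      U = rename* (old {suc p}) E₁ [ x ]≔ rename (new {suc p}) s

      M : Vec (Exp g ((suc p + suc q) + n)) (suc p + suc q)
      M = U ++ rename* (new {suc p}) E₂

      Mʳ : ∀ i → lookup M (suc p ↑ʳ i) ≡ rename (new {suc p}) (lookup E₂ i)
      Mʳ i = trans (lookup-++ʳ U _ i) (lookup-rename* (new {suc p} {suc q}) E₂ i)

      M-elim : (P : Fin (suc p) → Exp g ((suc p + suc q) + n) → Set) → P x (rename (new {suc p}) s) →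
               (∀ i → P i (rename (old {suc p}) (lookup E₁ i))) → ∀ i → P i (lookup M (i ↑ˡ suc q))
      M-elim P px pi i = transport (P i) (sym (lookup-++ˡ U _ i))
        (update-elim (rename* (old {suc p} {suc q}) E₁) x (rename (new {suc p}) s) P px (λ i → transport (P i) (sym (lookup-rename* (old {suc p} {suc q}) E₁ i)) (pi i)) i)

      module _ {b m k k′} {σ τ : Fin n → Exp Λ m} (le : k ≤ k′) (e : σ ⊑[ b ] τ) where
        mutual
          -- A letrec nested in a binding starts its k iterations afresh in each outer iteration.
          -- One outer iteration thus costs k + 1 of the merged group: k for E₂ and one for the
          -- binding itself.
          outer→ : ∀ j {j′} → j * suc k ≤ j′ → sol E₁ k σ j ⊑[ b ] sol M k′ τ j′ ∘ (_↑ˡ suc q)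
          outer→ zero    lt i = Ω⊴
          outer→ (suc j) {suc j′} (s≤s lt) i = sol-suc E₁ M {j = j} {j′} i (i ↑ˡ suc q)
            (M-elim (λ i s → ⟦ lookup E₁ i ⟧ k (env (sol E₁ k σ j) σ) ⊴[ b ] ⟦ s ⟧ k′ (env (sol M k′ τ j′) τ))
              (⊴-≡ (⟦at⟧ eq refl) (⟦new⟧ {p = suc p} {suc q} s) (⟦⟧-mono le (env-⊑ (inner→ j k lt) (env-⊑ (outer→ j lt′) e)) s))
              (λ i → ⊴-≡ refl (⟦old⟧ {p = suc p} {suc q} (lookup E₁ i)) (⟦⟧-mono le (env-⊑ (outer→ j lt′) e) (lookup E₁ i))) i)
            where lt′ = ≤-trans (m≤n+m (j * suc k) k) lt

          inner→ : ∀ j i₀ {j′} → i₀ + j * suc k ≤ j′ →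
                   sol E₂ k (env (sol E₁ k σ j) σ) i₀ ⊑[ b ] sol M k′ τ j′ ∘ (suc p ↑ʳ_)
          inner→ j zero     lt i = Ω⊴
          inner→ j (suc i₀) {suc j′} (s≤s lt) i = sol-suc E₂ M {j = i₀} {j′} i (suc p ↑ʳ i)
            (⊴-≡ refl (⟦at⟧ (Mʳ i) (⟦new⟧ {p = suc p} {suc q} (lookup E₂ i)))
              (⟦⟧-mono le (env-⊑ (inner→ j i₀ lt) (env-⊑ (outer→ j (≤-trans (m≤n+m (j * suc k) i₀) lt)) e)) (lookup E₂ i)))

        mutual
          -- The bound j ≤ k′ appears because the nested letrec on the right is iterated exactly k′
          -- times, whatever the outer stage.
          outer← : ∀ j {j′} → j ≤ j′ → j ≤ k′ → sol M k σ j ∘ (_↑ˡ suc q) ⊑[ b ] sol E₁ k′ τ j′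
          outer← zero    _        _   i = Ω⊴
          outer← (suc j) {suc j′} (s≤s lt) lt′ i = sol-suc M E₁ {j = j} {j′} (i ↑ˡ suc q) i
            (M-elim (λ i s → ⟦ s ⟧ k (env (sol M k σ j) σ) ⊴[ b ] ⟦ lookup E₁ i ⟧ k′ (env (sol E₁ k′ τ j′) τ))
              (⊴-≡ (⟦new⟧ {p = suc p} {suc q} s) (⟦at⟧ eq refl) (⟦⟧-mono le (env-⊑ (inner← j lt″ lt lt″) (env-⊑ (outer← j lt lt″) e)) s))
              (λ i → ⊴-≡ (⟦old⟧ {p = suc p} {suc q} (lookup E₁ i)) refl (⟦⟧-mono le (env-⊑ (outer← j lt lt″) e) (lookup E₁ i))) i)
            where lt″ = ≤-trans (n≤1+n j) lt′

          inner← : ∀ j {J j′} → j ≤ j′ → j ≤ J → j ≤ k′ →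
                   sol M k σ j ∘ (suc p ↑ʳ_) ⊑[ b ] sol E₂ k′ (env (sol E₁ k′ τ J) τ) j′
          inner← zero    _        _   _   i = Ω⊴
          inner← (suc j) {J} {suc j′} (s≤s lt) lt′ lt″ i = sol-suc M E₂ {j = j} {j′} (suc p ↑ʳ i) i
            (⊴-≡ (⟦at⟧ (Mʳ i) (⟦new⟧ {p = suc p} {suc q} (lookup E₂ i))) refl
              (⟦⟧-mono le (env-⊑ (inner← j lt (≤-trans (n≤1+n j) lt′) (≤-trans (n≤1+n j) lt″))
                                 (env-⊑ (outer← j (≤-trans (n≤1+n j) lt′) (≤-trans (n≤1+n j) lt″)) e)) (lookup E₂ i)))

    llet-e-≲ : ∀ {b} →
               letrec {h = h} {l = l} E₁ t ≲[ b ] letrec {h = h′} {l = l′} M (rename (old {suc p} {suc q}) t)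
    llet-e-≲ = below (λ k → k * suc k) (λ k → m≤m*n k (suc k)) λ {k} lt e →
      let le = ≤-trans (m≤m*n k (suc k)) lt in
      ⊴-≡ refl (⟦old⟧ {p = suc p} {suc q} t) (⟦⟧-mono le (env-⊑ (outer→ le e k lt) e) t)

    llet-e-≳ : ∀ {b} →
               letrec {h = h′} {l = l′} M (rename (old {suc p} {suc q}) t) ≲[ b ] letrec {h = h} {l = l} E₁ t
    llet-e-≳ = below id (λ _ → ≤-refl) λ {k} le e →
      ⊴-≡ (⟦old⟧ {p = suc p} {suc q} t) refl (⟦⟧-mono le (env-⊑ (outer← le e k le le) e) t)

  module _ {n p} {l l′ l₀ : Maybe Label} (E : Vec (LExp (suc p + n)) (suc p)) {x₁ τ₀ c} {ss : Vec (LExp (suc p + n)) (ar τ₀ c)}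
           (eq : lookup E x₁ ≡ con {l = l₀} τ₀ c ss) (t : LExp (suc p + n)) where

    private
      q : ℕ
      q = ar τ₀ c

      ys : Vec (LExp ((suc p + q) + n)) q
      ys = tabulate λ i → var {l = nothing} ((suc p ↑ʳ i) ↑ˡ n)

      U : Vec (LExp ((suc p + q) + n)) (suc p)
      U = rename* (old {suc p}) E [ x₁ ]≔ con {l = nothing} τ₀ c ys

      M : Vec (LExp ((suc p + q) + n)) (suc p + q)
      M = caseEnv {p} E x₁ τ₀ c ss

      Mʳ : ∀ i → lookup M (suc p ↑ʳ i) ≡ rename (old {suc p}) (lookup ss i)
      Mʳ i = trans (lookup-++ʳ U _ i) (lookup-rename* (old {suc p} {q}) ss i)

      M-elim : (P : Fin (suc p) → LExp ((suc p + q) + n) → Set) → P x₁ (con {l = nothing} τ₀ c ys) →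
               (∀ i → P i (rename (old {suc p}) (lookup E i))) → ∀ i → P i (lookup M (i ↑ˡ q))
      M-elim P px pi i = transport (P i) (sym (lookup-++ˡ U _ i))
        (update-elim (rename* (old {suc p} {q}) E) x₁ (con {l = nothing} τ₀ c ys) P px (λ i → transport (P i) (sym (lookup-rename* (old {suc p} {q}) E i)) (pi i)) i)

      ⟦ys⟧ : ∀ {m k} {f : Fin (suc p + q) → Exp Λ m} {σ : Fin n → Exp Λ m} i →
             lookup (⟦ ys ⟧* k (env f σ)) i ≡ f (suc p ↑ʳ i)
      ⟦ys⟧ {k = k} {f} {σ} i =
        trans (lookup-⟦⟧ ys i) (⟦at⟧ {k = k} (lookup∘tabulate _ i) (env-↑ˡ f σ (suc p ↑ʳ i)))

      module _ {b m k k′} {σ τ : Fin n → Exp Λ m} (le : k ≤ k′) (e : σ ⊑[ b ] τ) where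
        -- An argument of the constructor is now reached through the new variable yᵢ, which takes
        -- one iteration of its own; hence the factor 2.
        env→ : ∀ j {j′} → j * 2 ≤ j′ → sol E k σ j ⊑[ b ] sol M k′ τ j′ ∘ (_↑ˡ q)
        env→ zero    lt i = Ω⊴
        env→ (suc j) {suc (suc j′)} (s≤s (s≤s lt)) i = sol-suc E M {j = j} {suc j′} i (i ↑ˡ q)
          (M-elim (λ i s → ⟦ lookup E i ⟧ k (env (sol E k σ j) σ) ⊴[ b ] ⟦ s ⟧ k′ (env (sol M k′ τ (suc j′)) τ))
            (⊴-≡ (⟦at⟧ eq refl) refl (con τ₀ c (⊴*-tabulate _ _ λ i →
              ⊴-≡ (lookup-⟦⟧ ss i) (trans (⟦ys⟧ i) (trans (lookup-⟦⟧ M (suc p ↑ʳ i)) (⟦at⟧ (Mʳ i) (⟦old⟧ {p = suc p} {q} (lookup ss i)))))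
                  (⟦⟧-mono le (env-⊑ (env→ j lt) e) (lookup ss i)))))
            (λ i → ⊴-≡ refl (⟦old⟧ {p = suc p} {q} (lookup E i)) (⟦⟧-mono le (env-⊑ (env→ j (≤-trans lt (n≤1+n j′))) e) (lookup E i))) i)

        mutual
          env← : ∀ j {j′} → j ≤ j′ → sol M k σ j ∘ (_↑ˡ q) ⊑[ b ] sol E k′ τ j′
          env← zero    lt i = Ω⊴
          env← (suc j) {suc j′} (s≤s lt) i = sol-suc M E {j = j} {j′} (i ↑ˡ q) i
            (M-elim (λ i s → ⟦ s ⟧ k (env (sol M k σ j) σ) ⊴[ b ] ⟦ lookup E i ⟧ k′ (env (sol E k′ τ j′) τ))
              (⊴-≡ refl (⟦at⟧ eq refl) (con τ₀ c (⊴*-tabulate _ _ λ i →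
                ⊴-≡ (⟦ys⟧ i) (lookup-⟦⟧ ss i) (args← j lt i))))
              (λ i → ⊴-≡ (⟦old⟧ {p = suc p} {q} (lookup E i)) refl (⟦⟧-mono le (env-⊑ (env← j lt) e) (lookup E i))) i)

          args← : ∀ j {j′} → j ≤ j′ → ∀ i →
                  sol M k σ j (suc p ↑ʳ i) ⊴[ b ] ⟦ lookup ss i ⟧ k′ (env (sol E k′ τ j′) τ)
          args← zero    lt i = Ω⊴
          args← (suc j) lt i =
            ⊴-≡ (trans (lookup-⟦⟧ M (suc p ↑ʳ i)) (⟦at⟧ (Mʳ i) (⟦old⟧ {p = suc p} {q} (lookup ss i)))) refl
            (⟦⟧-mono le (env-⊑ (env← j (≤-trans (n≤1+n j) lt)) e) (lookup ss i))

    caseEnv-≲ : ∀ {b} → letrec {l = l} E t ≲[ b ] letrec {l = l′} M (rename (old {suc p} {q}) t)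
    caseEnv-≲ = below (_* 2) (λ k → m≤m*n k 2) λ {k} lt e →
      let le = ≤-trans (m≤m*n k 2) lt in
      ⊴-≡ refl (⟦old⟧ {p = suc p} {q} t) (⟦⟧-mono le (env-⊑ (env→ le e k lt) e) t)

    caseEnv-≳ : ∀ {b} → letrec {l = l′} M (rename (old {suc p} {q}) t) ≲[ b ] letrec {l = l} E t
    caseEnv-≳ =
      below id (λ _ → ≤-refl) λ {k} le e → ⊴-≡ (⟦old⟧ {p = suc p} {q} t) refl (⟦⟧-mono le (env-⊑ (env← le e k le) e) t)

  bind-⊴ : ∀ {b n m k k′ q} {σ τ : Fin n → Exp Λ m} → k ≤ k′ → σ ⊑[ b ] τ →
           (ss : Vec (LExp n) q) (t : LExp (q + n)) →
           ⟦ bind ss t ⟧ k σ ⊴[ b ] ⟦ t ⟧ k′ (env (lookup (⟦ ss ⟧* k′ τ)) τ)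
  bind-⊴ le e [] t = ⟦⟧-mono le e t
  bind-⊴ {b} {k = k} {k′} {suc q} {σ} {τ} le e ss@(_ ∷ _) t = ⟦⟧-mono le (env-⊑ (args k) e) t
    where
    args : ∀ j → sol (weaken* (suc q) ss) k σ j ⊑[ b ] lookup (⟦ ss ⟧* k′ τ)
    args zero    i = Ω⊴
    args (suc j) i = ⊴-≡ (trans (lookup-⟦⟧ (weaken* (suc q) ss) i)
        (⟦at⟧ (lookup-rename* _ ss i) (⟦⟧-rename (env-↑ʳ (suc q) (sol (weaken* (suc q) ss) k σ j) σ) (lookup ss i))))
      (lookup-⟦⟧ ss i) (⟦⟧-mono le e (lookup ss i))

  -- At index 0 even a non-recursive letrec gives Ω for its variables. The strict inequality
  -- guarantees one iteration, after which they stand for the arguments.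
  bind-⊵ : ∀ {b n m k k′ q} {σ τ : Fin n → Exp Λ m} → suc k ≤ k′ → σ ⊑[ b ] τ →
           (ss : Vec (LExp n) q) (t : LExp (q + n)) →
           ⟦ t ⟧ k (env (lookup (⟦ ss ⟧* k σ)) σ) ⊴[ b ] ⟦ bind ss t ⟧ k′ τ
  bind-⊵ lt e [] t = ⟦⟧-mono (≤-trans (n≤1+n _) lt) e t
  bind-⊵ {k = k} {suc k′} {suc q} {σ} {τ} (s≤s lt) e ss@(_ ∷ _) t = ⟦⟧-mono le (env-⊑ args e) t
    where
    le = ≤-trans lt (n≤1+n k′)
    args : lookup (⟦ ss ⟧* k σ) ⊑[ _ ] sol (weaken* (suc q) ss) (suc k′) τ (suc k′)
    args i = ⊴-≡ (lookup-⟦⟧ ss i) (trans (lookup-⟦⟧ (weaken* (suc q) ss) i)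
        (⟦at⟧ (lookup-rename* _ ss i) (⟦⟧-rename (env-↑ʳ (suc q) (sol (weaken* (suc q) ss) (suc k′) τ k′) τ) (lookup ss i))))
      (⟦⟧-mono le e (lookup ss i))

  lifts-[/x] : ∀ {n m q} (ss : Vec (Exp Λ m) q) (σ : Fin n → Exp Λ m) →
               subst (inst (lookup ss)) ∘ lifts q σ ≗ env (lookup ss) σ
  lifts-[/x] {q = q} ss σ = splitCases q
    (λ i → trans (cong (subst (inst (lookup ss))) (lifts-↑ˡ σ i)) (trans (inst-↑ˡ (lookup ss) i) (sym (env-↑ˡ (lookup ss) σ i))))
    (λ j → trans (cong (subst (inst (lookup ss))) (lifts-↑ʳ q σ j)) (trans (subst-weaken (lookup ss) (σ j)) (sym (env-↑ʳ q (lookup ss) σ j))))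

  ⟦beta⟧ : ∀ {g n m k} {σ : Fin n → Exp Λ m} (s : Exp g (suc n)) (t : Exp g n) →
           app (lam (⟦ s ⟧ k (lifts 1 σ))) (⟦ t ⟧ k σ) ↦ ⟦ s ⟧ k (env (lookup (⟦ t ∷ [] ⟧* k σ)) σ)
  ⟦beta⟧ {k = k} {σ = σ} s t =
    transport (app (lam (⟦ s ⟧ k (lifts 1 σ))) (⟦ t ⟧ k σ) ↦_) (subst-⟦⟧ (lifts-[/x] (⟦ t ∷ [] ⟧* k σ) σ) s) beta

  ⟦case⟧ : ∀ {g n m k} {σ : Fin n → Exp Λ m} τ c (ss : Vec (Exp g n) (ar τ c)) (rs : Alts g n (arities τ)) →
           case τ (con τ c (⟦ ss ⟧* k σ)) (⟦ rs ⟧ᵃ k σ) ↦ ⟦ alternative rs c ⟧ k (env (lookup (⟦ ss ⟧* k σ)) σ)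
  ⟦case⟧ {k = k} {σ = σ} τ c ss rs = transport (case τ (con τ c (⟦ ss ⟧* k σ)) (⟦ rs ⟧ᵃ k σ) ↦_)
    (trans (cong (subst (inst (lookup (⟦ ss ⟧* k σ)))) (alternative-⟦⟧ rs c))
           (subst-⟦⟧ (lifts-[/x] (⟦ ss ⟧* k σ) σ) (alternative rs c))) case

  value-⟦⟧ : ∀ {g n m k} {σ : Fin n → Exp Λ m} {v : Exp g n} → Value v → Value (⟦ v ⟧ k σ)
  value-⟦⟧ (lam s)      = lam _
  value-⟦⟧ (con τ c ss) = con τ c _

  -- Approximants, L_name and L_lcc

  ⊴-rights : ∀ {n a} {e r r′ : Exp Λ n} → r ↦⟨ a ⟩ r′ → e ⊴[ true ] r′ → e ⊴[ true ] r
  ⊴-rights []       d = d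
  ⊴-rights (q ∷ qs) d = right q (⊴-rights qs d)

  -- Unfolding N (letrec E t) is a sequence of reductions on the right side.
  mutual
    ⟦⟧-N : ∀ {n m k} {σ τ : Fin n → Exp Λ m} → σ ⊑[ true ] τ → (s : Exp 𝓛 n) →
           ⟦ s ⟧ k σ ⊴[ true ] subst τ (N s)
    ⟦⟧-N e (var x)       = e x
    ⟦⟧-N e (app s t)     = app (⟦⟧-N e s) (⟦⟧-N e t)
    ⟦⟧-N e (lam s)       = lam (⟦⟧-N (⊑-lifts 1 e) s)
    ⟦⟧-N {n} {m} {k} {σ} {τ} e (letrec {p = p} E t) = ⊴-rights (unfold t) (⟦⟧-N (close k) t)
      where
      τ′ : Fin (suc p + n) → Exp Λ m
      τ′ = subst τ ∘ inst (solution E)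
      unfold : ∀ s → subst τ (N (letrec E s)) ↦⟨ suc p + suc p ⟩ subst τ′ (N s)
      unfold s =
        transport (subst τ (N (letrec E s)) ↦⟨ suc p + suc p ⟩_) (subst-∘ (λ _ → refl) (N s)) (↦*-subst τ (N-unfold E s))
      close : ∀ j → env (sol E k σ j) σ ⊑[ true ] τ′
      entry : ∀ j → sol E k σ j ⊑[ true ] (λ i → subst τ (solution E i))
      close j = splitCases (suc p)
        (λ i → ⊴-≡ (env-↑ˡ (sol E k σ j) σ i) (cong (subst τ) (inst-↑ˡ (solution E) i)) (entry j i))
        (λ i → ⊴-≡ (env-↑ʳ (suc p) (sol E k σ j) σ i) (cong (subst τ) (inst-↑ʳ (suc p) (solution E) i)) (e i))
      entry zero    i = Ω⊴
      entry (suc j) i = ⊴-rights (unfold (lookup E i))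
        (⊴-≡ refl (sym (trans (lookup-subst* τ′ (N* E) i) (cong (subst τ′) (lookup-N* E i)))) (⊴-lookup (⟦⟧-N* (close j) E) i))
    ⟦⟧-N e (con τ c ss)  = con τ c (⟦⟧-N* e ss)
    ⟦⟧-N e (seq s t)     = seq (⟦⟧-N e s) (⟦⟧-N e t)
    ⟦⟧-N e (case τ s rs) = case τ (⟦⟧-N e s) (⟦⟧-Nᵃ e rs)

    ⟦⟧-N* : ∀ {n m k} {σ τ : Fin n → Exp Λ m} → σ ⊑[ true ] τ → ∀ {j} (ss : Vec (Exp 𝓛 n) j) →
            ⟦ ss ⟧* k σ ⊴*[ true ] subst* τ (N* ss)
    ⟦⟧-N* e []       = []
    ⟦⟧-N* e (s ∷ ss) = ⟦⟧-N e s ∷ ⟦⟧-N* e ss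

    ⟦⟧-Nᵃ : ∀ {n m k} {σ τ : Fin n → Exp Λ m} → σ ⊑[ true ] τ → ∀ {ks} (rs : Alts 𝓛 n ks) →
            ⟦ rs ⟧ᵃ k σ ⊴ᵃ[ true ] substᵃ τ (Nᵃ rs)
    ⟦⟧-Nᵃ e []       = []
    ⟦⟧-Nᵃ e (r ∷ rs) = ⟦⟧-N (⊑-lifts _ e) r ∷ ⟦⟧-Nᵃ e rs

  ↓⇒N⇓ : ∀ {n m} {s : Exp 𝓛 n} → s ↓[ m ] → ∃ λ m′ → N s ⇓[ m′ ]
  ↓⇒N⇓ {s = s} (k , d) with ⊴-⇓ (⟦⟧-N (λ x → var x) s) d
  ... | m′ , d′ , _ = m′ , transport (_⇓[ m′ ]) (subst-id (λ _ → refl) (N s)) d′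

  infix 4 _≾[_]_
  -- What remains of a law once it has been used in its context: convergence and its cost. In this
  -- form laws compose, without an appeal to transitivity of the simulation itself.
  record _≾[_]_ {g n} (s : Exp g n) (b : Bool) (t : Exp g n) : Set where
    constructor transfer
    field
      cost : ∀ {m} → s ↓[ m ] → ∃ λ m′ → t ↓[ m′ ] × (b ≡ false → m′ ≤ m)
  open _≾[_]_

  ≲⇒≾ : ∀ {g n b} {s t : Exp g n} → s ≲[ b ] t → s ≾[ b ] t
  ≲⇒≾ r = transfer (≲-↓ r)

  ≾-trans : ∀ {g n b} {s t u : Exp g n} → s ≾[ b ] t → t ≾[ b ] u → s ≾[ b ] u
  ≾-trans r r′ = transfer λ d →
    let m₁ , d₁ , z₁ = cost r d
        m₂ , d₂ , z₂ = cost r′ d₁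
    in m₂ , d₂ , λ b → ≤-trans (z₂ b) (z₁ b)

  ≲-≡ : ∀ {g n b} {s s′ t t′ : Exp g n} → s ≡ s′ → t ≡ t′ → s′ ≲[ b ] t′ → s ≲[ b ] t
  ≲-≡ refl refl r = r

  ctxS : ∀ {g k n} → Stack g n → Ctx g k n → Ctx g k n
  ctxS []                   C = C
  ctxS (app {l} t ∷ fs)     C = ctxS fs (appˡ {l = l} C t)
  ctxS (seq {l} t ∷ fs)     C = ctxS fs (seqˡ {l = l} C t)
  ctxS (case {l} τ rs ∷ fs) C = ctxS fs (caseˢ {l = l} τ C rs)

  plug-ctxS : ∀ {g k n} (fs : Stack g n) (C : Ctx g k n) u → plug (ctxS fs C) u ≡ plugS fs (plug C u)
  plug-ctxS []               C u = refl
  plug-ctxS (app t ∷ fs)     C u = plug-ctxS fs (appˡ C t) u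
  plug-ctxS (seq t ∷ fs)     C u = plug-ctxS fs (seqˡ C t) u
  plug-ctxS (case τ rs ∷ fs) C u = plug-ctxS fs (caseˢ τ C rs) u

  wk-ctxS : ∀ {g k n} (fs : Stack g n) (C : Ctx g k n) x → wk (ctxS fs C) x ≡ wk C x
  wk-ctxS []               C x = refl
  wk-ctxS (app t ∷ fs)     C x = wk-ctxS fs (appˡ C t) x
  wk-ctxS (seq t ∷ fs)     C x = wk-ctxS fs (seqˡ C t) x
  wk-ctxS (case τ rs ∷ fs) C x = wk-ctxS fs (caseˢ τ C rs) x

  ctxL : ∀ {j k n} → LCtx j n → Ctx 𝓛 k j → Ctx 𝓛 k n
  ctxL hole         C = C
  ctxL (letrec E L) C = letrecⁱ E (ctxL L C)

  plug-ctxL : ∀ {j k n} (L : LCtx j n) (C : Ctx 𝓛 k j) u → plug (ctxL L C) u ≡ plugL L (plug C u)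
  plug-ctxL hole         C u = refl
  plug-ctxL (letrec E L) C u = cong (letrec E) (plug-ctxL L C u)

  wk-ctxL : ∀ {j k n} (L : LCtx j n) (C : Ctx 𝓛 k j) x → wk (ctxL L C) x ≡ wk C (wkL L x)
  wk-ctxL hole                 C x = refl
  wk-ctxL (letrec {p = p} E L) C x = wk-ctxL L C (suc p ↑ʳ x)

  ⟦[/x]⟧ : ∀ {g n m k q} {σ : Fin n → Exp Λ m} (t : Exp g (q + n)) (ss : Vec (Exp g n) q) →
           ⟦ t [ ss /x] ⟧ k σ ≡ ⟦ t ⟧ k (env (lookup (⟦ ss ⟧* k σ)) σ)
  ⟦[/x]⟧ {k = k} {q} {σ} t ss = ⟦⟧-subst (splitCases q
    (λ i → trans (cong (λ s → ⟦ s ⟧ k σ) (inst-↑ˡ (lookup ss) i)) (trans (sym (lookup-⟦⟧ ss i)) (sym (env-↑ˡ (lookup (⟦ ss ⟧* k σ)) σ i))))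
    (λ j → trans (cong (λ s → ⟦ s ⟧ k σ) (inst-↑ʳ q (lookup ss) j)) (sym (env-↑ʳ q (lookup (⟦ ss ⟧* k σ)) σ j)))) t

  -- The contractum stands on the left because convergence is to be carried back along a step. The
  -- additional reduction then falls on the right side, which b = true permits.
  beta-≲ : ∀ {g n} {l l′ : Ann g} {s : Exp g (suc n)} {t} →
           s [ t ∷ [] /x] ≲[ true ] app {l = l} (lam {l = l′} s) t
  beta-≲ {s = s} {t} = below id (λ _ → ≤-refl) λ le e →
    right (⟦beta⟧ s t) (⊴-≡ (⟦[/x]⟧ s (t ∷ [])) refl (⟦⟧-mono le (env-⊑ (⊴-lookup (⟦⟧-mono* le e (t ∷ []))) e) s))

  case-≲ : ∀ {g n} {l l′ : Ann g} {τ c ss} {rs : Alts g n (arities τ)} →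
           alternative rs c [ ss /x] ≲[ true ] case {l = l} τ (con {l = l′} τ c ss) rs
  case-≲ {τ = τ} {c} {ss} {rs} = below id (λ _ → ≤-refl) λ le e →
    right (⟦case⟧ τ c ss rs) (⊴-≡ (⟦[/x]⟧ (alternative rs c) ss) refl
      (⟦⟧-mono le (env-⊑ (⊴-lookup (⟦⟧-mono* le e ss)) e) (alternative rs c)))

  seq-≲ : ∀ {g n} {l : Ann g} {v s : Exp g n} → Value v → s ≲[ true ] seq {l = l} v s
  seq-≲ {s = s} v = below id (λ _ → ≤-refl) λ le e → right (seq (value-⟦⟧ v)) (⟦⟧-mono le e s)

  bind-beta-≲ : ∀ {n} {l l′ : Maybe Label} {s : LExp (suc n)} {t} →
                bind (t ∷ []) s ≲[ true ] app {l = l} (lam {l = l′} s) t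
  bind-beta-≲ {s = s} {t} =
    below id (λ _ → ≤-refl) λ le e → right (⟦beta⟧ s t) (bind-⊴ le e (t ∷ []) s)

  bind-case-≲ : ∀ {n} {l l′ : Maybe Label} {τ c ss} {rs : Alts 𝓛ˡ n (arities τ)} →
                bind ss (alternative rs c) ≲[ true ] case {l = l} τ (con {l = l′} τ c ss) rs
  bind-case-≲ {τ = τ} {c} {ss} {rs} = below id (λ _ → ≤-refl) λ le e →
    right (⟦case⟧ τ c ss rs) (bind-⊴ le e ss (alternative rs c))

  plugF-mono : ∀ {b g n n′ m k k′} {σ : Fin n → Exp Λ m} {τ : Fin n′ → Exp Λ m} (F : Frame g n) {s : Exp g n} {s′ : Exp g n′} {ρ : Fin n → Fin n′} →
               k ≤ k′ → σ ⊑[ b ] τ ∘ ρ → ⟦ s ⟧ k σ ⊴[ b ] ⟦ s′ ⟧ k′ τ → ⟦ plugF F s ⟧ k σ ⊴[ b ] ⟦ plugF (renameF ρ F) s′ ⟧ k′ τ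
  plugF-mono (app t)     le e r = app r (⊴-≡ refl (⟦⟧-rename (λ _ → refl) t) (⟦⟧-mono le e t))
  plugF-mono (seq t)     le e r = seq r (⊴-≡ refl (⟦⟧-rename (λ _ → refl) t) (⟦⟧-mono le e t))
  plugF-mono {b} {k′ = k′} {σ} {τ} (case κ rs) le e r =
    case κ r (transport (λ v → ⟦ rs ⟧ᵃ _ σ ⊴ᵃ[ b ] v) (sym (⟦⟧-renameᵃ (λ _ → refl) rs)) (⟦⟧-monoᵃ le e rs))

  plugF-mono⁻¹ : ∀ {b g n n′ m k k′} {σ : Fin n → Exp Λ m} {τ : Fin n′ → Exp Λ m} (F : Frame g n) {s : Exp g n} {s′ : Exp g n′} {ρ : Fin n → Fin n′} →
                 k ≤ k′ → τ ∘ ρ ⊑[ b ] σ → ⟦ s′ ⟧ k τ ⊴[ b ] ⟦ s ⟧ k′ σ → ⟦ plugF (renameF ρ F) s′ ⟧ k τ ⊴[ b ] ⟦ plugF F s ⟧ k′ σ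
  plugF-mono⁻¹ (app t)     le e r = app r (⊴-≡ (⟦⟧-rename (λ _ → refl) t) refl (⟦⟧-mono le e t))
  plugF-mono⁻¹ (seq t)     le e r = seq r (⊴-≡ (⟦⟧-rename (λ _ → refl) t) refl (⟦⟧-mono le e t))
  plugF-mono⁻¹ {b} {k′ = k′} {σ} {τ} (case κ rs) le e r =
    case κ r (transport (λ v → v ⊴ᵃ[ b ] ⟦ rs ⟧ᵃ _ σ) (sym (⟦⟧-renameᵃ (λ _ → refl) rs)) (⟦⟧-monoᵃ le e rs))

  module _ {g n p} {h h′ : HasLetrec g} {l l′ : Ann g} (F : Frame g n) {E : Vec (Exp g (suc p + n)) (suc p)} {s : Exp g (suc p + n)} where
    lift-≲ : ∀ {b} →
             plugF F (letrec {h = h} {l = l} E s) ≲[ b ] letrec {h = h′} {l = l′} E (plugF (renameF (suc p ↑ʳ_) F) s)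
    lift-≲ {b} = below id (λ _ → ≤-refl) λ {k} {k′} le {_} {σ} {τ} e →
      plugF-mono F {s = letrec {h = h} {l = l} E s} {s′ = s} le
        (λ x → ⊴-≡ refl (env-↑ʳ (suc p) (sol E k′ τ k′) τ x) (e x)) (⟦⟧-mono le (env-⊑ (sol-mono E le e le) e) s)

    lift-≳ : ∀ {b} →
             letrec {h = h′} {l = l′} E (plugF (renameF (suc p ↑ʳ_) F) s) ≲[ b ] plugF F (letrec {h = h} {l = l} E s)
    lift-≳ {b} = below id (λ _ → ≤-refl) λ {k} {k′} le {_} {σ} {τ} e →
      plugF-mono⁻¹ F {s = letrec {h = h} {l = l} E s} {s′ = s} le
        (λ x → ⊴-≡ (env-↑ʳ (suc p) (sol E k σ k) σ x) refl (e x)) (⟦⟧-mono le (env-⊑ (sol-mono E le e le) e) s)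

  replaces-var : ∀ {g j n} {C : Ctx g j n} {l : Ann g} {x u w} →
                 (∀ {k m} (σ : Fin j → Exp Λ m) → ⟦ w ⟧ k σ ≡ ⟦ u ⟧ k (σ ∘ wk C)) →
                 Replaces C x u (var {l = l} (wk C x)) w
  replaces-var eq = record { replace = λ le e q → ⊴-≡ refl (eq _) q ; unreplace = λ le e q → ⊴-≡ (eq _) refl q }

  replaces-seq : ∀ {g j n} {C : Ctx g j n} {l : Ann g} {x u w w′ s} → Replaces C x u w w′ →
                 Replaces C x u (seq {l = l} w s) (seq {l = l} w′ s)
  replaces-seq {s = s} R = record { replace   = λ le e q → seq (replace R le e q) (⟦⟧-mono le e s)
                                  ; unreplace = λ le e q → seq (unreplace R le e q) (⟦⟧-mono le e s) }

  replaces-case : ∀ {g j n} {C : Ctx g j n} {l : Ann g} {x u w w′ τ rs} → Replaces C x u w w′ →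
                  Replaces C x u (case {l = l} τ w rs) (case {l = l} τ w′ rs)
  replaces-case {τ = τ} {rs} R = record { replace   = λ le e q → case τ (replace R le e q) (⟦⟧-monoᵃ le e rs)
                                        ; unreplace =
                                          λ le e q → case τ (unreplace R le e q) (⟦⟧-monoᵃ le e rs) }

  name-≾ : ∀ {n} {s s′ : Exp 𝓛 n} → s ⟶name s′ → s′ ≾[ true ] s
  name-≾ r = ≲⇒≾ (go r)
    where
    inR : ∀ {k n} (R : RCtx k n) {u u′} → u ≲[ true ] u′ → plugR R u ≲[ true ] plugR R u′
    inR (L , A) {u} {u′} r = ≲-≡ (eq u) (eq u′) (plug-≲ (ctxL L (ctxS (fromA A []) hole)) r)
      where
      eq : ∀ u → plugR (L , A) u ≡ plug (ctxL L (ctxS (fromA A []) hole)) u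
      eq u =
        sym (trans (plug-ctxL L _ u) (cong (plugL L) (trans (plug-ctxS (fromA A []) hole u) (plugS-fromA A [] u))))
    go : ∀ {n} {s s′ : Exp 𝓛 n} → s ⟶name s′ → s′ ≲[ true ] s
    go (beta R)  = inR R beta-≲
    -- gcp is the inverse copying law for an empty chain; the surrounding equations only translate
    -- between `RCtx` and `Ctx`.
    go (gcp {k} {j} L {E} {x} (L₂ , A)) = inR (L , hole) (≲-≡
        (cong (letrec E) (trans (sym (eq _)) (cong (plug C) (rename-cong (λ y → sym (wkC y)) (lookup E x)))))
        (cong (letrec E) (trans (sym (eq _)) (cong (λ y → plug C (var y)) (sym (wkC (x ↑ˡ j))))))
        (copy-in⁻¹ C [] (replaces-var {w = rename (wk C) (lookup E x)} (λ σ → ⟦⟧-rename (λ _ → refl) (lookup E x)))))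
      where
      C = ctxL L₂ (ctxS (fromA A []) hole)
      wkC : ∀ y → wk C y ≡ wkL L₂ y
      wkC y = trans (wk-ctxL L₂ _ y) (wk-ctxS (fromA A []) hole (wkL L₂ y))
      eq : ∀ u → plug C u ≡ plugR (L₂ , A) u
      eq u =
        trans (plug-ctxL L₂ _ u) (cong (plugL L₂) (trans (plug-ctxS (fromA A []) hole u) (plugS-fromA A [] u)))
    go (lapp R {t = t})    = inR R (lift-≳ (app t))
    go (lcase R {rs = rs}) = inR R (lift-≳ (case _ rs))
    go (lseq R {t = t})    = inR R (lift-≳ (seq t))
    go (seq R v) = inR R (seq-≲ v)
    go (case R)  = inR R case-≲

  value-↓ : ∀ {g n} {v : Exp g n} → Value v → v ↓[ 0 ]
  value-↓ v = 0 , done (value-⟦⟧ v)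

  ↓name⇒↓ : ∀ {n} {s : Exp 𝓛 n} → s ↓name → ∃ λ m → s ↓[ m ]
  ↓name⇒↓ (_ , ε , L[v] L v)  = 0 , 0 , done (answer L v)
    where
    answer : ∀ {k n m} (L : LCtx k n) {v} {σ : Fin n → Exp Λ m} → Value v → Value (⟦ plugL L v ⟧ 0 σ)
    answer hole         v = value-⟦⟧ v
    answer (letrec E L) v = answer L v
  ↓name⇒↓ (v , r ◅ rs , ans) with ↓name⇒↓ (v , rs , ans)
  ... | m , d with cost (name-≾ r) d
  ... | m′ , d′ , _ = m′ , d′

  -- A detour through L_name: it would be awkward to read off from an evaluation of N s how many
  -- unfoldings it uses. Instead s is evaluated in L_name, its answer converges at index 0, and each
  -- step back enlarges the index as its law demands.
  N⇓⇒↓ : ∀ {n m} {s : Exp 𝓛 n} → N s ⇓[ m ] → ∃ λ m′ → s ↓[ m′ ]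
  N⇓⇒↓ {m = m} {s} d = ↓name⇒↓ (N⇓⇒↓name (suc m) hole [] s d ≤-refl)

  -- Soundness of the reductions of L_LR

  mutual
    rename-plug : ∀ {g k n n′} (ρ : Fin n → Fin n′) (C : Ctx g k n) u →
                  rename ρ (plug C u) ≡ plug (renameᶜ ρ C) (rename (holeRenaming C ρ) u)
    rename-plug ρ hole                  u = refl
    rename-plug ρ (appˡ {l = l} C t)    u =
      cong (λ s → app {l = l} s (rename ρ t)) (rename-plug ρ C u)
    rename-plug ρ (appʳ {l = l} s C)    u = cong (app {l = l} (rename ρ s)) (rename-plug ρ C u)
    rename-plug ρ (lam {l = l} C)       u = cong (lam {l = l}) (rename-plug (lift 1 ρ) C u)
    rename-plug ρ (letrecᵉ {l = l} C t) u =
      cong (λ E → letrec {l = l} E (rename (lift _ ρ) t)) (rename-plug* (lift _ ρ) C u)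
    rename-plug ρ (letrecⁱ {l = l} E C) u =
      cong (letrec {l = l} (rename* (lift _ ρ) E)) (rename-plug (lift _ ρ) C u)
    rename-plug ρ (con {l = l} τ c C)   u = cong (con {l = l} τ c) (rename-plug* ρ C u)
    rename-plug ρ (seqˡ {l = l} C t)    u =
      cong (λ s → seq {l = l} s (rename ρ t)) (rename-plug ρ C u)
    rename-plug ρ (seqʳ {l = l} s C)    u = cong (seq {l = l} (rename ρ s)) (rename-plug ρ C u)
    rename-plug ρ (caseˢ {l = l} τ C rs) u =
      cong (λ s → case {l = l} τ s (renameᵃ ρ rs)) (rename-plug ρ C u)
    rename-plug ρ (caseᵃ {l = l} τ s C) u = cong (case {l = l} τ (rename ρ s)) (rename-plugᵃ ρ C u)

    rename-plug* : ∀ {g k n n′ j} (ρ : Fin n → Fin n′) (C : Ctxs g k n j) u →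
                   rename* ρ (plug* C u) ≡ plug* (renameᶜ* ρ C) (rename (holeRenaming* C ρ) u)
    rename-plug* ρ (here C ss) u = cong (_∷ rename* ρ ss) (rename-plug ρ C u)
    rename-plug* ρ (there s C) u = cong (rename ρ s ∷_) (rename-plug* ρ C u)

    rename-plugᵃ : ∀ {g k n n′ js} (ρ : Fin n → Fin n′) (C : AltsCtx g k n js) u →
                   renameᵃ ρ (plugᵃ C u) ≡ plugᵃ (renameᶜᵃ ρ C) (rename (holeRenamingᵃ C ρ) u)
    rename-plugᵃ ρ (here C rs) u = cong (_∷ renameᵃ ρ rs) (rename-plug (lift _ ρ) C u)
    rename-plugᵃ ρ (there r C) u = cong (rename (lift _ ρ) r ∷_) (rename-plugᵃ ρ C u)

  mutual
    holeRenaming-wk : ∀ {g k n n′} (C : Ctx g k n) (ρ : Fin n → Fin n′) x →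
                      holeRenaming C ρ (wk C x) ≡ wk (renameᶜ ρ C) (ρ x)
    holeRenaming-wk hole           ρ x = refl
    holeRenaming-wk (appˡ C t)     ρ x = holeRenaming-wk C ρ x
    holeRenaming-wk (appʳ s C)     ρ x = holeRenaming-wk C ρ x
    holeRenaming-wk (lam C)        ρ x = holeRenaming-wk C (lift 1 ρ) (suc x)
    holeRenaming-wk (letrecᵉ {p = p} C t) ρ x =
      trans (holeRenaming-wk* C (lift (suc p) ρ) (suc p ↑ʳ x)) (cong (wk* (renameᶜ* _ C)) (lift-↑ʳ (suc p) ρ x))
    holeRenaming-wk (letrecⁱ {p = p} E C) ρ x =
      trans (holeRenaming-wk C (lift (suc p) ρ) (suc p ↑ʳ x)) (cong (wk (renameᶜ _ C)) (lift-↑ʳ (suc p) ρ x))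
    holeRenaming-wk (con τ c C)    ρ x = holeRenaming-wk* C ρ x
    holeRenaming-wk (seqˡ C t)     ρ x = holeRenaming-wk C ρ x
    holeRenaming-wk (seqʳ s C)     ρ x = holeRenaming-wk C ρ x
    holeRenaming-wk (caseˢ τ C rs) ρ x = holeRenaming-wk C ρ x
    holeRenaming-wk (caseᵃ τ s C)  ρ x = holeRenaming-wkᵃ C ρ x

    holeRenaming-wk* : ∀ {g k n n′ j} (C : Ctxs g k n j) (ρ : Fin n → Fin n′) x →
                       holeRenaming* C ρ (wk* C x) ≡ wk* (renameᶜ* ρ C) (ρ x)
    holeRenaming-wk* (here C ss) ρ x = holeRenaming-wk C ρ x
    holeRenaming-wk* (there s C) ρ x = holeRenaming-wk* C ρ x

    holeRenaming-wkᵃ : ∀ {g k n n′ js} (C : AltsCtx g k n js) (ρ : Fin n → Fin n′) x →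
                       holeRenamingᵃ C ρ (wkᵃ C x) ≡ wkᵃ (renameᶜᵃ ρ C) (ρ x)
    holeRenaming-wkᵃ (here {j = j} C rs) ρ x =
      trans (holeRenaming-wk C (lift j ρ) (j ↑ʳ x)) (cong (wk (renameᶜ _ C)) (lift-↑ʳ j ρ x))
    holeRenaming-wkᵃ (there r C) ρ x = holeRenaming-wkᵃ C ρ x

  ctxAt : ∀ {g k n j} → Vec (Exp g n) j → Fin j → Ctx g k n → Ctxs g k n j
  ctxAt (s ∷ ss) zero    C = here C ss
  ctxAt (s ∷ ss) (suc y) C = there s (ctxAt ss y C)

  plug-ctxAt : ∀ {g k n j} (E : Vec (Exp g n) j) y (C : Ctx g k n) u →
               plug* (ctxAt E y C) u ≡ E [ y ]≔ plug C u
  plug-ctxAt (s ∷ ss) zero    C u = refl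
  plug-ctxAt (s ∷ ss) (suc y) C u = cong (s ∷_) (plug-ctxAt ss y C u)

  update-≲ : ∀ {g n k p b} {h : HasLetrec g} {l : Ann g} (E : Vec (Exp g (suc p + n)) (suc p)) y (C : Ctx g k (suc p + n)) {t u u′} →
             u ≲[ b ] u′ → letrec {h = h} {l = l} (E [ y ]≔ plug C u) t ≲[ b ] letrec {h = h} {l = l} (E [ y ]≔ plug C u′) t
  update-≲ {h = h} {l} E y C {t} {u} {u′} r = ≲-≡
    (cong (λ E → letrec {h = h} {l = l} E t) (sym (plug-ctxAt E y C u)))
    (cong (λ E → letrec {h = h} {l = l} E t) (sym (plug-ctxAt E y C u′))) (plug-≲ (letrecᵉ {h = h} {l = l} (ctxAt E y C) t) r)

  rename*-tabulate : ∀ {g m n k} (ρ : Fin m → Fin n) (f : Fin k → Exp g m) →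
                     rename* ρ (tabulate f) ≡ tabulate (rename ρ ∘ f)
  rename*-tabulate {k = zero}  ρ f = refl
  rename*-tabulate {k = suc k} ρ f = cong (rename ρ (f zero) ∷_) (rename*-tabulate ρ (f ∘ suc))

  old-↑ˡ : ∀ {p q n} (x : Fin p) → old {p} {q} {n} (x ↑ˡ n) ≡ (x ↑ˡ q) ↑ˡ n
  old-↑ˡ {p} {q} {n} x = cong [ _ , _ ]′ (splitAt-↑ˡ p x n)

  -- case-in and case-e are split into three laws: naming the arguments of the constructor by new
  -- bindings, copying `c y₁ … yₖ` from x₁ to the scrutinee, and a local case. Here the outer parts
  -- are related to each other: the chain survives in the extended group, and the renamed scrutinee
  -- is the occurrence that gets copied.
  module CaseEnv {n p} (E : Vec (LExp (suc p + n)) (suc p)) {x₁ τ₀ c} {ss : Vec (LExp (suc p + n)) (ar τ₀ c)}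
                 (eq : lookup E x₁ ≡ con {l = just S} τ₀ c ss) where
    q : ℕ
    q = ar τ₀ c

    ρ : Fin (suc p + n) → Fin ((suc p + q) + n)
    ρ = old {suc p} {q} {n}

    M : Vec (LExp ((suc p + q) + n)) (suc p + q)
    M = caseEnv {p} E x₁ τ₀ c ss

    ys : Vec (LExp ((suc p + q) + n)) q
    ys = tabulate λ i → var {l = nothing} ((suc p ↑ʳ i) ↑ˡ n)

    lookup-M : ∀ {y} → y ≢ x₁ → lookup M (y ↑ˡ q) ≡ rename ρ (lookup E y)
    lookup-M {y} y≢ = trans (lookup-++ˡ (rename* ρ E [ x₁ ]≔ con {l = nothing} τ₀ c ys) _ y)
      (trans (lookup∘update′ y≢ (rename* ρ E) _) (lookup-rename* ρ E y))

    lookup-M-x₁ : lookup M (x₁ ↑ˡ q) ≡ con {l = nothing} τ₀ c ys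
    lookup-M-x₁ =
      trans (lookup-++ˡ (rename* ρ E [ x₁ ]≔ con {l = nothing} τ₀ c ys) _ x₁) (lookup∘update x₁ (rename* ρ E) _)

    -- x₁ is bound to a constructor application, so overwriting its binding leaves the links of a
    -- chain alone.
    not-x₁ : ∀ {y l x} → lookup E y ≡ var {l = l} x → y ≢ x₁
    not-x₁ eq′ refl with trans (sym eq) eq′
    ... | ()

    chain-M : ∀ {x} → Chain E x₁ x → Chain M (x₁ ↑ˡ q) (x ↑ˡ q)
    chain-M []                 = []
    chain-M (_▸_ {x = x} ch e) =
      chain-M ch ▸ trans (lookup-M (not-x₁ e)) (trans (cong (rename ρ) e) (cong (λ x → var x) (old-↑ˡ x)))

    module Branch {j} (C : Ctx 𝓛ˡ j (suc p + n)) (rs : Alts 𝓛ˡ j (arities τ₀)) {l : Maybe Label} where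
      C′ : Ctx 𝓛ˡ (holeScope C ((suc p + q) + n)) ((suc p + q) + n)
      C′ = renameᶜ ρ C

      rs′ : Alts 𝓛ˡ (holeScope C ((suc p + q) + n)) (arities τ₀)
      rs′ = renameᵃ (holeRenaming C ρ) rs

      ys′ : Vec (LExp (holeScope C ((suc p + q) + n))) q
      ys′ = tabulate λ i → var {l = nothing} (wk C′ ((suc p ↑ʳ i) ↑ˡ n))

      scrutinee : Fin (suc p) → LExp (holeScope C ((suc p + q) + n))
      scrutinee x = case {l = l} τ₀ (var {l = just V} (wk C′ ((x ↑ˡ q) ↑ˡ n))) rs′

      forced branch : LExp (holeScope C ((suc p + q) + n))
      forced = case {l = l} τ₀ (con {l = nothing} τ₀ c ys′) rs′
      branch = bind ys′ (alternative rs′ c)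

      rename-scrutinee : ∀ x →
                         rename ρ (plug C (case {l = l} τ₀ (occ C x V) rs)) ≡ plug C′ (scrutinee x)
      rename-scrutinee x =
        trans (rename-plug ρ C _) (cong (λ y → plug C′ (case {l = l} τ₀ (var {l = just V} y) rs′))
        (trans (holeRenaming-wk C ρ (x ↑ˡ n)) (cong (wk C′) (old-↑ˡ x))))

      force : ∀ x → Replaces C′ ((x ↑ˡ q) ↑ˡ n) (lookup M (x₁ ↑ˡ q)) (scrutinee x) forced
      force x = replaces-case (replaces-var λ {k} σ → sym (⟦at⟧ {k = k} lookup-M-x₁ (cong (con τ₀ c)
        (trans (sym (⟦⟧-rename* (λ _ → refl) ys)) (cong (λ ss → ⟦ ss ⟧* k σ) (rename*-tabulate (wk C′) _))))))

      caseBody≡ : caseBody {p = p} {n = n} C (alternative rs c) ≡ plug C′ branch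
      caseBody≡ = cong (λ r → plug C′ (bind ys′ r)) (sym (alternative-rename (holeRenaming C ρ) rs c))

  -- Every rule is an instance or a composite of laws that hold in arbitrary contexts, so it does
  -- not matter whether the labels were placed correctly.
  ⇒-≾ : ∀ {n} {a b : LExp n} → a ⇒ b → b ≾[ true ] a
  ⇒-≾ (lbeta C) = ≲⇒≾ (plug-≲ C bind-beta-≲)
  ⇒-≾ (cp-in {s = s} C eq ch) =
    ≲⇒≾ (copy-in⁻¹ C ch (replaces-var λ {k} σ → trans (⟦⟧-rename (λ _ → refl) (lam {l = nothing} s)) (sym (⟦at⟧ {k = k} eq refl))))
  ⇒-≾ (cp-e {s = s} C eq ch _ ey) =
    ≲⇒≾ (copy-e⁻¹ C ch (replaces-var λ {k} σ → trans (⟦⟧-rename (λ _ → refl) (lam {l = nothing} s)) (sym (⟦at⟧ {k = k} eq refl))) ey)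
  ⇒-≾ (lapp C {t = t})    = ≲⇒≾ (plug-≲ C (lift-≳ (app t)))
  ⇒-≾ (lcase C {rs = rs}) = ≲⇒≾ (plug-≲ C (lift-≳ (case _ rs)))
  ⇒-≾ (lseq C {t = t})    = ≲⇒≾ (plug-≲ C (lift-≳ (seq t)))
  ⇒-≾ (llet-in {E₁ = E₁} {E₂} {s}) = ≲⇒≾ (llet-in-≳ E₁ E₂ s)
  ⇒-≾ (llet-e {t = t} {E₁ = E₁} eq) = ≲⇒≾ (llet-e-≳ E₁ eq t)
  ⇒-≾ (seq-c C v _)       = ≲⇒≾ (plug-≲ C (seq-≲ v))
  -- Backwards: the redex of a local seq is restored around a copy of the constructor application,
  -- and then the copy is replaced by the variable.
  ⇒-≾ (seq-in {E = E} {τ = τ} {c} {ss} C eq ch) = ≾-trans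
    (≲⇒≾ (plug-≲ (letrecⁱ E C) (seq-≲ (con {l = nothing} τ c (rename* (wk C) ss)))))
    (≲⇒≾ (copy-in⁻¹ C ch (replaces-seq (replaces-var λ {k} σ →
      trans (⟦⟧-rename (λ _ → refl) (con {l = nothing} τ c ss)) (sym (⟦at⟧ {k = k} eq refl))))))
  ⇒-≾ (seq-e {E = E} {y = y} {τ} {c} {ss} C eq ch _ ey) = ≾-trans
    (≲⇒≾ (update-≲ E y C (seq-≲ (con {l = nothing} τ c (rename* (wk C) ss)))))
    (≲⇒≾ (copy-e⁻¹ C ch (replaces-seq (replaces-var λ {k} σ →
      trans (⟦⟧-rename (λ _ → refl) (con {l = nothing} τ c ss)) (sym (⟦at⟧ {k = k} eq refl)))) ey))
  ⇒-≾ (case-c C) = ≲⇒≾ (plug-≲ C bind-case-≲)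
  ⇒-≾ (case-in {l} {l′} {E = E} {xₘ = xₘ} {rs = rs} C eq ch) = ≾-trans
    (≲⇒≾ (≲-≡ (cong (letrec {l = l} M) caseBody≡) refl (plug-≲ (letrecⁱ {l = l} M C′) bind-case-≲)))
    (≾-trans (≲⇒≾ (copy-in⁻¹ {l = l} {l} C′ (chain-M ch) (force xₘ)))
      (≲⇒≾ (≲-≡ (cong (letrec {l = l} M) (sym (rename-scrutinee xₘ))) refl (caseEnv-≳ E eq _))))
    where open CaseEnv E eq
          open Branch C rs {l′}
  ⇒-≾ (case-e {l} {l′} {r = r} {E = E} {xₘ = xₘ} {u = u} {rs = rs} C eq ch u≢ ey) = ≾-trans
    (≲⇒≾ (≲-≡ (cong (λ s → letrec {l = l} (M [ u ↑ˡ q ]≔ s) (rename ρ r)) caseBody≡) refl (update-≲ {l = l} M (u ↑ˡ q) C′ bind-case-≲)))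
    (≾-trans (≲⇒≾ (copy-e⁻¹ {l = l} {l} C′ (chain-M ch) (force xₘ)
        (trans (lookup-M (λ e → u≢ (sym e))) (trans (cong (rename ρ) ey) (rename-scrutinee xₘ)))))
      (≲⇒≾ (caseEnv-≳ E eq r)))
    where open CaseEnv E eq
          open Branch C rs {l′}

  mutual
    erase-plug : ∀ {k n} (C : Ctx 𝓛ˡ k n) {u u′} → erase u ≡ erase u′ →
                 erase (plug C u) ≡ erase (plug C u′)
    erase-plug hole           e = e
    erase-plug (appˡ C t)     e = cong (λ s → app s (erase t)) (erase-plug C e)
    erase-plug (appʳ s C)     e = cong (app (erase s)) (erase-plug C e)
    erase-plug (lam C)        e = cong lam (erase-plug C e)
    erase-plug (letrecᵉ C t)  e = cong (λ E → letrec E (erase t)) (erase-plug* C e)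
    erase-plug (letrecⁱ E C)  e = cong (letrec _) (erase-plug C e)
    erase-plug (con τ c C)    e = cong (con τ c) (erase-plug* C e)
    erase-plug (seqˡ C t)     e = cong (λ s → seq s (erase t)) (erase-plug C e)
    erase-plug (seqʳ s C)     e = cong (seq (erase s)) (erase-plug C e)
    erase-plug (caseˢ τ C rs) e = cong (λ s → case τ s _) (erase-plug C e)
    erase-plug (caseᵃ τ s C)  e = cong (case τ (erase s)) (erase-plugᵃ C e)

    erase-plug* : ∀ {k n j} (C : Ctxs 𝓛ˡ k n j) {u u′} → erase u ≡ erase u′ →
                  convert* {g′ = 𝓛} id (λ _ → tt) (plug* C u) ≡ convert* id (λ _ → tt) (plug* C u′)
    erase-plug* (here C ss) e = cong (_∷ _) (erase-plug C e)
    erase-plug* (there s C) e = cong (erase s ∷_) (erase-plug* C e)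

    erase-plugᵃ : ∀ {k n js} (C : AltsCtx 𝓛ˡ k n js) {u u′} → erase u ≡ erase u′ →
                  convertᵃ {g′ = 𝓛} id (λ _ → tt) (plugᵃ C u) ≡ convertᵃ id (λ _ → tt) (plugᵃ C u′)
    erase-plugᵃ (here C rs) e = cong (_∷ _) (erase-plug C e)
    erase-plugᵃ (there r C) e = cong (erase r ∷_) (erase-plugᵃ C e)

  erase-^ : ∀ {n} (s : LExp n) l → erase (s ^ l) ≡ erase s
  erase-^ (var x)       l = refl
  erase-^ (app s t)     l = refl
  erase-^ (lam s)       l = refl
  erase-^ (letrec E t)  l = refl
  erase-^ (con τ c ss)  l = refl
  erase-^ (seq s t)     l = refl
  erase-^ (case τ s rs) l = refl

  erase*-update : ∀ {n k} (E : Vec (LExp n) k) y f → erase (f (lookup E y)) ≡ erase (lookup E y) →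
                  convert* {g′ = 𝓛} id (λ _ → tt) (E [ y ]%= f) ≡ convert* id (λ _ → tt) E
  erase*-update (s ∷ ss) zero    f e = cong (_∷ _) e
  erase*-update (s ∷ ss) (suc y) f e = cong (erase s ∷_) (erase*-update ss y f e)

  ⇝₀-erase : ∀ {n} {a b : LExp n} → a ⇝₀ b → erase a ≡ erase b
  ⇝₀-erase (letrecᵀ {s = s})   = cong (letrec _) (sym (erase-^ s S))
  ⇝₀-erase (app {s = s} _)     = cong (λ s → app s _) (sym (erase-^ s S))
  ⇝₀-erase (seq {s = s} _)     = cong (λ s → seq s _) (sym (erase-^ s S))
  ⇝₀-erase (case {s = s} _)    = cong (λ s → case _ s _) (sym (erase-^ s S))
  ⇝₀-erase (var-in {E = E} {x} {C}) =
    cong₂ letrec (sym (erase*-update E x (_^ S) (erase-^ (lookup E x) S))) (erase-plug C refl)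
  ⇝₀-erase (var-e {E = E} {x} {y} {C} x≢y eq _) = cong (λ E → letrec E _) (sym (trans
    (erase*-update (E [ x ]%= (_^ S)) y _ (trans (erase-plug C refl)
      (cong erase (sym (trans (lookup∘updateAt′ y x (λ e → x≢y (sym e)) E) eq)))))
    (erase*-update E x (_^ S) (erase-^ (lookup E x) S))))
  ⇝₀-erase (var-var {E = E} {x} {y} x≢y eq) = cong (λ E → letrec E _) (sym (trans
    (erase*-update (E [ x ]%= (_^ S)) y _ (cong erase (sym (trans (lookup∘updateAt′ y x (λ e → x≢y (sym e)) E) eq))))
    (erase*-update E x (_^ S) (erase-^ (lookup E x) S))))

  ⇝-erase : ∀ {n} {a b : LExp n} → Star _⇝_ a b → erase a ≡ erase b
  ⇝-erase ε                = refl
  ⇝-erase (at C _ r ◅ rs) = trans (erase-plug C (⇝₀-erase r)) (⇝-erase rs)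

  mutual
    erase-withoutLabels : ∀ {n} (s : Exp 𝓛 n) → erase (withoutLabels s) ≡ s
    erase-withoutLabels (var x)       = refl
    erase-withoutLabels (app s t)     = cong₂ app (erase-withoutLabels s) (erase-withoutLabels t)
    erase-withoutLabels (lam s)       = cong lam (erase-withoutLabels s)
    erase-withoutLabels (letrec E t)  = cong₂ letrec (erase-withoutLabels* E) (erase-withoutLabels t)
    erase-withoutLabels (con τ c ss)  = cong (con τ c) (erase-withoutLabels* ss)
    erase-withoutLabels (seq s t)     = cong₂ seq (erase-withoutLabels s) (erase-withoutLabels t)
    erase-withoutLabels (case τ s rs) =
      cong₂ (case τ) (erase-withoutLabels s) (erase-withoutLabelsᵃ rs)

    erase-withoutLabels* : ∀ {n k} (ss : Vec (Exp 𝓛 n) k) →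
                           convert* {g = 𝓛ˡ} id (λ _ → tt) (convert* id (λ _ → nothing) ss) ≡ ss
    erase-withoutLabels* []       = refl
    erase-withoutLabels* (s ∷ ss) = cong₂ _∷_ (erase-withoutLabels s) (erase-withoutLabels* ss)

    erase-withoutLabelsᵃ : ∀ {n ks} (rs : Alts 𝓛 n ks) →
                           convertᵃ {g = 𝓛ˡ} id (λ _ → tt) (convertᵃ id (λ _ → nothing) rs) ≡ rs
    erase-withoutLabelsᵃ []       = refl
    erase-withoutLabelsᵃ (r ∷ rs) = cong₂ _∷_ (erase-withoutLabels r) (erase-withoutLabelsᵃ rs)

  labelling-erase : ∀ {n} {s : Exp 𝓛 n} {a} → Star _⇝_ (withoutLabels s ^ T) a → erase a ≡ s
  labelling-erase {s = s} rs =
    trans (sym (⇝-erase rs)) (trans (erase-^ (withoutLabels s) T) (erase-withoutLabels s))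

  erase-↓ : ∀ {n m} (a : LExp n) → erase a ↓[ m ] → a ↓[ m ]
  erase-↓ a (k , d) = k , transport (_⇓[ _ ]) (⟦⟧-convert (λ _ → refl) a) d

  erase-↓⁻¹ : ∀ {n m} (a : LExp n) → a ↓[ m ] → erase a ↓[ m ]
  erase-↓⁻¹ a (k , d) = k , transport (_⇓[ _ ]) (sym (⟦⟧-convert (λ _ → refl) a)) d

  AnswerLR⇒↓ : ∀ {n} {s : Exp 𝓛 n} → AnswerLR s → ∃ λ m → s ↓[ m ]
  AnswerLR⇒↓ (value v)        = 0 , value-↓ v
  AnswerLR⇒↓ (letrec-val v)   = 0 , 0 , done (value-⟦⟧ v)
  AnswerLR⇒↓ (letrec-con {p = p} {E} {x₁} {xₘ} {τ} {c} {ss} eq ch) =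
    let m , d , _ = cost unfolded (0 , done (con τ c _)) in m , d
    where
    -- An answer that ends in a variable converges only after its chain has been unfolded, so its
    -- index is supplied by `copy-in⁻¹`.
    unfolded : letrec E (con τ c ss) ≾[ true ] letrec E (var (xₘ ↑ˡ _))
    unfolded =
      ≲⇒≾ (copy-in⁻¹ hole ch (replaces-var {w = con τ c ss} λ {k} σ → sym (⟦at⟧ {k = k} eq refl)))

  ↓LR⇒↓ : ∀ {n} {s : Exp 𝓛 n} → s ↓LR → ∃ λ m → s ↓[ m ]
  ↓LR⇒↓ (_ , ε , ans) = AnswerLR⇒↓ ans
  ↓LR⇒↓ {s = s} (v , step {a} {b} rs _ _ r ◅ rs′ , ans) with ↓LR⇒↓ (v , rs′ , ans)
  ... | m , d with cost (⇒-≾ r) (erase-↓ b d)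
  ... | m′ , d′ , _ = m′ , transport (_↓[ m′ ]) (labelling-erase rs) (erase-↓⁻¹ a d′)

  -- Labelling

  Calm : Bool → Maybe Label → Set
  Calm quiet l = quiet ≡ true → ¬ S∨T l

  -- Clean false: no variable is labelled S, so that no fail rule applies.
  -- Clean true: moreover no labelling rule applies.
  mutual
    Clean : ∀ {n} → Bool → LExp n → Set
    Clean b (var {l} x)         = l ≢ just S
    Clean b (app {l} s t)       = Calm b l × Clean b s × Clean b t
    Clean b (lam s)             = Clean b s
    Clean b (letrec {l = l} E t) = (b ≡ true → l ≢ just T) × Clean* b E × Clean b t
    Clean b (con τ c ss)        = Clean* b ss
    Clean b (seq {l} s t)       = Calm b l × Clean b s × Clean b t
    Clean b (case {l} τ s rs)   = Calm b l × Clean b s × Cleanᵃ b rs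

    Clean* : ∀ {n k} → Bool → Vec (LExp n) k → Set
    Clean* b []       = ⊤
    Clean* b (s ∷ ss) = Clean b s × Clean* b ss

    Cleanᵃ : ∀ {n ks} → Bool → Alts 𝓛ˡ n ks → Set
    Cleanᵃ b []       = ⊤
    Cleanᵃ b (r ∷ rs) = Clean b r × Cleanᵃ b rs

  mutual
    clean-plug : ∀ {k n b} (C : Ctx 𝓛ˡ k n) {u} → Clean b (plug C u) → Clean b u
    clean-plug hole           c           = c
    clean-plug (appˡ C t)     (_ , c , _) = clean-plug C c
    clean-plug (appʳ s C)     (_ , _ , c) = clean-plug C c
    clean-plug (lam C)        c           = clean-plug C c
    clean-plug (letrecᵉ C t)  (_ , c , _) = clean-plug* C c
    clean-plug (letrecⁱ E C)  (_ , _ , c) = clean-plug C c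
    clean-plug (con τ c C)    c′          = clean-plug* C c′
    clean-plug (seqˡ C t)     (_ , c , _) = clean-plug C c
    clean-plug (seqʳ s C)     (_ , _ , c) = clean-plug C c
    clean-plug (caseˢ τ C rs) (_ , c , _) = clean-plug C c
    clean-plug (caseᵃ τ s C)  (_ , _ , c) = clean-plugᵃ C c

    clean-plug* : ∀ {k n j b} (C : Ctxs 𝓛ˡ k n j) {u} → Clean* b (plug* C u) → Clean b u
    clean-plug* (here C ss) (c , _) = clean-plug C c
    clean-plug* (there s C) (_ , c) = clean-plug* C c

    clean-plugᵃ : ∀ {k n js b} (C : AltsCtx 𝓛ˡ k n js) {u} → Cleanᵃ b (plugᵃ C u) → Clean b u
    clean-plugᵃ (here C rs) (c , _) = clean-plug C c
    clean-plugᵃ (there r C) (_ , c) = clean-plugᵃ C c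

  clean-lookup : ∀ {n k b} (E : Vec (LExp n) k) → Clean* b E → ∀ i → Clean b (lookup E i)
  clean-lookup (s ∷ ss) (c , cs) zero    = c
  clean-lookup (s ∷ ss) (c , cs) (suc i) = clean-lookup ss cs i

  clean-tabulate : ∀ {n k b} (E : Vec (LExp n) k) → (∀ i → Clean b (lookup E i)) → Clean* b E
  clean-tabulate []       h = tt
  clean-tabulate (s ∷ ss) h = h zero , clean-tabulate ss (h ∘ suc)

  mutual
    clean-withoutLabels : ∀ {n b} (s : Exp 𝓛 n) → Clean b (withoutLabels s)
    clean-withoutLabels (var x)       = λ ()
    clean-withoutLabels (app s t)     = (λ _ ()) , clean-withoutLabels s , clean-withoutLabels t
    clean-withoutLabels (lam s)       = clean-withoutLabels s
    clean-withoutLabels (letrec E t)  = (λ _ ()) , clean-withoutLabels* E , clean-withoutLabels t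
    clean-withoutLabels (con τ c ss)  = clean-withoutLabels* ss
    clean-withoutLabels (seq s t)     = (λ _ ()) , clean-withoutLabels s , clean-withoutLabels t
    clean-withoutLabels (case τ s rs) = (λ _ ()) , clean-withoutLabels s , clean-withoutLabelsᵃ rs

    clean-withoutLabels* : ∀ {n k b} (ss : Vec (Exp 𝓛 n) k) →
        Clean* b (convert* id (λ _ → nothing) ss)
    clean-withoutLabels* []       = tt
    clean-withoutLabels* (s ∷ ss) = clean-withoutLabels s , clean-withoutLabels* ss

    clean-withoutLabelsᵃ : ∀ {n ks b} (rs : Alts 𝓛 n ks) → Cleanᵃ b (convertᵃ id (λ _ → nothing) rs)
    clean-withoutLabelsᵃ []       = tt
    clean-withoutLabelsᵃ (r ∷ rs) = clean-withoutLabels r , clean-withoutLabelsᵃ rs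

  mutual
    clean-weaken : ∀ {n} (s : LExp n) → Clean true s → Clean false s
    clean-weaken (var x)       c            = c
    clean-weaken (app s t)     (_ , c , c′) = (λ ()) , clean-weaken s c , clean-weaken t c′
    clean-weaken (lam s)       c            = clean-weaken s c
    clean-weaken (letrec E t)  (_ , c , c′) = (λ ()) , clean-weaken* E c , clean-weaken t c′
    clean-weaken (con τ c ss)  cs           = clean-weaken* ss cs
    clean-weaken (seq s t)     (_ , c , c′) = (λ ()) , clean-weaken s c , clean-weaken t c′
    clean-weaken (case τ s rs) (_ , c , c′) = (λ ()) , clean-weaken s c , clean-weakenᵃ rs c′

    clean-weaken* : ∀ {n k} (ss : Vec (LExp n) k) → Clean* true ss → Clean* false ss
    clean-weaken* []       c        = tt
    clean-weaken* (s ∷ ss) (c , cs) = clean-weaken s c , clean-weaken* ss cs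

    clean-weakenᵃ : ∀ {n ks} (rs : Alts 𝓛ˡ n ks) → Cleanᵃ true rs → Cleanᵃ false rs
    clean-weakenᵃ []       c        = tt
    clean-weakenᵃ (r ∷ rs) (c , cs) = clean-weaken r c , clean-weakenᵃ rs cs

  clean-binding : ∀ {k n p b} (E : Vec (LExp (p + n)) p) → Clean* b E →
                  ∀ y (C : Ctx 𝓛ˡ k (p + n)) {x} →
                  lookup E y ≢ plug C (var {l = just S} x)
  clean-binding {b = b} E c y C eq = clean-plug C (transport (Clean b) eq (clean-lookup E c y)) refl

  clean-FailsAt : ∀ {n b} {a : LExp n} → Clean b a → ¬ FailsAt a
  clean-FailsAt (_ , c , _) (visited {E = E} {y = y} {C} _ _ eq) = clean-binding E c y C eq
  clean-FailsAt (_ , c , _) (self {E = E} {x} {C} eq)            = clean-binding E c x C eq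

  clean-Fails : ∀ {n b} {a : LExp n} → Clean b a → ¬ Fails a
  clean-Fails c (at C f) = clean-FailsAt (clean-plug C c) f

  quiet-⇝₀ : ∀ {n} {a b : LExp n} → Clean true a → ¬ (a ⇝₀ b)
  quiet-⇝₀ (c , _)     letrecᵀ  = c refl refl
  quiet-⇝₀ (c , _)     (app l)  = c refl l
  quiet-⇝₀ (c , _)     (seq l)  = c refl l
  quiet-⇝₀ (c , _)     (case l) = c refl l
  quiet-⇝₀ (_ , _ , c) (var-in {C = C}) = clean-plug C c refl
  quiet-⇝₀ (_ , c , _) (var-e {E = E} {y = y} {C} _ eq _) = clean-binding E c y C eq
  quiet-⇝₀ (_ , c , _) (var-var {E = E} {y = y} _ eq)     = clean-binding E c y hole eq

  quiet-normal : ∀ {n} {a : LExp n} → Clean true a → ∀ {a′} → ¬ (a ⇝ a′)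
  quiet-normal c (at C _ r) = quiet-⇝₀ (clean-plug C c) r

  -- The only variable labelled S is x, at the head of the spine. By `spine-var`, any occurrence of
  -- an S-labelled variable found by a rule is this one.
  data Spine {n} (x : Fin n) : LExp n → Set where
    here : Spine x (var {l = just S} x)
    app  : ∀ {l s t} → Spine x s → Clean false t → Spine x (app {l = l} s t)
    seq  : ∀ {l s t} → Spine x s → Clean false t → Spine x (seq {l = l} s t)
    case : ∀ {l τ s rs} → Spine x s → Cleanᵃ false rs → Spine x (case {l = l} τ s rs)

  spine-letrec : ∀ {k n p} {x : Fin n} (C : Ctx 𝓛ˡ k n) {l} {E : Vec (LExp (suc p + k)) (suc p)} {t} →
                 Spine x (plug C (letrec {l = l} E t)) → Clean false (letrec {l = l} E t)
  spine-letrec (appˡ C t)     (app sp _)  = spine-letrec C sp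
  spine-letrec (appʳ s C)     (app _ c)   = clean-plug C c
  spine-letrec (seqˡ C t)     (seq sp _)  = spine-letrec C sp
  spine-letrec (seqʳ s C)     (seq _ c)   = clean-plug C c
  spine-letrec (caseˢ τ C rs) (case sp _) = spine-letrec C sp
  spine-letrec (caseᵃ τ s C)  (case _ c)  = clean-plugᵃ C c

  spine-var : ∀ {k n} {x : Fin n} (C : Ctx 𝓛ˡ k n) {y} → Spine x (plug C (var {l = just S} y)) →
              y ≡ wk C x
  spine-var hole           here        = refl
  spine-var (appˡ C t)     (app sp _)  = spine-var C sp
  spine-var (appʳ s C)     (app _ c)   = ⊥-elim (clean-plug C c refl)
  spine-var (seqˡ C t)     (seq sp _)  = spine-var C sp
  spine-var (seqʳ s C)     (seq _ c)   = ⊥-elim (clean-plug C c refl)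
  spine-var (caseˢ τ C rs) (case sp _) = spine-var C sp
  spine-var (caseᵃ τ s C)  (case _ c)  = ⊥-elim (clean-plugᵃ C c refl)

  mutual
    wk-injective : ∀ {g k n} (C : Ctx g k n) {x y} → wk C x ≡ wk C y → x ≡ y
    wk-injective hole           e = e
    wk-injective (appˡ C t)     e = wk-injective C e
    wk-injective (appʳ s C)     e = wk-injective C e
    wk-injective (lam C)        e = suc-injective (wk-injective C e)
    wk-injective (letrecᵉ {p = p} C t) e = ↑ʳ-injective (suc p) _ _ (wk-injective* C e)
    wk-injective (letrecⁱ {p = p} E C) e = ↑ʳ-injective (suc p) _ _ (wk-injective C e)
    wk-injective (con τ c C)    e = wk-injective* C e
    wk-injective (seqˡ C t)     e = wk-injective C e
    wk-injective (seqʳ s C)     e = wk-injective C e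
    wk-injective (caseˢ τ C rs) e = wk-injective C e
    wk-injective (caseᵃ τ s C)  e = wk-injectiveᵃ C e

    wk-injective* : ∀ {g k n j} (C : Ctxs g k n j) {x y} → wk* C x ≡ wk* C y → x ≡ y
    wk-injective* (here C ss) e = wk-injective C e
    wk-injective* (there s C) e = wk-injective* C e

    wk-injectiveᵃ : ∀ {g k n js} (C : AltsCtx g k n js) {x y} → wkᵃ C x ≡ wkᵃ C y → x ≡ y
    wk-injectiveᵃ (here {j = j} C rs) e = ↑ʳ-injective j _ _ (wk-injective C e)
    wk-injectiveᵃ (there r C) e = wk-injectiveᵃ C e

  -- The variable labelled S refers to the binding z, which has not been visited.
  module Unvisited {n p} {E : Vec (LExp (suc p + n)) (suc p)} {t : LExp (suc p + n)} (z : Fin (suc p))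
                   (spineᴱ : ∀ i → Spine (z ↑ˡ n) (lookup E i) ⊎ Clean false (lookup E i))
                   (spineᵗ : Spine (z ↑ˡ n) t ⊎ Clean false t)
                   (unlab : labelOf (lookup E z) ≡ nothing) (clean-z : Clean false (lookup E z)) where
    inner : ∀ {k m} {x : Fin m} {s} (C : Ctx 𝓛ˡ k m) {a} → Spine x s ⊎ Clean false s → s ≡ plug C a →
            ¬ FailsAt a
    inner C (inj₁ sp) refl f@(visited _ _ _) = clean-FailsAt (spine-letrec C sp) f
    inner C (inj₁ sp) refl f@(self _)        = clean-FailsAt (spine-letrec C sp) f
    inner C (inj₂ c)  refl f                 = clean-FailsAt (clean-plug C c) f

    inner* : ∀ {k m j} {x : Fin m} (C : Ctxs 𝓛ˡ k m j) {a} →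
             (∀ i → Spine x (lookup (plug* C a) i) ⊎ Clean false (lookup (plug* C a) i)) → ¬ FailsAt a
    inner* (here C ss) h = inner C (h zero) refl
    inner* (there s C) h = inner* C (h ∘ suc)

    occurrence : ∀ {k y x} {C : Ctx 𝓛ˡ k (suc p + n)} → lookup E y ≡ plug C (occ C x S) → x ≡ z
    occurrence {y = y} {x} {C} eq with spineᴱ y
    ... | inj₁ sp =
      ↑ˡ-injective n x z (wk-injective C (spine-var C (transport (Spine (z ↑ˡ n)) eq sp)))
    ... | inj₂ c  = ⊥-elim (clean-plug C (transport (Clean false) eq c) refl)

    no-V∨W : ¬ V∨W nothing
    no-V∨W ()

    -- The visited rule would need V or W on the binding z, which is unlabelled, and the self rule
    -- an S-labelled variable inside it, which is clean. Below the top no letrec can fail, since the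
    -- S-labelled variable lies on a spine outside all inner letrecs.
    no-fail : ∀ {l a} → Fails a → a ≢ letrec {l = l} E t
    no-fail (at hole (visited {C = C} _ v eq)) refl with refl ← occurrence {C = C} eq =
      no-V∨W (transport V∨W unlab v)
    no-fail (at hole (self {C = C} eq))        refl with refl ← occurrence {C = C} eq =
      clean-plug C (transport (Clean false) eq clean-z) refl
    no-fail (at (letrecᵉ C t) f) refl = inner* C spineᴱ f
    no-fail (at (letrecⁱ E C) f) refl = inner C spineᵗ refl f

  labF : ∀ {n} → Frame 𝓛 n → Frame 𝓛ˡ n
  labF (app t)     = app {l = just V} (withoutLabels t)
  labF (seq t)     = seq {l = just V} (withoutLabels t)
  labF (case τ rs) = case {l = just V} τ (convertᵃ id (λ _ → nothing) rs)

  labS : ∀ {n} → Stack 𝓛 n → Stack 𝓛ˡ n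
  labS = List.map labF

  -- The head of plugS fs r is labelled S after the first step of the descent
  -- into the spine; a descent of length 0 keeps the initial label.
  headLabel : ∀ {n} → Stack 𝓛 n → Label → Label
  headLabel []       l = l
  headLabel (f ∷ fs) l = S

  clean-plugF : ∀ {n b} (f : Frame 𝓛 n) {u} → Clean b u → Clean b (plugF (labF f) u)
  clean-plugF (app t)     c = (λ _ ()) , c , clean-withoutLabels t
  clean-plugF (seq t)     c = (λ _ ()) , c , clean-withoutLabels t
  clean-plugF (case τ rs) c = (λ _ ()) , c , clean-withoutLabelsᵃ rs

  clean-plugS : ∀ {n b} (fs : Stack 𝓛 n) {u} → Clean b u → Clean b (plugS (labS fs) u)
  clean-plugS []       c = c
  clean-plugS (f ∷ fs) c = clean-plugS fs (clean-plugF f c)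

  spine-plugF : ∀ {n} {x : Fin n} (f : Frame 𝓛 n) {u} → Spine x u → Spine x (plugF (labF f) u)
  spine-plugF (app t)     sp = app sp (clean-withoutLabels t)
  spine-plugF (seq t)     sp = seq sp (clean-withoutLabels t)
  spine-plugF (case τ rs) sp = case sp (clean-withoutLabelsᵃ rs)

  spine-plugS : ∀ {n} {x : Fin n} (fs : Stack 𝓛 n) {u} → Spine x u → Spine x (plugS (labS fs) u)
  spine-plugS []       sp = sp
  spine-plugS (f ∷ fs) sp = spine-plugS fs (spine-plugF f sp)

  -- A place where the labelling descends into a spine: the whole expression, the body of its
  -- letrec, or one binding. The field `context` supplies the context that a labelling step demands,
  -- and `clean` shows that no fail rule interferes from elsewhere.
  record Position {k n} (K : LExp k → LExp n) : Set where
    field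
      context      : Ctx 𝓛ˡ k k → Ctx 𝓛ˡ k n
      plug-context : ∀ C u → plug (context C) u ≡ K (plug C u)
      clean        : ∀ {u} → Clean false u → Clean false (K u)
  open Position

  ⇝-at : ∀ {k n} {K : LExp k → LExp n} → Position K → (fs : Stack 𝓛ˡ k) → ∀ {a b} →
         Clean false (plugS fs a) → a ⇝₀ b → K (plugS fs a) ⇝ K (plugS fs b)
  ⇝-at {K = K} P fs {a} {b} c r = transport₂ _⇝_ (eq a) (eq b)
    (at C (clean-Fails (transport (Clean false) (sym (eq a)) (clean P c))) r)
    where
    C = context P (ctxS fs hole)
    eq : ∀ u → plug C u ≡ K (plugS fs u)
    eq u = trans (plug-context P _ u) (cong K (plug-ctxS fs hole u))

  frame-⇝₀ : ∀ {n} (f : Frame 𝓛 n) r {l} → S∨T (just l) →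
             withoutLabels (plugF f r) ^ l ⇝₀ plugF (labF f) (withoutLabels r ^ S)
  frame-⇝₀ (app t)     r st = app st
  frame-⇝₀ (seq t)     r st = seq st
  frame-⇝₀ (case τ rs) r st = case st

  clean-frame : ∀ {n} (f : Frame 𝓛 n) r l → Clean false (withoutLabels (plugF f r) ^ l)
  clean-frame (app t)     r l = (λ ()) , clean-withoutLabels r , clean-withoutLabels t
  clean-frame (seq t)     r l = (λ ()) , clean-withoutLabels r , clean-withoutLabels t
  clean-frame (case τ rs) r l = (λ ()) , clean-withoutLabels r , clean-withoutLabelsᵃ rs

  headLabel-S∨T : ∀ {n} (fs : Stack 𝓛 n) {l} → S∨T (just l) → S∨T (just (headLabel fs l))
  headLabel-S∨T []       st = st
  headLabel-S∨T (f ∷ fs) st = S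

  -- The stack lists the innermost frame first, so the recursive call labels all outer frames and
  -- the last step enters f.
  descend : ∀ {k n} {K : LExp k → LExp n} → Position K → ∀ fs r l → S∨T (just l) →
            Star _⇝_ (K (withoutLabels (plugS fs r) ^ l)) (K (plugS (labS fs) (withoutLabels r ^ headLabel fs l)))
  descend P []       r l st = ε
  descend P (f ∷ fs) r l st = descend P fs (plugF f r) l st ◅◅
    (⇝-at P (labS fs) (clean-plugS fs (clean-frame f r (headLabel fs l))) (frame-⇝₀ f r (headLabel-S∨T fs st)) ◅ ε)

  headLabel-S : ∀ {n} (fs : Stack 𝓛 n) → headLabel fs S ≡ S
  headLabel-S []       = refl
  headLabel-S (f ∷ fs) = refl

  descendˢ : ∀ {k n} {K : LExp k → LExp n} → Position K → ∀ fs r →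
             Star _⇝_ (K (withoutLabels (plugS fs r) ^ S)) (K (plugS (labS fs) (withoutLabels r ^ S)))
  descendˢ {K = K} P fs r =
    transport (λ l → Star _⇝_ (K (withoutLabels (plugS fs r) ^ S)) (K (plugS (labS fs) (withoutLabels r ^ l))))
    (headLabel-S fs) (descend P fs r S S)

  -- Paths of demanded bindings

  data Head {g n} : Exp g n → Set where
    lam    : ∀ {l s} → Head (lam {l = l} s)
    con    : ∀ {l τ c ss} → Head (con {l = l} τ c ss)
    letrec : ∀ {h l p} {E : Vec (Exp g (suc p + n)) (suc p)} {t} → Head (letrec {h = h} {l = l} E t)

  head-label : ∀ {n} {r : Exp 𝓛 n} → Head r →
               Clean true (withoutLabels r ^ S) × Head (withoutLabels r ^ S) × labelOf (withoutLabels r ^ S) ≡ just S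
  head-label {r = lam s}      lam    = clean-withoutLabels s , lam , refl
  head-label {r = con τ c ss} con    = clean-withoutLabels* ss , con , refl
  head-label {r = letrec E t} letrec =
    ((λ _ ()) , clean-withoutLabels* E , clean-withoutLabels t) , letrec , refl

  data Path {n p} (E : Vec (Exp 𝓛 (suc p + n)) (suc p)) : Fin (suc p) → Set where
    end  : ∀ {x} fs r → Head r → lookup E x ≡ plugS fs r → Path E x
    step : ∀ {x} fs z → lookup E x ≡ plugS fs (var (z ↑ˡ n)) → Path E z → Path E x

  module _ {n p} {E : Vec (Exp 𝓛 (suc p + n)) (suc p)} where
    On : ∀ {x} → Fin (suc p) → Path E x → Set
    On {x} y (end _ _ _ _)    = y ≡ x
    On {x} y (step _ _ _ π)   = y ≡ x ⊎ On y π

    Simple : ∀ {x} → Path E x → Set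
    Simple (end _ _ _ _)      = ⊤
    Simple {x} (step _ _ _ π) = ¬ On x π × Simple π

    on? : ∀ {x} y (π : Path E x) → Dec (On y π)
    on? {x} y (end _ _ _ _) = y ≟ x
    on? {x} y (step _ _ _ π) with y ≟ x | on? y π
    ... | yes e | _      = yes (inj₁ e)
    ... | no _  | yes on = yes (inj₂ on)
    ... | no ¬e | no ¬on = no [ ¬e , ¬on ]′

    suffix : ∀ {x} y (π : Path E x) → Simple π → On y π → ∃ λ (π′ : Path E y) → Simple π′
    suffix y π@(end _ _ _ _)  s refl        = π , s
    suffix y π@(step _ _ _ _) s (inj₁ refl) = π , s
    suffix y (step _ _ _ π) (_ , s) (inj₂ on) = suffix y π s on

    -- Labelling fails as soon as it meets a binding for the second time, so `follow` needs a path
    -- without repetitions. Cutting out a loop is easier than showing that a terminating demand has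
    -- none.
    simplify : ∀ {x} → Path E x → ∃ λ (π : Path E x) → Simple π
    simplify π@(end _ _ _ _) = π , tt
    simplify {x} (step fs z eq π) with simplify π
    ... | π′ , s with on? x π′
    ...   | yes on = suffix x π′ s on
    ...   | no ¬on = step fs z eq π′ , ¬on , s

    on-start : ∀ {x} (π : Path E x) → On x π
    on-start (end _ _ _ _)  = refl
    on-start (step _ _ _ _) = inj₁ refl

  -- A path as the finished labelling leaves it. A `link` is a bare variable and belongs to a chain,
  -- while a `step` ends below a frame, whose V-labelled variable is where cp, seq or case may act.
  data LPath {n p} (E : Vec (LExp (suc p + n)) (suc p)) : Fin (suc p) → Set where
    end  : ∀ {x} fs r → Head r → labelOf r ≡ just S → lookup E x ≡ plugS fs r → LPath E x
    link : ∀ {x l} z → lookup E x ≡ var {l = l} (z ↑ˡ n) → LPath E z → LPath E x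
    step : ∀ {x} f fs z → lookup E x ≡ plugS (f ∷ fs) (var {l = just V} (z ↑ˡ n)) → LPath E z →
           LPath E x

  atBinding : ∀ {n p l} (E : Vec (LExp (suc p + n)) (suc p)) x t →
              (∀ i → i ≢ x → Clean false (lookup E i)) → Clean false t →
              Position (λ u → letrec {l = l} (E [ x ]≔ u) t)
  atBinding {l = l} E x t cE ct = record
    { context      = λ C → letrecᵉ {l = l} (ctxAt E x C) t
    ; plug-context = λ C u → cong (λ E → letrec {l = l} E t) (plug-ctxAt E x C u)
    ; clean        = λ {u} c → (λ ()) , clean-tabulate _ (others c) , ct }
    where
    others : ∀ {u} → Clean false u → ∀ i → Clean false (lookup (E [ x ]≔ u) i)
    others {u} c i with i ≟ x
    ... | yes refl = transport (Clean false) (sym (lookup∘update i E u)) c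
    ... | no i≢x   = transport (Clean false) (sym (lookup∘update′ i≢x E u)) (cE i i≢x)

  atBody : ∀ {n p l} (E : Vec (LExp (suc p + n)) (suc p)) → Clean* false E →
           Position (λ u → letrec {l = l} E u)
  atBody {l = l} E cE = record
    { context = letrecⁱ {l = l} E ; plug-context = λ C u → refl ; clean = λ c → (λ ()) , cE , c }

  atTop : ∀ {n} → Position {n} id
  atTop = record { context = id ; plug-context = λ C u → refl ; clean = id }

  occ-ctxS : ∀ {n p} (fs : Stack 𝓛ˡ (p + n)) (z : Fin p) l →
             plug (ctxS fs hole) (occ {n = n} (ctxS fs hole) z l) ≡ plugS fs (var {l = just l} (z ↑ˡ n))
  occ-ctxS {n} fs z l =
    trans (plug-ctxS fs hole _) (cong (λ y → plugS fs (var {l = just l} y)) (wk-ctxS fs hole (z ↑ˡ n)))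

  plugS-not-var : ∀ {g n} f (fs : Stack g n) {u l} {x : Fin n} → plugS (f ∷ fs) u ≢ var {l = l} x
  plugS-not-var (app t)     []       ()
  plugS-not-var (seq t)     []       ()
  plugS-not-var (case τ rs) []       ()
  plugS-not-var f           (f′ ∷ fs) = plugS-not-var f′ fs

  labelOf-withoutLabels : ∀ {n} (s : Exp 𝓛 n) → labelOf (withoutLabels s) ≡ nothing
  labelOf-withoutLabels (var x)       = refl
  labelOf-withoutLabels (app s t)     = refl
  labelOf-withoutLabels (lam s)       = refl
  labelOf-withoutLabels (letrec E t)  = refl
  labelOf-withoutLabels (con τ c ss)  = refl
  labelOf-withoutLabels (seq s t)     = refl
  labelOf-withoutLabels (case τ s rs) = refl

  data VarLabel : ∀ {n} → Stack 𝓛 n → Label → Set where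
    W : ∀ {n} → VarLabel {n} [] W
    V : ∀ {n f fs} → VarLabel {n} (f ∷ fs) V

  var-label : ∀ {n} (fs : Stack 𝓛 n) → ∃ (VarLabel fs)
  var-label []       = W , W
  var-label (f ∷ fs) = V , V

  varLabel≢S : ∀ {n} {fs : Stack 𝓛 n} {l} → VarLabel fs l → just l ≢ just S
  varLabel≢S W ()
  varLabel≢S V ()

  visit : ∀ {n p} {E : Vec (LExp (suc p + n)) (suc p)} {t x z} (fs : Stack 𝓛 (suc p + n)) {l} →
          VarLabel fs l → z ≢ x →
          lookup E x ≡ plugS (labS fs) (var {l = just S} (z ↑ˡ n)) →
          letrec {l = just V} E t ⇝₀ letrec {l = just V} (E [ z ]%= (_^ S) [ x ]≔ plugS (labS fs) (var {l = just l} (z ↑ˡ n))) t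
  visit []       W z≢x eq = var-var z≢x eq
  visit {E = E} {t} {x} {z} fs@(f ∷ fs′) V z≢x eq =
    transport (λ u → letrec {l = just V} E t ⇝₀ letrec {l = just V} (E [ z ]%= (_^ S) [ x ]≔ u) t) (occ-ctxS (labS fs) z V)
      (var-e {C = ctxS (labS fs) hole} z≢x (trans eq (sym (occ-ctxS (labS fs) z S)))
        (λ e → plugS-not-var (labF f) (labS fs′) (trans (sym (occ-ctxS (labS fs) z S)) e)))

  module _ {n p} {E : Vec (Exp 𝓛 (suc p + n)) (suc p)} {t : LExp (suc p + n)} (ct : Clean true t) where

    record Followed {x} (π : Path E x) (E₀ : Vec (LExp (suc p + n)) (suc p)) : Set where
      field
        E₁        : Vec (LExp (suc p + n)) (suc p)
        labelling : Star _⇝_ (letrec {l = just V} E₀ t) (letrec {l = just V} E₁ t)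
        quiet     : ∀ i → Clean true (lookup E₁ i)
        path      : LPath E₁ x
        unchanged : ∀ i → ¬ On i π → lookup E₁ i ≡ lookup E₀ i

    -- At each stage the current binding x carries S, the later bindings of the path are still
    -- unlabelled, and all bindings other than x are quiet. Simplicity keeps x out of the rest of
    -- the path, so its final labels are not disturbed; `unchanged` passes this information back.
    follow : ∀ {x} (π : Path E x) → Simple π → (E₀ : Vec (LExp (suc p + n)) (suc p)) →
             lookup E₀ x ≡ withoutLabels (lookup E x) ^ S →
             (∀ i → On i π → i ≢ x → lookup E₀ i ≡ withoutLabels (lookup E i)) →
             (∀ i → i ≢ x → Clean true (lookup E₀ i)) → Followed π E₀
    follow {x} (end fs r hd eq) _ E₀ eqˣ _ cE = record
      { E₁        = E₁
      ; labelling = transport (λ E′ → Star _⇝_ (letrec {l = just V} E′ t) (letrec {l = just V} E₁ t))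
          (trans (cong (E₀ [ x ]≔_) (sym (trans eqˣ (cong (λ s → withoutLabels s ^ S) eq)))) ([]≔-lookup E₀ x))
          (descendˢ (atBinding E₀ x t (λ i i≢x → clean-weaken (lookup E₀ i) (cE i i≢x)) (clean-weaken t ct)) fs r)
      ; quiet     = quiet
      ; path      =
        end (labS fs) (withoutLabels r ^ S) (proj₁ (proj₂ (head-label hd))) (proj₂ (proj₂ (head-label hd))) (lookup∘update x E₀ u)
      ; unchanged = λ i i≢x → lookup∘update′ i≢x E₀ u }
      where
      u  = plugS (labS fs) (withoutLabels r ^ S)
      E₁ = E₀ [ x ]≔ u
      quiet : ∀ i → Clean true (lookup E₁ i)
      quiet i with i ≟ x
      ... | yes refl =
        transport (Clean true) (sym (lookup∘update i E₀ u)) (clean-plugS fs (proj₁ (head-label hd)))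
      ... | no i≢x   = transport (Clean true) (sym (lookup∘update′ i≢x E₀ u)) (cE i i≢x)
    follow {x} (step fs z eq π) (x∉π , sπ) E₀ eqˣ eqᵖ cE = record
      { E₁        = F.E₁
      ; labelling = transport (λ E′ → Star _⇝_ (letrec {l = just V} E′ t) (letrec {l = just V} E₁ t))
          (trans (cong (E₀ [ x ]≔_) (sym (trans eqˣ (cong (λ s → withoutLabels s ^ S) eq)))) ([]≔-lookup E₀ x))
          (descendˢ (atBinding E₀ x t (λ i i≢x → clean-weaken (lookup E₀ i) (cE i i≢x)) (clean-weaken t ct)) fs (var (z ↑ˡ n)))
          -- The S-labelled variable at the end of the descent now hands its label over to z, which
          -- has not been visited because the path is simple.
          ◅◅ (at hole (λ f → U.no-fail f refl) (visit fs vl z≢x (lookup∘update x E₀ u)) ◅ F.labelling)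
      ; quiet     = F.quiet
      ; path      = extend fs vl (trans (F.unchanged x x∉π) (lookup∘update x E₁z v)) F.path
      ; unchanged =
        λ i i∉ → trans (F.unchanged i (i∉ ∘ inj₂)) (trans (lookup∘update′ (i∉ ∘ inj₁) E₁z v)
          (trans (lookup∘updateAt′ i z (λ { refl → i∉ (inj₂ (on-start π)) }) E₁) (lookup∘update′ (i∉ ∘ inj₁) E₀ u))) }
      where
      u  = plugS (labS fs) (var {l = just S} (z ↑ˡ n))
      E₁ = E₀ [ x ]≔ u
      vl = proj₂ (var-label fs)
      v  = plugS (labS fs) (var {l = just (proj₁ (var-label fs))} (z ↑ˡ n))
      E₁z = E₁ [ z ]%= (_^ S)
      E₂ = E₁z [ x ]≔ v
      z≢x : z ≢ x
      z≢x refl = x∉π (on-start π)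
      E₁-z : lookup E₁ z ≡ withoutLabels (lookup E z)
      E₁-z = trans (lookup∘update′ z≢x E₀ u) (eqᵖ z (inj₂ (on-start π)) z≢x)
      spines : ∀ i → Spine (z ↑ˡ n) (lookup E₁ i) ⊎ Clean false (lookup E₁ i)
      spines i with i ≟ x
      ... | yes refl =
        inj₁ (transport (Spine (z ↑ˡ n)) (sym (lookup∘update i E₀ u)) (spine-plugS fs here))
      ... | no i≢x   =
        inj₂ (transport (Clean false) (sym (lookup∘update′ i≢x E₀ u)) (clean-weaken (lookup E₀ i) (cE i i≢x)))
      module U = Unvisited {E = E₁} {t = t} z spines (inj₂ (clean-weaken t ct))
        (trans (cong labelOf E₁-z) (labelOf-withoutLabels (lookup E z)))
        (transport (Clean false) (sym E₁-z) (clean-withoutLabels (lookup E z)))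
      E₂-≢ : ∀ i → i ≢ x → i ≢ z → lookup E₂ i ≡ lookup E₀ i
      E₂-≢ i i≢x i≢z =
        trans (lookup∘update′ i≢x E₁z v) (trans (lookup∘updateAt′ i z i≢z E₁) (lookup∘update′ i≢x E₀ u))
      quiet₂ : ∀ i → i ≢ z → Clean true (lookup E₂ i)
      quiet₂ i i≢z with i ≟ x
      ... | yes refl =
        transport (Clean true) (sym (lookup∘update i E₁z v)) (clean-plugS fs (varLabel≢S vl))
      ... | no i≢x   = transport (Clean true) (sym (E₂-≢ i i≢x i≢z)) (cE i i≢x)
      rest : Followed π E₂
      rest = follow π sπ E₂
        (trans (lookup∘update′ z≢x E₁z v) (trans (lookup∘updateAt z E₁) (cong (_^ S) E₁-z)))
        (λ i on i≢z → let i≢x = λ { refl → x∉π on } in trans (E₂-≢ i i≢x i≢z) (eqᵖ i (inj₂ on) i≢x))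
        quiet₂
      module F = Followed rest
      extend : ∀ {E₃ : Vec (LExp (suc p + n)) (suc p)} (fs : Stack 𝓛 (suc p + n)) {l} →
               VarLabel fs l →
               lookup E₃ x ≡ plugS (labS fs) (var {l = just l} (z ↑ˡ n)) → LPath E₃ z → LPath E₃ x
      extend []       W eq π = link z eq π
      extend (f ∷ fs) V eq π = step (labF f) (labS fs) z eq π

  labelling-top : ∀ {n} (fs : Stack 𝓛 n) r →
                  Star _⇝_ (withoutLabels (plugS fs r) ^ T) (plugS (labS fs) (withoutLabels r ^ headLabel fs T))
  labelling-top fs r = descend atTop fs r T T

  module _ {n p} (E : Vec (Exp 𝓛 (suc p + n)) (suc p)) where
    private
      E₀ : Vec (LExp (suc p + n)) (suc p)
      E₀ = convert* id (λ _ → nothing) E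

      lookup-E₀ : ∀ {k} (E : Vec (Exp 𝓛 (suc p + n)) k) i →
                  lookup (convert* id (λ _ → nothing) E) i ≡ withoutLabels (lookup E i)
      lookup-E₀ (s ∷ ss) zero    = refl
      lookup-E₀ (s ∷ ss) (suc i) = lookup-E₀ ss i

    labelling-body : ∀ fs r → Star _⇝_ (withoutLabels (letrec E (plugS fs r)) ^ T)
                                       (letrec {l = just V} E₀ (plugS (labS fs) (withoutLabels r ^ S)))
    labelling-body fs r =
      at hole (clean-Fails {b = false} ((λ ()) , clean-withoutLabels* E , clean-withoutLabels (plugS fs r))) letrecᵀ ◅
      descendˢ (atBody E₀ (clean-withoutLabels* E)) fs r

    record Demanded (fs : Stack 𝓛 (suc p + n)) (x : Fin (suc p)) : Set where
      field
        E₁        : Vec (LExp (suc p + n)) (suc p)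
        labelling : Star _⇝_ (withoutLabels (letrec E (plugS fs (var (x ↑ˡ n)))) ^ T)
                             (letrec {l = just V} E₁ (plugS (labS fs) (var {l = just V} (x ↑ˡ n))))
        quiet     : Clean true (letrec {l = just V} E₁ (plugS (labS fs) (var {l = just V} (x ↑ˡ n))))
        path      : LPath E₁ x

    labelling-path : ∀ fs {x} → Path E x → Demanded fs x
    labelling-path fs {x} π₀ = record
      { E₁        = F.E₁
      ; labelling =
        labelling-body fs (var (x ↑ˡ n)) ◅◅ (at hole (λ f → U.no-fail f refl) enter ◅ F.labelling)
      ; quiet     = (λ _ ()) , clean-tabulate _ F.quiet , ct
      ; path      = F.path }
      where
      π = proj₁ (simplify π₀)
      C = ctxS (labS fs) hole
      t = plugS (labS fs) (var {l = just V} (x ↑ˡ n))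
      ct : Clean true t
      ct = clean-plugS fs (λ ())
      module U = Unvisited {E = E₀} {t = plugS (labS fs) (var {l = just S} (x ↑ˡ n))} x
        (λ i → inj₂ (transport (Clean false) (sym (lookup-E₀ E i)) (clean-withoutLabels (lookup E i))))
        (inj₁ (spine-plugS fs here))
        (trans (cong labelOf (lookup-E₀ E x)) (labelOf-withoutLabels (lookup E x)))
        (transport (Clean false) (sym (lookup-E₀ E x)) (clean-withoutLabels (lookup E x)))
      enter : letrec {l = just V} E₀ (plugS (labS fs) (var {l = just S} (x ↑ˡ n))) ⇝₀ letrec {l = just V} (E₀ [ x ]%= (_^ S)) t
      enter =
        transport₂ (λ a b → letrec {l = just V} E₀ a ⇝₀ letrec {l = just V} (E₀ [ x ]%= (_^ S)) b)
        (occ-ctxS (labS fs) x S) (occ-ctxS (labS fs) x V) (var-in {x = x} {C = C})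
      followed : Followed ct π (E₀ [ x ]%= (_^ S))
      followed = follow ct π (proj₂ (simplify π₀)) (E₀ [ x ]%= (_^ S))
        (trans (lookup∘updateAt x E₀) (cong (_^ S) (lookup-E₀ E x)))
        (λ i _ i≢x → trans (lookup∘updateAt′ i x i≢x E₀) (lookup-E₀ E i))
        (λ i i≢x → transport (Clean true) (sym (trans (lookup∘updateAt′ i x i≢x E₀) (lookup-E₀ E i))) (clean-withoutLabels (lookup E i)))
      module F = Followed followed

  -- Termination of the normal-order reduction

  -- Among the expressions of equal cost, μ bounds the number of lll- and
  -- cp-reductions: it counts the letrecs and the variables that can still be
  -- reached by the normal-order reduction, doubled in each reduction frame so
  -- that moving a letrec out of a frame decreases it.
  mutual
    μ : ∀ {g n} → Exp g n → ℕ
    μ (var x)       = 1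
    μ (app s t)     = μ s + μ s
    μ (lam s)       = 0
    μ (letrec E t)  = suc (μ* E + μ t)
    μ (con τ c ss)  = 0
    μ (seq s t)     = μ s + μ s
    μ (case τ s rs) = μ s + μ s

    μ* : ∀ {g n k} → Vec (Exp g n) k → ℕ
    μ* []       = 0
    μ* (s ∷ ss) = μ s + μ* ss

  mutual
    μ-rename : ∀ {g m n} (ρ : Fin m → Fin n) (s : Exp g m) → μ (rename ρ s) ≡ μ s
    μ-rename ρ (var x)       = refl
    μ-rename ρ (app s t)     = cong₂ _+_ (μ-rename ρ s) (μ-rename ρ s)
    μ-rename ρ (lam s)       = refl
    μ-rename ρ (letrec E t)  = cong suc (cong₂ _+_ (μ*-rename _ E) (μ-rename _ t))
    μ-rename ρ (con τ c ss)  = refl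
    μ-rename ρ (seq s t)     = cong₂ _+_ (μ-rename ρ s) (μ-rename ρ s)
    μ-rename ρ (case τ s rs) = cong₂ _+_ (μ-rename ρ s) (μ-rename ρ s)

    μ*-rename : ∀ {g m n k} (ρ : Fin m → Fin n) (ss : Vec (Exp g m) k) → μ* (rename* ρ ss) ≡ μ* ss
    μ*-rename ρ []       = refl
    μ*-rename ρ (s ∷ ss) = cong₂ _+_ (μ-rename ρ s) (μ*-rename ρ ss)

  mutual
    μ-erase : ∀ {n} (s : LExp n) → μ (erase s) ≡ μ s
    μ-erase (var x)       = refl
    μ-erase (app s t)     = cong₂ _+_ (μ-erase s) (μ-erase s)
    μ-erase (lam s)       = refl
    μ-erase (letrec E t)  = cong suc (cong₂ _+_ (μ*-erase E) (μ-erase t))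
    μ-erase (con τ c ss)  = refl
    μ-erase (seq s t)     = cong₂ _+_ (μ-erase s) (μ-erase s)
    μ-erase (case τ s rs) = cong₂ _+_ (μ-erase s) (μ-erase s)

    μ*-erase : ∀ {n k} (ss : Vec (LExp n) k) → μ* (convert* {g′ = 𝓛} id (λ _ → tt) ss) ≡ μ* ss
    μ*-erase []       = refl
    μ*-erase (s ∷ ss) = cong₂ _+_ (μ-erase s) (μ*-erase ss)

  μ-plugF : ∀ {g n} (f : Frame g n) u → μ (plugF f u) ≡ μ u + μ u
  μ-plugF (app t)     u = refl
  μ-plugF (seq t)     u = refl
  μ-plugF (case τ rs) u = refl

  μ-lift : ∀ {g n p} (f : Frame g n) (E : Vec (Exp g (suc p + n)) (suc p)) s →
           suc (μ* E + μ (plugF (renameF (suc p ↑ʳ_) f) s)) < suc (μ* E + μ s) + suc (μ* E + μ s)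
  μ-lift {p = p} f E s rewrite μ-plugF (renameF (suc p ↑ʳ_) f) s =
    s≤s (≤-trans (s≤s (≤-trans (≤-reflexive (sym (+-assoc (μ* E) (μ s) (μ s)))) (+-monoʳ-≤ (μ* E + μ s) (m≤n+m (μ s) (μ* E)))))
                 (≤-reflexive (sym (+-suc (μ* E + μ s) (μ* E + μ s)))))

  μ*-++ : ∀ {g n j k} (ss : Vec (Exp g n) j) (ts : Vec (Exp g n) k) → μ* (ss ++ ts) ≡ μ* ss + μ* ts
  μ*-++ []       ts = refl
  μ*-++ (s ∷ ss) ts = trans (cong (μ s +_) (μ*-++ ss ts)) (sym (+-assoc (μ s) (μ* ss) (μ* ts)))

  -- The removed binding is added on the left instead of being subtracted on the right; `μ-llet-e`
  -- cancels a common summand afterwards.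
  μ*-update : ∀ {g n k} (E : Vec (Exp g n) k) y v → μ* (E [ y ]≔ v) + μ (lookup E y) ≡ μ* E + μ v
  μ*-update (s ∷ ss) zero    v = trans (cong (_+ μ s) (+-comm (μ v) (μ* ss)))
    (trans (+-assoc (μ* ss) (μ v) (μ s)) (trans (cong (μ* ss +_) (+-comm (μ v) (μ s)))
      (trans (sym (+-assoc (μ* ss) (μ s) (μ v))) (cong (_+ μ v) (+-comm (μ* ss) (μ s))))))
  μ*-update (s ∷ ss) (suc y) v = trans (+-assoc (μ s) (μ* (ss [ y ]≔ v)) _)
    (trans (cong (μ s +_) (μ*-update ss y v)) (sym (+-assoc (μ s) (μ* ss) (μ v))))

  μ*-update-< : ∀ {g n k} (E : Vec (Exp g n) k) y {v v′} → μ v < μ v′ →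
                μ* (E [ y ]≔ v) < μ* (E [ y ]≔ v′)
  μ*-update-< (s ∷ ss) zero    lt = +-monoˡ-≤ (μ* ss) lt
  μ*-update-< (s ∷ ss) (suc y) lt =
    ≤-trans (≤-reflexive (sym (+-suc (μ s) _))) (+-monoʳ-≤ (μ s) (μ*-update-< ss y lt))

  μ-llet-in : ∀ {g n p q} (E₁ : Vec (Exp g (suc p + n)) (suc p))
              (E₂ : Vec (Exp g (suc q + (suc p + n))) (suc q)) (s : Exp g (suc q + (suc p + n))) →
              suc (μ* (rename* (old {suc p} {suc q}) E₁ ++ rename* (new {suc p} {suc q}) E₂) + μ (rename (new {suc p} {suc q}) s)) <
              suc (μ* E₁ + suc (μ* E₂ + μ s))
  μ-llet-in {p = p} {q} E₁ E₂ s
    rewrite μ*-++ (rename* (old {suc p} {suc q}) E₁) (rename* (new {suc p} {suc q}) E₂)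
          | μ*-rename (old {suc p} {suc q}) E₁ | μ*-rename (new {suc p} {suc q}) E₂ | μ-rename (new {suc p} {suc q}) s
          | +-suc (μ* E₁) (μ* E₂ + μ s) = s≤s (s≤s (≤-reflexive (+-assoc (μ* E₁) (μ* E₂) (μ s))))

  μ-llet-e : ∀ {g n p q} {h : HasLetrec g} {l : Ann g} (E₁ : Vec (Exp g (suc p + n)) (suc p)) {x}
             {E₂ : Vec (Exp g (suc q + (suc p + n))) (suc q)} {s} →
                   lookup E₁ x ≡ letrec {h = h} {l = l} E₂ s → ∀ (t : Exp g (suc p + n)) →
             suc (μ* ((rename* (old {suc p} {suc q}) E₁ [ x ]≔ rename (new {suc p} {suc q}) s) ++ rename* (new {suc p} {suc q}) E₂) +
                  μ (rename (old {suc p} {suc q}) t)) <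
             suc (μ* E₁ + μ t)
  μ-llet-e {p = p} {q} E₁ {x} {E₂} {s} eq t
    rewrite μ*-++ (rename* (old {suc p} {suc q}) E₁ [ x ]≔ rename (new {suc p} {suc q}) s) (rename* (new {suc p} {suc q}) E₂)
          | μ*-rename (new {suc p} {suc q}) E₂ | μ-rename (old {suc p} {suc q}) t =
    s≤s (+-monoˡ-≤ (μ t) (≤-reflexive (+-cancelʳ-≡ (μ s) _ _ total)))
    where
    U = rename* (old {suc p} {suc q}) E₁ [ x ]≔ rename (new {suc p} {suc q}) s
    total : suc (μ* U + μ* E₂) + μ s ≡ μ* E₁ + μ s
    total = trans (cong suc (+-assoc (μ* U) (μ* E₂) (μ s))) (trans (sym (+-suc (μ* U) (μ* E₂ + μ s)))
      (trans (cong (μ* U +_) (sym (trans (cong μ (lookup-rename* (old {suc p} {suc q}) E₁ x))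
          (trans (μ-rename (old {suc p} {suc q}) (lookup E₁ x)) (cong μ eq)))))
        (trans (μ*-update (rename* (old {suc p} {suc q}) E₁) x (rename (new {suc p} {suc q}) s))
          (cong₂ _+_ (μ*-rename (old {suc p} {suc q}) E₁) (μ-rename (new {suc p} {suc q}) s)))))

  ⟦_⟧F : ∀ {g n m} → Frame g n → ℕ → (Fin n → Exp Λ m) → Frame Λ m
  ⟦ app t ⟧F     k σ = app (⟦ t ⟧ k σ)
  ⟦ seq t ⟧F     k σ = seq (⟦ t ⟧ k σ)
  ⟦ case τ rs ⟧F k σ = case τ (⟦ rs ⟧ᵃ k σ)

  ⟦_⟧S : ∀ {g n m} → Stack g n → ℕ → (Fin n → Exp Λ m) → Stack Λ m
  ⟦ fs ⟧S k σ = List.map (λ f → ⟦ f ⟧F k σ) fs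

  ⟦plugF⟧ : ∀ {g n m k} {σ : Fin n → Exp Λ m} (f : Frame g n) u →
            ⟦ plugF f u ⟧ k σ ≡ plugF (⟦ f ⟧F k σ) (⟦ u ⟧ k σ)
  ⟦plugF⟧ (app t)     u = refl
  ⟦plugF⟧ (seq t)     u = refl
  ⟦plugF⟧ (case τ rs) u = refl

  ⟦plugS⟧ : ∀ {g n m k} {σ : Fin n → Exp Λ m} (fs : Stack g n) u →
            ⟦ plugS fs u ⟧ k σ ≡ plugS (⟦ fs ⟧S k σ) (⟦ u ⟧ k σ)
  ⟦plugS⟧ []       u = refl
  ⟦plugS⟧ {k = k} {σ} (f ∷ fs) u =
    trans (⟦plugS⟧ fs (plugF f u)) (cong (plugS (⟦ fs ⟧S k σ)) (⟦plugF⟧ f u))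

  plugS-⊴ : ∀ {b g n m k k′} {σ τ : Fin n → Exp Λ m} → k ≤ k′ → σ ⊑[ b ] τ → (fs : Stack g n) →
            ∀ {e e′} → e ⊴[ b ] e′ →
            plugS (⟦ fs ⟧S k σ) e ⊴[ b ] plugS (⟦ fs ⟧S k′ τ) e′
  plugS-⊴ le e []               r = r
  plugS-⊴ le e (app t ∷ fs)     r = plugS-⊴ le e fs (app r (⟦⟧-mono le e t))
  plugS-⊴ le e (seq t ∷ fs)     r = plugS-⊴ le e fs (seq r (⟦⟧-mono le e t))
  plugS-⊴ le e (case τ rs ∷ fs) r = plugS-⊴ le e fs (case τ r (⟦⟧-monoᵃ le e rs))

  -- Reductions that lower the cost

  infix 4 _≺_
  -- The first step of the left side is exposed, and only what follows is simulated, so by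
  -- determinism the evaluation of u′ is strictly shorter. The inequality k < k′ is the one that
  -- `bind-⊵` requires.
  record _≺_ {g n} (u u′ : Exp g n) : Set where
    constructor strict
    field
      reduct : ∀ {k k′} → k < k′ → ∀ {m} {σ τ : Fin n → Exp Λ m} → σ ⊑[ false ] τ →
               ∃ λ e → ⟦ u ⟧ k σ ↦ e × e ⊴[ false ] ⟦ u′ ⟧ k′ τ
  open _≺_

  ≺-⊴ : ∀ {g n k k′ m} {u u′ : Exp g n} {σ τ : Fin n → Exp Λ m} → u ≺ u′ → k < k′ → σ ⊑[ false ] τ →
        ⟦ u ⟧ k σ ⊴[ false ] ⟦ u′ ⟧ k′ τ
  ≺-⊴ r lt e with reduct r lt e
  ... | _ , q , d = left q d

  ≺-↓ : ∀ {g n m} {u u′ : Exp g n} → u ≺ u′ → u ↓[ m ] → ∃ λ m′ → u′ ↓[ m′ ] × m′ < m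
  ≺-↓ r (k , d) with reduct r (≤-refl {suc k}) (λ x → ⊴-refl (var x))
  ≺-↓ r (k , done v)   | e , q , d′ = ⊥-elim (value-stuck v q)
  ≺-↓ r (k , step q′ d) | e , q , d′ with refl ← ↦-deterministic q q′ with ⊴-⇓ d′ d
  ... | m′ , d″ , z = m′ , (suc k , d″) , s≤s (z refl)

  beta-≺ : ∀ {n} {l l′ : Maybe Label} {s : LExp (suc n)} {t} →
           app {l = l} (lam {l = l′} s) t ≺ bind (t ∷ []) s
  beta-≺ {s = s} {t} = strict λ lt e → _ , ⟦beta⟧ s t , bind-⊵ lt e (t ∷ []) s

  case-≺ : ∀ {n} {l l′ : Maybe Label} {τ c ss} {rs : Alts 𝓛ˡ n (arities τ)} →
           case {l = l} τ (con {l = l′} τ c ss) rs ≺ bind ss (alternative rs c)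
  case-≺ {τ = τ} {c} {ss} {rs} =
    strict λ lt e → _ , ⟦case⟧ τ c ss rs , bind-⊵ lt e ss (alternative rs c)

  seq-≺ : ∀ {g n} {l : Ann g} {v s : Exp g n} → Value v → seq {l = l} v s ≺ s
  seq-≺ {s = s} v = strict λ lt e → _ , seq (value-⟦⟧ v) , ⟦⟧-mono (≤-trans (n≤1+n _) lt) e s

  data EvalCtx {g k} : ∀ {n} → Ctx g k n → Set where
    hole  : EvalCtx hole
    appˡ  : ∀ {n l} {C : Ctx g k n} {t} → EvalCtx C → EvalCtx (appˡ {l = l} C t)
    seqˡ  : ∀ {n l} {C : Ctx g k n} {t} → EvalCtx C → EvalCtx (seqˡ {l = l} C t)
    caseˢ : ∀ {n l} {C : Ctx g k n} {τ rs} → EvalCtx C → EvalCtx (caseˢ {l = l} τ C rs)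

  evalCtx-ctxS : ∀ {g k n} (fs : Stack g n) {C : Ctx g k n} → EvalCtx C → EvalCtx (ctxS fs C)
  evalCtx-ctxS []               c = c
  evalCtx-ctxS (app t ∷ fs)     c = evalCtx-ctxS fs (appˡ c)
  evalCtx-ctxS (seq t ∷ fs)     c = evalCtx-ctxS fs (seqˡ c)
  evalCtx-ctxS (case τ rs ∷ fs) c = evalCtx-ctxS fs (caseˢ c)

  evalCtx-rename : ∀ {g k n n′} (ρ : Fin n → Fin n′) {C : Ctx g k n} → EvalCtx C →
                   EvalCtx (renameᶜ ρ C)
  evalCtx-rename ρ hole      = hole
  evalCtx-rename ρ (appˡ c)  = appˡ (evalCtx-rename ρ c)
  evalCtx-rename ρ (seqˡ c)  = seqˡ (evalCtx-rename ρ c)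
  evalCtx-rename ρ (caseˢ c) = caseˢ (evalCtx-rename ρ c)

  evalCtx-≺ : ∀ {g k n} {C : Ctx g k n} → EvalCtx C → ∀ {u u′} → u ≺ u′ → plug C u ≺ plug C u′
  evalCtx-≺ hole r = r
  evalCtx-≺ (appˡ {t = t} c) r = strict λ lt e →
    let _ , q , d = reduct (evalCtx-≺ c r) lt e in _ , appˡ q , app d (⟦⟧-mono (≤-trans (n≤1+n _) lt) e t)
  evalCtx-≺ (seqˡ {t = t} c) r = strict λ lt e →
    let _ , q , d = reduct (evalCtx-≺ c r) lt e in _ , seqˡ q , seq d (⟦⟧-mono (≤-trans (n≤1+n _) lt) e t)
  evalCtx-≺ (caseˢ {τ = τ} {rs} c) r = strict λ lt e →
    let _ , q , d = reduct (evalCtx-≺ c r) lt e in _ , caseˢ q , case τ d (⟦⟧-monoᵃ (≤-trans (n≤1+n _) lt) e rs)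

  -- Convergence of the subexpression in some environment. It serves to rule out ill-typed redexes,
  -- such as the application of a constructor, at positions that a convergent expression must
  -- evaluate.
  Live : ∀ {g n} → Exp g n → Set
  Live {n = n} u = ∃ λ k → ∃ λ m → ∃ λ (σ : Fin n → Exp Λ m) → ∃ λ a → ⟦ u ⟧ k σ ⇓[ a ]

  evalCtx-live : ∀ {g j n} {C : Ctx g j n} → EvalCtx C → ∀ {u k m a} {σ : Fin n → Exp Λ m} →
                 ⟦ plug C u ⟧ k σ ⇓[ a ] → Live u
  evalCtx-live hole d = _ , _ , _ , _ , d
  evalCtx-live (appˡ c)  d = evalCtx-live c (proj₂ (⇓-plugF (app _) d))
  evalCtx-live (seqˡ c)  d = evalCtx-live c (proj₂ (⇓-plugF (seq _) d))
  evalCtx-live (caseˢ {τ = τ} c) d = evalCtx-live c (proj₂ (⇓-plugF (case τ _) d))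

  +-mono-< : ∀ {a b} → a < b → a + a < b + b
  +-mono-< lt = +-mono-≤ lt (≤-trans (n≤1+n _) lt)

  evalCtx-μ : ∀ {g k n} {C : Ctx g k n} → EvalCtx C → ∀ {u u′} → μ u < μ u′ →
              μ (plug C u) < μ (plug C u′)
  evalCtx-μ hole      lt = lt
  evalCtx-μ (appˡ c)  lt = +-mono-< (evalCtx-μ c lt)
  evalCtx-μ (seqˡ c)  lt = +-mono-< (evalCtx-μ c lt)
  evalCtx-μ (caseˢ c) lt = +-mono-< (evalCtx-μ c lt)

  -- The condition x ≢ y at each step ensures that replacing the binding of y leaves the path
  -- leading to it intact.
  data Demand {g n p} (E : Vec (Exp g (suc p + n)) (suc p)) (y : Fin (suc p)) : Fin (suc p) → Set where
    []   : Demand E y y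
    step : ∀ {x l} fs z → x ≢ y → lookup E x ≡ plugS fs (var {l = l} (z ↑ˡ n)) → Demand E y z →
           Demand E y x

  Ω-diverges : ∀ {n m} → ¬ (Ω {n} ⇓[ m ])
  Ω-diverges (step beta d) = Ω-diverges d

  module _ {g n p} {E : Vec (Exp g (suc p + n)) (suc p)} {y : Fin (suc p)} where

    module _ {m k k′} {σ τ : Fin n → Exp Λ m} (lt : k < k′) (e : σ ⊑[ false ] τ) {u u′ : Exp g (suc p + n)} (r : u ≺ u′) where
      private
        U U′ : Vec (Exp g (suc p + n)) (suc p)
        U  = E [ y ]≔ u
        U′ = E [ y ]≔ u′

        le : k ≤ k′
        le = ≤-trans (n≤1+n k) lt

      update-sol : ∀ {j j′} → j ≤ j′ → sol U k σ j ⊑[ false ] sol U′ k′ τ j′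
      update-sol z≤n i = Ω⊴
      update-sol {suc j} {suc j′} (s≤s j≤) i = sol-suc U U′ {j = j} {j′} i i entry
        where
        entry : ⟦ lookup U i ⟧ k (env (sol U k σ j) σ) ⊴[ false ] ⟦ lookup U′ i ⟧ k′ (env (sol U′ k′ τ j′) τ)
        entry with i ≟ y
        ... | yes refl rewrite lookup∘update i E u | lookup∘update i E u′ =
          ≺-⊴ r lt (env-⊑ (update-sol j≤) e)
        ... | no i≢y rewrite lookup∘update′ i≢y E u | lookup∘update′ i≢y E u′ =
          ⟦⟧-mono le (env-⊑ (update-sol j≤) e) (lookup E i)

      -- An exhausted index needs no separate treatment, since Ω ↦ Ω.
      demand-≺ : ∀ {x} → Demand E y x → ∀ {j j′} → j ≤ j′ → ∃ λ e →
                 sol U k σ j x ↦ e × e ⊴[ false ] sol U′ k′ τ j′ x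
      demand-≺ D z≤n = Ω , beta , Ω⊴
      demand-≺ [] {suc j} {suc j′} (s≤s j≤) with reduct r lt (env-⊑ (update-sol j≤) e)
      ... | e₁ , q , d =
        e₁ , transport (_↦ e₁) (sym (trans (lookup-⟦⟧ U y) (⟦at⟧ {k = k} (lookup∘update y E u) refl))) q ,
                         ⊴-≡ refl (trans (lookup-⟦⟧ U′ y) (⟦at⟧ {k = k′} (lookup∘update y E u′) refl)) d
      demand-≺ (step {x} fs z x≢y eq D) {suc j} {suc j′} (s≤s j≤) with demand-≺ D j≤
      ... | e₁ , q , d = plugS (⟦ fs ⟧S k _) e₁ ,
          transport (_↦ plugS (⟦ fs ⟧S k (env (sol U k σ j) σ)) e₁) (sym (unfold u {k} {j} {σ})) (↦-plugS (⟦ fs ⟧S k _) q) ,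
          ⊴-≡ refl (unfold u′ {k′} {j′} {τ}) (plugS-⊴ le (env-⊑ (update-sol j≤) e) fs d)
        where
        unfold : ∀ v {k j} {σ : Fin n → Exp Λ m} → sol (E [ y ]≔ v) k σ (suc j) x ≡
                 plugS (⟦ fs ⟧S k (env (sol (E [ y ]≔ v) k σ j) σ)) (sol (E [ y ]≔ v) k σ j z)
        unfold v {k} {j} {σ} =
          trans (lookup-⟦⟧ (E [ y ]≔ v) x) (⟦at⟧ {k = k} (trans (lookup∘update′ x≢y E v) eq)
          (trans (⟦plugS⟧ fs _) (cong (plugS (⟦ fs ⟧S k _)) (env-↑ˡ (sol (E [ y ]≔ v) k σ j) σ z))))

    demand-live : ∀ {x u} → Demand E y x → ∀ j {k m a} {σ : Fin n → Exp Λ m} →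
                  sol (E [ y ]≔ u) k σ j x ⇓[ a ] →
                  ∃ λ (τ : Fin (suc p + n) → Exp Λ m) → ∃ λ b → ⟦ u ⟧ k τ ⇓[ b ]
    demand-live D zero d = ⊥-elim (Ω-diverges d)
    demand-live {u = u} [] (suc j) {k} {a = a} d =
      _ , a , transport (_⇓[ a ]) (trans (lookup-⟦⟧ (E [ y ]≔ u) y) (⟦at⟧ {k = k} (lookup∘update y E u) refl)) d
    demand-live {x} {u} (step fs z x≢y eq D) (suc j) {k} {a = a} {σ} d =
      demand-live D j (proj₂ (⇓-plugS (⟦ fs ⟧S k _) (transport (_⇓[ a ])
      (trans (lookup-⟦⟧ (E [ y ]≔ u) x) (⟦at⟧ {k = k} (trans (lookup∘update′ x≢y E u) eq)
        (trans (⟦plugS⟧ fs _) (cong (plugS (⟦ fs ⟧S k _)) (env-↑ˡ (sol (E [ y ]≔ u) k σ j) σ z))))) d)))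

  -- The three places of a normal-order redex: a spine without letrec around it, the body of the
  -- outer letrec, or a binding demanded by the head variable of that body. In each of them a
  -- decrease of cost or of μ carries over to the whole expression.
  data Active {g k} : ∀ {n} → Ctx g k n → Set where
    top  : ∀ {n} {C : Ctx g k n} → EvalCtx C → Active C
    body : ∀ {n h l p} {E : Vec (Exp g (suc p + n)) (suc p)} {C : Ctx g k (suc p + n)} → EvalCtx C →
           Active (letrecⁱ {h = h} {l = l} E C)
    binding : ∀ {n h l l′ p} {E : Vec (Exp g (suc p + n)) (suc p)} {C : Ctx g k (suc p + n)} {x y} fs →
           EvalCtx C → Demand E y x → Active (letrecᵉ {h = h} {l = l} (ctxAt E y C) (plugS fs (var {l = l′} (x ↑ˡ n))))

  active-≺ : ∀ {g k n} {C : Ctx g k n} → Active C → ∀ {u u′} → u ≺ u′ → plug C u ≺ plug C u′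
  active-≺ (top c) r = evalCtx-≺ c r
  active-≺ (body {E = E} c) r = strict λ lt e →
    let le = ≤-trans (n≤1+n _) lt in reduct (evalCtx-≺ c r) lt (env-⊑ (sol-mono E le e le) e)
  active-≺ {n = n} (binding {l′ = l′} {E = E} {C} {x} {y} fs c D) {u} {u′} r =
    strict λ {k} {k′} lt {m} {σ} {τ} e →
    let le = ≤-trans (n≤1+n _) lt
        r′ = evalCtx-≺ c r
        -- The step in binding y appears in the approximant at the head variable x of the body,
        -- where it is the next reduction.
        e₁ , q , d = demand-≺ lt e r′ D le
        unfold : ∀ v k (σ : Fin n → Exp Λ m) →
                 ⟦ plugS fs (var {l = l′} (x ↑ˡ n)) ⟧ k (env (sol (plug* (ctxAt E y C) v) k σ k) σ) ≡
                 plugS (⟦ fs ⟧S k (env (sol (E [ y ]≔ plug C v) k σ k) σ)) (sol (E [ y ]≔ plug C v) k σ k x)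
        unfold v k σ =
          trans (cong (λ E′ → ⟦ plugS fs (var {l = l′} (x ↑ˡ n)) ⟧ k (env (sol E′ k σ k) σ)) (plug-ctxAt E y C v))
          (trans (⟦plugS⟧ fs _) (cong (plugS (⟦ fs ⟧S k _)) (env-↑ˡ (sol (E [ y ]≔ plug C v) k σ k) σ x)))
    in plugS (⟦ fs ⟧S k (env (sol (E [ y ]≔ plug C u) k σ k) σ)) e₁ ,
       transport (_↦ plugS (⟦ fs ⟧S k (env (sol (E [ y ]≔ plug C u) k σ k) σ)) e₁) (sym (unfold u k σ)) (↦-plugS (⟦ fs ⟧S k _) q) ,
       ⊴-≡ refl (unfold u′ k′ τ) (plugS-⊴ le (env-⊑ (update-sol {E = E} {y} lt e r′ le) e) fs d)

  active-live : ∀ {g j n} {C : Ctx g j n} → Active C → ∀ {u k m a} {σ : Fin n → Exp Λ m} →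
                ⟦ plug C u ⟧ k σ ⇓[ a ] → Live u
  active-live (top c)  d = evalCtx-live c d
  active-live (body c) d = evalCtx-live c d
  active-live (binding {n} {l′ = l′} {E = E} {C} {x} {y} fs c D) {u} {k} {a = a} {σ} d =
    evalCtx-live c
    (proj₂ (proj₂ (demand-live D k (proj₂ (⇓-plugS (⟦ fs ⟧S k _) (transport (_⇓[ a ])
      (trans (cong (λ E′ → ⟦ plugS fs (var {l = l′} (x ↑ˡ n)) ⟧ k (env (sol E′ k σ k) σ)) (plug-ctxAt E y C u))
        (trans (⟦plugS⟧ fs _) (cong (plugS (⟦ fs ⟧S k _)) (env-↑ˡ (sol (E [ y ]≔ plug C u) k σ k) σ x)))) d))))))

  active-μ : ∀ {g k n} {C : Ctx g k n} → Active C → ∀ {u u′} → μ u < μ u′ →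
             μ (plug C u) < μ (plug C u′)
  active-μ (top c) lt = evalCtx-μ c lt
  active-μ (body {E = E} c) lt =
    s≤s (≤-trans (≤-reflexive (sym (+-suc (μ* E) _))) (+-monoʳ-≤ (μ* E) (evalCtx-μ c lt)))
  active-μ (binding {E = E} {C} {y = y} fs c D) {u} {u′} lt
    rewrite plug-ctxAt E y C u | plug-ctxAt E y C u′ =
      s≤s (+-monoˡ-≤ _ (μ*-update-< E y (evalCtx-μ c lt)))

  -- Normal-order steps of convergent expressions

  data Outcome {n} (a : LExp n) (m : ℕ) : Set where
    answer : AnswerLR (erase a) → Outcome a m
    next   : ∀ {b m′} → a ⇒ b → b ↓[ m′ ] → m′ < m ⊎ (m′ ≤ m × μ b < μ a) → Outcome a m

  outcome-≡ : ∀ {n m} {a a′ : LExp n} → a ≡ a′ → (a′ ↓[ m ] → Outcome a′ m) → a ↓[ m ] → Outcome a m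
  outcome-≡ refl o = o

  next-≺ : ∀ {n m} {a b : LExp n} → a ⇒ b → a ≺ b → a ↓[ m ] → Outcome a m
  next-≺ r s d with ≺-↓ s d
  ... | m′ , d′ , lt = next r d′ (inj₁ lt)

  next-≾≺ : ∀ {n m} {a b c : LExp n} → a ⇒ b → a ≾[ false ] c → c ≺ b → a ↓[ m ] → Outcome a m
  next-≾≺ r w s d with cost w d
  ... | m₁ , d₁ , z with ≺-↓ s d₁
  ... | m′ , d′ , lt = next r d′ (inj₁ (≤-trans lt (z refl)))

  next-≲ : ∀ {n m} {a b : LExp n} → a ⇒ b → a ≲[ false ] b → μ b < μ a → a ↓[ m ] → Outcome a m
  next-≲ r w lt d with ≲-↓ w d
  ... | m′ , d′ , z = next r d′ (inj₂ (z refl , lt))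

  -- The frame and its head determine the rule. A combination without a rule contradicts convergence
  -- by `active-live`.
  reduce-frame : ∀ {k n m} {D : Ctx 𝓛ˡ k n} → Active D → ∀ f {r} → Head r → labelOf r ≡ just S →
                 plug D (plugF f r) ↓[ m ] → Outcome (plug D (plugF f r)) m
  reduce-frame {D = D} A (app t)     lam refl = next-≺ (lbeta D) (active-≺ A beta-≺)
  reduce-frame {D = D} A (seq t)     lam refl =
    next-≺ (seq-c D (lam _) refl) (active-≺ A (seq-≺ (lam _)))
  reduce-frame {D = D} A (case τ rs) lam refl (k , d) with active-live A d
  ... | _ , _ , _ , _ , step (caseˢ ()) _
  reduce-frame {D = D} A (app t)     con refl (k , d) with active-live A d
  ... | _ , _ , _ , _ , step (appˡ ()) _
  reduce-frame {D = D} A (seq t)     con refl =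
    next-≺ (seq-c D (con _ _ _) refl) (active-≺ A (seq-≺ (con _ _ _)))
  reduce-frame {D = D} A (case τ rs) con refl (k , d) with active-live A d
  ... | _ , _ , _ , _ , step (caseˢ ()) _
  ... | _ , _ , _ , _ , step case _ = next-≺ (case-c D) (active-≺ A case-≺) (k , d)
  reduce-frame {D = D} A f@(app t)     (letrec {E = E} {s}) refl =
    next-≲ (lapp D) (plug-≲ D (lift-≲ f)) (active-μ A (μ-lift f E s))
  reduce-frame {D = D} A f@(seq t)     (letrec {E = E} {s}) refl =
    next-≲ (lseq D) (plug-≲ D (lift-≲ f)) (active-μ A (μ-lift f E s))
  reduce-frame {D = D} A f@(case τ rs) (letrec {E = E} {s}) refl =
    next-≲ (lcase D) (plug-≲ D (lift-≲ f)) (active-μ A (μ-lift f E s))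

  -- The constructor selects the family of rules: `busy` a redex inside a demanded binding, `nested`
  -- llet-e, `value` a value that reaches the body through a chain (cp-in, seq-in, case-in or an
  -- answer), `demander` a value that reaches a frame in another binding (cp-e, seq-e, case-e).
  data Analysis {n p} (E : Vec (LExp (suc p + n)) (suc p)) (x : Fin (suc p)) : Set where
    busy     : ∀ {w} f fs {r} → Head r → labelOf r ≡ just S → lookup E w ≡ plugS (f ∷ fs) r → Demand E w x → Analysis E x
    nested   : ∀ {w q} {E₂ : Vec (LExp (suc q + (suc p + n))) (suc q)} {s} → lookup E w ≡ letrec {l = just S} E₂ s → Analysis E x
    value    : ∀ {w v} → Value v → labelOf v ≡ just S → lookup E w ≡ v → Chain E w x → Analysis E x
    demander : ∀ {w v y z} → Value v → labelOf v ≡ just S → lookup E w ≡ v → Chain E w z →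
               ∀ f fs → lookup E y ≡ plugS (f ∷ fs) (var {l = just V} (z ↑ˡ n)) → Demand E y x → w ≢ y → Analysis E x

  plugS-not-value : ∀ {g n} f (fs : Stack g n) {u} → ¬ Value (plugS (f ∷ fs) u)
  plugS-not-value (app t)     []        ()
  plugS-not-value (seq t)     []        ()
  plugS-not-value (case τ rs) []        ()
  plugS-not-value f           (f′ ∷ fs) = plugS-not-value f′ fs

  module _ {n p} {E : Vec (LExp (suc p + n)) (suc p)} where
    demand-cons : ∀ {x y z l} fs → lookup E x ≡ plugS fs (var {l = l} (z ↑ˡ n)) → Demand E y z →
                  Demand E y x
    demand-cons {x} {y} fs eq D with x ≟ y
    ... | yes refl = []
    ... | no x≢y   = step fs _ x≢y eq D

    -- A value travels back along bare variables and extends its chain. The first frame on the way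
    -- makes the binding of that frame the place of reduction; everything before it is demand.
    analyse : ∀ {x} → LPath E x → Analysis E x
    analyse (end [] _ lam hl eq)                = value (lam _) hl eq []
    analyse (end [] _ con hl eq)                = value (con _ _ _) hl eq []
    analyse (end [] _ letrec refl eq)           = nested eq
    analyse (end (f ∷ fs) _ hd hl eq)           = busy f fs hd hl eq []
    analyse (link z eq π) with analyse π
    ... | busy f fs hd hl eq′ D                 = busy f fs hd hl eq′ (demand-cons [] eq D)
    ... | nested eq′                            = nested eq′
    ... | value v hl eq′ ch                     = value v hl eq′ (ch ▸ eq)
    ... | demander v hl eq′ ch f fs eq″ D w≢y   =
      demander v hl eq′ ch f fs eq″ (demand-cons [] eq D) w≢y
    analyse (step f₀ fs₀ z eq π) with analyse π
    ... | busy f fs hd hl eq′ D                 = busy f fs hd hl eq′ (demand-cons (f₀ ∷ fs₀) eq D)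
    ... | nested eq′                            = nested eq′
    ... | value v hl eq′ ch                     = demander v hl eq′ ch f₀ fs₀ eq [] λ { refl →
            plugS-not-value f₀ fs₀ (transport Value (trans (sym eq′) eq) v) }
    ... | demander v hl eq′ ch f fs eq″ D w≢y   =
      demander v hl eq′ ch f fs eq″ (demand-cons (f₀ ∷ fs₀) eq D) w≢y

  replaces-app : ∀ {g j n} {C : Ctx g j n} {l : Ann g} {x u w w′ t} → Replaces C x u w w′ →
                 Replaces C x u (app {l = l} w t) (app {l = l} w′ t)
  replaces-app {t = t} R = record { replace   = λ le e q → app (replace R le e q) (⟦⟧-mono le e t)
                                  ; unreplace = λ le e q → app (unreplace R le e q) (⟦⟧-mono le e t) }

  replaces-plugF : ∀ {g j n} {C : Ctx g j n} {x u w w′} f → Replaces C x u w w′ →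
                   Replaces C x u (plugF f w) (plugF f w′)
  replaces-plugF (app t)     = replaces-app
  replaces-plugF (seq t)     = replaces-seq
  replaces-plugF (case τ rs) = replaces-case

  copyOf : ∀ {j n} (C : Ctx 𝓛ˡ j n) {v : LExp n} → Value v → LExp j
  copyOf C (lam s)      = rename (wk C) (lam {l = nothing} s)
  copyOf C (con τ c ss) = rename (wk C) (con {l = nothing} τ c ss)

  replaces-copy : ∀ {j n l} (C : Ctx 𝓛ˡ j n) {x u v} (val : Value v) → u ≡ v →
                  Replaces C x u (var {l = l} (wk C x)) (copyOf C val)
  replaces-copy C (lam s)      eq =
    replaces-var λ {k} σ → trans (⟦⟧-rename (λ _ → refl) (lam {l = nothing} s)) (sym (⟦at⟧ {k = k} eq refl))
  replaces-copy C (con τ c ss) eq =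
    replaces-var λ {k} σ → trans (⟦⟧-rename (λ _ → refl) (con {l = nothing} τ c ss)) (sym (⟦at⟧ {k = k} eq refl))

  occ-frame : ∀ {n p} f (fs : Stack 𝓛ˡ (p + n)) (z : Fin p) l →
              plugS (f ∷ fs) (var {l = just l} (z ↑ˡ n)) ≡ plug (ctxS fs hole) (plugF f (occ {n = n} (ctxS fs hole) z l))
  occ-frame {n} f fs z l = sym (trans (plug-ctxS fs hole _)
    (cong (λ y → plugS fs (plugF f (var {l = just l} y))) (wk-ctxS fs hole (z ↑ˡ n))))

  chain-erase : ∀ {n p} {E : Vec (LExp (p + n)) p} {x y} → Chain E x y →
                Chain (convert* {g′ = 𝓛} id (λ _ → tt) E) x y
  lookup-erase : ∀ {n k} (E : Vec (LExp n) k) i →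
                 lookup (convert* {g′ = 𝓛} id (λ _ → tt) E) i ≡ erase (lookup E i)
  lookup-erase (s ∷ ss) zero    = refl
  lookup-erase (s ∷ ss) (suc i) = lookup-erase ss i
  chain-erase []                    = []
  chain-erase {E = E} (_▸_ {y = y} ch eq) = chain-erase ch ▸ trans (lookup-erase E y) (cong erase eq)

  rename-plugF : ∀ {g m n} (ρ : Fin m → Fin n) (f : Frame g m) u →
                 rename ρ (plugF f u) ≡ plugF (renameF ρ f) (rename ρ u)
  rename-plugF ρ (app t)     u = refl
  rename-plugF ρ (seq t)     u = refl
  rename-plugF ρ (case τ rs) u = refl

  rename-plugS : ∀ {g m n} (ρ : Fin m → Fin n) (fs : Stack g m) u →
                 rename ρ (plugS fs u) ≡ plugS (List.map (renameF ρ) fs) (rename ρ u)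
  rename-plugS ρ []       u = refl
  rename-plugS ρ (f ∷ fs) u =
    trans (rename-plugS ρ fs (plugF f u)) (cong (plugS (List.map (renameF ρ) fs)) (rename-plugF ρ f u))

  rename-plugS-old : ∀ {g p q n} {l : Ann g} (fs : Stack g (p + n)) x →
                     rename (old {p} {q} {n}) (plugS fs (var {l = l} (x ↑ˡ n))) ≡
                     plugS (List.map (renameF (old {p} {q} {n})) fs) (var {l = l} ((x ↑ˡ q) ↑ˡ n))
  rename-plugS-old {p = p} {q} {n} {l} fs x =
    trans (rename-plugS (old {p} {q} {n}) fs (var {l = l} (x ↑ˡ n))) (cong (λ y → plugS (List.map (renameF (old {p} {q} {n})) fs) (var {l = l} y)) (old-↑ˡ {p} {q} {n} x))

  module _ {n p} {E : Vec (LExp (suc p + n)) (suc p)} {x₁ τ₀ c} {ss : Vec (LExp (suc p + n)) (ar τ₀ c)}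
           {eq : lookup E x₁ ≡ con {l = just S} τ₀ c ss} where
    open CaseEnv E eq

    demand-M : ∀ {x y} → Demand E y x → Demand M (y ↑ˡ q) (x ↑ˡ q)
    demand-M [] = []
    demand-M (step {x} fs z x≢y e D) =
      step (List.map (renameF ρ) fs) (z ↑ˡ q) (λ e → x≢y (↑ˡ-injective q _ _ e))
      (trans (lookup-M (not-con fs e)) (trans (cong (rename ρ) e) (rename-plugS-old fs z))) (demand-M D)
      where
      not-con : ∀ fs {l z} → lookup E x ≡ plugS fs (var {l = l} z) → x ≢ x₁
      not-con []       e refl with trans (sym eq) e
      ... | ()
      not-con (f ∷ fs) e refl = plugS-not-value f fs (transport Value (trans (sym eq) e) (con _ _ _))

  module _ {n p m : ℕ} {l : Maybe Label} {E : Vec (LExp (suc p + n)) (suc p)} {x : Fin (suc p)} (fs₀ : Stack 𝓛ˡ (suc p + n)) where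
    private
      t : LExp (suc p + n)
      t = plugS fs₀ (var {l = just V} (x ↑ˡ n))

    module Binding {y} (D : Demand E y x) {k} (C : Ctx 𝓛ˡ k (suc p + n)) (c : EvalCtx C) where
      ctx : Ctx 𝓛ˡ k n
      ctx = letrecᵉ {l = l} (ctxAt E y C) t

      active : Active ctx
      active = binding fs₀ c D

      plug-binding : ∀ u → plug ctx u ≡ letrec {l = l} (E [ y ]≔ plug C u) t
      plug-binding u = cong (λ E → letrec {l = l} E t) (plug-ctxAt E y C u)

      unchanged : ∀ {u} → lookup E y ≡ plug C u → letrec {l = l} E t ≡ plug ctx u
      unchanged {u} eq =
        sym (trans (plug-binding u) (cong (λ E → letrec {l = l} E t) (trans (cong (E [ y ]≔_) (sym eq)) ([]≔-lookup E y))))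

    -- The laws that bring the constructor application to the frame do not raise the cost, and the
    -- local seq or case that follows lowers it strictly. The copy is also what shows the frame to
    -- be of the right kind.
    force-body : ∀ {w τ c ss} f → lookup E w ≡ con {l = just S} τ c ss → Chain E w x → ∀ fs →
                 let a = letrec {l = l} E (plug (ctxS fs hole) (plugF f (occ {n = n} (ctxS fs hole) x V))) in
                 a ↓[ m ] → Outcome a m
    force-body {τ = τ} {c} {ss} f eq ch fs =
      go f (copy-in C ch (replaces-plugF f (replaces-copy C (con τ c ss) eq)))
      where
      C = ctxS fs hole
      A : ∀ {E : Vec (LExp (suc p + n)) (suc p)} → Active (letrecⁱ {l = l} E C)
      A = body (evalCtx-ctxS fs hole)
      go : ∀ f →
           letrec {l = l} E (plug C (plugF f (occ {n = n} C x V))) ≲[ false ] letrec {l = l} E (plug C (plugF f (copyOf C (con {l = just S} τ c ss)))) →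
           letrec {l = l} E (plug C (plugF f (occ {n = n} C x V))) ↓[ m ] → Outcome (letrec {l = l} E (plug C (plugF f (occ {n = n} C x V)))) m
      go (seq s) w d = next-≾≺ (seq-in C eq ch) (≲⇒≾ w) (active-≺ (A {E}) (seq-≺ (con _ _ _))) d
      go (app s) w d with ≲-↓ w d
      ... | _ , (_ , d′) , _ with active-live (A {E}) d′
      ...   | _ , _ , _ , _ , step (appˡ ()) _
      go (case {l′} τ′ rs) w d with ≲-↓ w d
      ... | _ , (_ , d′) , _ with active-live (A {E}) d′
      ...   | _ , _ , _ , _ , step (caseˢ ()) _
      ...   | _ , _ , _ , _ , step case _ = next-≾≺ (case-in C eq ch)
          (≾-trans (≲⇒≾ (≲-≡ refl (cong (letrec {l = l} M) (sym (rename-scrutinee x))) (caseEnv-≲ E eq _)))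
                   (≲⇒≾ (copy-in {l = l} {l} C′ (chain-M ch) (force x))))
          (transport (λ s → letrec {l = l} M (plug C′ forced) ≺ letrec {l = l} M s) (sym caseBody≡)
            (active-≺ (body {l = l} {E = M} (evalCtx-rename ρ (evalCtx-ctxS fs hole))) case-≺)) d
        where open CaseEnv E eq
              open Branch C rs {l′}

    force-binding : ∀ {w τ c ss y z} f → lookup E w ≡ con {l = just S} τ c ss → Chain E w z → w ≢ y →
                    Demand E y x → ∀ fs →
                    lookup E y ≡ plug (ctxS fs hole) (plugF f (occ {n = n} (ctxS fs hole) z V)) →
                    letrec {l = l} E t ↓[ m ] → Outcome (letrec {l = l} E t) m
    force-binding {τ = τ} {c} {ss} {y} {z} f eq ch w≢y D fs = go f
      where
      C = ctxS fs hole
      c′ = evalCtx-ctxS fs hole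
      open Binding D C c′
      copied : ∀ f → lookup E y ≡ plug C (plugF f (occ {n = n} C z V)) →
               letrec {l = l} E t ≲[ false ] plug ctx (plugF f (copyOf C (con {l = just S} τ c ss)))
      copied f ey =
        ≲-≡ refl (plug-binding _) (copy-e C ch (replaces-plugF f (replaces-copy C (con τ c ss) eq)) ey)
      go : ∀ f → lookup E y ≡ plug C (plugF f (occ {n = n} C z V)) → letrec {l = l} E t ↓[ m ] →
           Outcome (letrec {l = l} E t) m
      go (seq {l′} s) ey d = next-≾≺ (seq-e C eq ch w≢y ey) (≲⇒≾ (copied (seq s) ey))
        (transport (plug ctx (seq {l = l′} (copyOf C (con {l = just S} τ c ss)) s) ≺_) (plug-binding s) (active-≺ active (seq-≺ (con _ _ _)))) d
      go f@(app s) ey d with ≲-↓ (copied f ey) d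
      ... | _ , (_ , d′) , _ with active-live active d′
      ...   | _ , _ , _ , _ , step (appˡ ()) _
      go f@(case {l′} τ′ rs) ey d with ≲-↓ (copied f ey) d
      ... | _ , (_ , d′) , _ with active-live active d′
      ...   | _ , _ , _ , _ , step (caseˢ ()) _
      ...   | _ , _ , _ , _ , step case _ = next-≾≺ (case-e C eq ch w≢y ey)
          (≾-trans (≲⇒≾ (caseEnv-≲ {l = l} {l} E eq t))
                   (≲⇒≾ (≲-≡ refl (cong (λ E → letrec {l = l} E (rename ρ t)) (plug-ctxAt M (y ↑ˡ q) C′ forced))
                     (copy-e {l = l} {l} C′ (chain-M ch) (force z) ey-M))))
          (transport (plug ctxM forced ≺_)
            (trans (cong (λ E → letrec {l = l} E (rename ρ t)) (plug-ctxAt M (y ↑ˡ q) C′ branch))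
                   (cong (λ s → letrec {l = l} (M [ y ↑ˡ q ]≔ s) (rename ρ t)) (sym caseBody≡)))
            (active-≺ activeM case-≺)) d
        where
        open CaseEnv E eq
        open Branch C rs {l′}
        ey-M : lookup M (y ↑ˡ q) ≡ plug C′ (scrutinee z)
        ey-M = trans (lookup-M (λ e → w≢y (sym e))) (trans (cong (rename ρ) ey) (rename-scrutinee z))
        ctxM = letrecᵉ {l = l} (ctxAt M (y ↑ˡ q) C′) (rename ρ t)
        activeM : Active ctxM
        activeM =
          transport (λ t → Active (letrecᵉ {l = l} (ctxAt M (y ↑ˡ q) C′) t)) (sym (rename-plugS-old fs₀ x))
          (binding {l = l} {just V} (List.map (renameF ρ) fs₀) (evalCtx-rename ρ c′) (demand-M {eq = eq} D))

    reduce-path : LPath E x → letrec {l = l} E t ↓[ m ] → Outcome (letrec {l = l} E t) m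
    reduce-path π with analyse π
    ... | busy f fs hd hl eq D =
      outcome-≡ (unchanged (trans eq (sym (plug-ctxS fs hole _)))) (reduce-frame active f hd hl)
      where open Binding D (ctxS fs hole) (evalCtx-ctxS fs hole)
    ... | nested eq = next-≲ (llet-e eq) (llet-e-≲ E eq t) (μ-llet-e E eq t)
    ... | value (lam s) refl eq ch = outcome-≡ (cong (letrec {l = l} E) (sym (occ-ctxS fs₀ x V)))
      -- cp keeps the cost, but replaces a variable, of measure 1, by an abstraction, of measure 0.
      (next-≲ (cp-in {l′ = nothing} C eq ch) (copy-in C ch (replaces-copy C (lam s) eq))
              (active-μ (body {l = l} {E = E} (evalCtx-ctxS fs₀ hole)) {copyOf C (lam {l = just S} s)} {occ {n = n} C x V} (s≤s z≤n)))
      where C = ctxS fs₀ hole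
    ... | value (con τ c ss) refl eq ch = go fs₀
      where
      go : ∀ fs → letrec {l = l} E (plugS fs (var {l = just V} (x ↑ˡ n))) ↓[ m ] →
           Outcome (letrec {l = l} E (plugS fs (var {l = just V} (x ↑ˡ n)))) m
      -- Constructor applications are never copied: without a frame around the variable the
      -- expression is an answer.
      go []       d = answer (letrec-con (trans (lookup-erase E _) (cong erase eq)) (chain-erase ch))
      go (f ∷ fs) d =
        outcome-≡ (cong (letrec {l = l} E) (occ-frame f fs x V)) (force-body f eq ch fs) d
    ... | demander {w} {y = y} {z} (lam s) refl eq ch f fs ey D w≢y =
      next-≲ (cp-e {l′ = nothing} C eq ch w≢y ey′)
        (copy-e C ch (replaces-copy C (lam s) eq) ey′)
        (transport₂ (λ a b → μ a < μ b) (plug-binding _) (sym (unchanged ey′)) (active-μ active {copyOf C (lam {l = just S} s)} {occ {n = n} C z V} (s≤s z≤n)))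
      where
      C = ctxS (f ∷ fs) hole
      open Binding D C (evalCtx-ctxS (f ∷ fs) hole)
      ey′ : lookup E y ≡ plug C (occ {n = n} C z V)
      ey′ = trans ey (sym (occ-ctxS (f ∷ fs) z V))
    ... | demander {z = z} (con τ c ss) refl eq ch f fs ey D w≢y =
      force-binding f eq ch w≢y D fs (trans ey (occ-frame f fs z V))

  data Split p {n} : Fin (p + n) → Set where
    bound : ∀ i → Split p (i ↑ˡ n)
    free  : ∀ j → Split p (p ↑ʳ j)

  data Viewed {n} (t : Exp 𝓛 n) : Set where
    head     : ∀ fs r → Head r → t ≡ plugS fs r → Viewed t
    headVar : ∀ fs x → t ≡ plugS fs (var x) → Viewed t

  view : ∀ {n} (fs : Stack 𝓛 n) t → Viewed (plugS fs t)
  view fs (var x)       = headVar fs x refl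
  view fs (app s t)     = view (app t ∷ fs) s
  view fs (lam s)       = head fs (lam s) lam refl
  view fs (letrec E t)  = head fs (letrec E t) letrec refl
  view fs (con τ c ss)  = head fs (con τ c ss) con refl
  view fs (seq s t)     = view (seq t ∷ fs) s
  view fs (case τ s rs) = view (case τ rs ∷ fs) s

  plugS-var-⇓ : ∀ {g n m k a} {σ : Fin n → Exp Λ m} {l : Ann g} (fs : Stack g n) x →
                ⟦ plugS fs (var {l = l} x) ⟧ k σ ⇓[ a ] → ∃ λ b → σ x ⇓[ b ]
  plugS-var-⇓ {k = k} {a} {σ} fs x d = ⇓-plugS (⟦ fs ⟧S k σ) (transport (_⇓[ a ]) (⟦plugS⟧ fs _) d)

  free-⇓ : ∀ {n k a p} {f : Fin p → Exp Λ n} {l} (fs : Stack 𝓛 (p + n)) j →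
           ¬ (⟦ plugS fs (var {l = l} (p ↑ʳ j)) ⟧ k (env f var) ⇓[ a ])
  free-⇓ {p = p} {f} fs j d with plugS-var-⇓ fs (p ↑ʳ j) d
  ... | b , d′ with transport (_⇓[ b ]) (env-↑ʳ p f var j) d′
  ...   | step () _

  -- Each binding on the path costs one unfolding, so that the index of the
  -- Kleene approximant bounds the length of the path.
  demand-path : ∀ {n p k a} (E : Vec (Exp 𝓛 (suc p + n)) (suc p)) j {x} →
                sol {m = n} E k var j x ⇓[ a ] → Path E x
  demand-path E zero d = ⊥-elim (Ω-diverges d)
  demand-path {n} {p} {k} E (suc j) {x} d with view [] (lookup E x) | transport (_⇓[ _ ]) (lookup-⟦⟧ E x) d
  ... | head fs r hd eq | d′ = end fs r hd eq
  ... | headVar fs y eq | d′ with splitCases (suc p) {P = Split (suc p)} bound free y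
  ...   | free i = ⊥-elim (free-⇓ {p = suc p} fs i (transport (_⇓[ _ ]) (⟦at⟧ {k = k} eq refl) d′))
  ...   | bound z with plugS-var-⇓ fs (z ↑ˡ n) (transport (_⇓[ _ ]) (⟦at⟧ {k = k} eq refl) d′)
  ...     | b , d″ =
    step fs z eq (demand-path E j (transport (_⇓[ b ]) (env-↑ˡ (sol E k var j) var z) d″))

  data Progress {n} (s : Exp 𝓛 n) (m : ℕ) : Set where
    answer : AnswerLR s → Progress s m
    next   : ∀ {s′ m′} → s ⟶LR s′ → s′ ↓[ m′ ] → m′ < m ⊎ (m′ ≤ m × μ s′ < μ s) → Progress s m

  perform : ∀ {n m} {s : Exp 𝓛 n} {a} → Star _⇝_ (withoutLabels s ^ T) a → Clean true a →
            (a ↓[ m ] → Outcome a m) → s ↓[ m ] → Progress s m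
  perform {m = m} {s} {a} rs c o d with o (erase-↓ a (transport (_↓[ m ]) (sym (labelling-erase rs)) d))
  ... | answer ans = answer (transport AnswerLR (labelling-erase rs) ans)
  ... | next {b} r d′ lt = next (step rs (clean-Fails c) (quiet-normal c) r) (erase-↓⁻¹ b d′)
    (transport₂ (λ x y → _ < m ⊎ (_ ≤ m × x < y)) (sym (μ-erase b)) (trans (sym (μ-erase a)) (cong μ (labelling-erase rs))) lt)

  progress-body : ∀ {n p m} (E : Vec (Exp 𝓛 (suc p + n)) (suc p)) t → letrec E t ↓[ m ] →
                  Progress (letrec E t) m
  progress-body {n} {p} {m} E t d@(k , d′) with view [] t
  ... | head [] _ (lam {s = s}) refl          = answer (letrec-val (lam s))
  ... | head [] _ (con {τ = τ} {c} {ss}) refl = answer (letrec-val (con τ c ss))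
  ... | head [] _ (letrec {E = E₂} {s}) refl  = perform (labelling-body E [] (letrec E₂ s))
        ((λ _ ()) , clean-withoutLabels* E , proj₁ (head-label {r = letrec E₂ s} letrec))
        (next-≲ llet-in (llet-in-≲ E₁ E₂′ s′) (μ-llet-in E₁ E₂′ s′)) d
    where
    E₁ = convert* {g′ = 𝓛ˡ} id (λ _ → nothing) E
    E₂′ = convert* {g′ = 𝓛ˡ} id (λ _ → nothing) E₂
    s′ = withoutLabels s
  ... | head (f ∷ fs) r hd refl               = perform (labelling-body E (f ∷ fs) r)
        ((λ _ ()) , clean-withoutLabels* E , clean-plugS (f ∷ fs) (proj₁ (head-label hd)))
        (outcome-≡ (cong (letrec _) (sym (plug-ctxS (labS fs) hole _)))
          (reduce-frame (body (evalCtx-ctxS (labS fs) hole)) (labF f) (proj₁ (proj₂ (head-label hd))) (proj₂ (proj₂ (head-label hd))))) d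
  ... | headVar fs y refl with splitCases (suc p) {P = Split (suc p)} bound free y
  ...   | free j = ⊥-elim (free-⇓ {p = suc p} fs j d′)
  ...   | bound x =
        perform P.labelling P.quiet (reduce-path (labS fs) P.path) d
    where
    live = plugS-var-⇓ fs (x ↑ˡ n) d′
    demanded : Demanded E fs x
    demanded =
      labelling-path E fs (demand-path E k (transport (_⇓[ proj₁ live ]) (env-↑ˡ (sol E k var k) var x) (proj₂ live)))
    module P = Demanded demanded

  progress : ∀ {n m} (s : Exp 𝓛 n) → s ↓[ m ] → Progress s m
  progress s d@(k , d′) with view [] s
  ... | head [] _ (lam {s = s}) refl          = answer (value (lam s))
  ... | head [] _ (con {τ = τ} {c} {ss}) refl = answer (value (con τ c ss))
  ... | head [] _ (letrec {E = E} {t}) refl   = progress-body E t d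
  ... | head (f ∷ fs) r hd refl               =
    perform (labelling-top (f ∷ fs) r) (clean-plugS (f ∷ fs) (proj₁ (head-label hd)))
        (outcome-≡ (sym (plug-ctxS (labS fs) hole _))
          (reduce-frame (top (evalCtx-ctxS (labS fs) hole)) (labF f) (proj₁ (proj₂ (head-label hd))) (proj₂ (proj₂ (head-label hd))))) d
  ... | headVar fs x refl with plugS-var-⇓ {k = k} fs x d′
  ...   | _ , step () _

  prepend : ∀ {n} {s s′ : Exp 𝓛 n} → s ⟶LR s′ → s′ ↓LR → s ↓LR
  prepend r (v , rs , ans) = v , r ◅ rs , ans

  mutual
    -- Lexicographic recursion with two fuels, B above the cost and B′ above μ. When the cost falls,
    -- μ may grow arbitrarily and B′ is set anew.
    ↓⇒↓LR : ∀ B B′ {n m} (s : Exp 𝓛 n) → s ↓[ m ] → m < B → μ s < B′ → s ↓LR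
    ↓⇒↓LR (suc B) (suc B′) s d lt lt′ = iterate (suc B) (suc B′) s (progress s d) lt lt′

    iterate : ∀ B B′ {n m} (s : Exp 𝓛 n) → Progress s m → m < B → μ s < B′ → s ↓LR
    iterate B B′ s (answer ans) _ _ = s , ε , ans
    iterate (suc B) B′ s (next {s′} r d (inj₁ m′<m)) lt lt′ =
      prepend r (↓⇒↓LR B (suc (μ s′)) s′ d (s≤s⁻¹ (≤-trans (s≤s m′<m) lt)) ≤-refl)
    iterate B (suc B′) s (next {s′} r d (inj₂ (m′≤m , μ<))) lt lt′ =
      prepend r (↓⇒↓LR B B′ s′ d (≤-trans (s≤s m′≤m) lt) (s≤s⁻¹ (≤-trans (s≤s μ<) lt′)))

  name⇒lcc : ∀ {n} {s : Exp 𝓛 n} → s ↓name → N s ↓lcc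
  name⇒lcc d = ⇓⇒↓lcc (proj₂ (↓name⇒N⇓ d))

  lcc⇒name : ∀ {n} {s : Exp 𝓛 n} → N s ↓lcc → s ↓name
  lcc⇒name {s = s} d = N⇓⇒↓name _ hole [] s (proj₂ (↓lcc⇒⇓ d)) ≤-refl

  LR⇒lcc : ∀ {n} {s : Exp 𝓛 n} → s ↓LR → N s ↓lcc
  LR⇒lcc {s = s} d = ⇓⇒↓lcc (proj₂ (↓⇒N⇓ {s = s} (proj₂ (↓LR⇒↓ d))))

  lcc⇒LR : ∀ {n} {s : Exp 𝓛 n} → N s ↓lcc → s ↓LR
  lcc⇒LR {s = s} d = ↓⇒↓LR _ _ s (proj₂ (N⇓⇒↓ {s = s} (proj₂ (↓lcc⇒⇓ d)))) ≤-refl ≤-refl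

  -- Contexts

  lift-injective : ∀ {m n} k {ρ : Fin m → Fin n} → (∀ {x y} → ρ x ≡ ρ y → x ≡ y) → ∀ {x y} →
                   lift k ρ x ≡ lift k ρ y → x ≡ y
  lift-injective zero    inj                 e = inj e
  lift-injective (suc k) inj {zero}  {zero}  e = refl
  lift-injective (suc k) inj {suc x} {suc y} e = cong suc (lift-injective k inj (suc-injective e))

  mutual
    holeRenaming-injective : ∀ {g k n n′} (C : Ctx g k n) {ρ : Fin n → Fin n′} →
        (∀ {x y} → ρ x ≡ ρ y → x ≡ y) →
                             ∀ {x y} → holeRenaming C ρ x ≡ holeRenaming C ρ y → x ≡ y
    holeRenaming-injective hole           inj = inj
    holeRenaming-injective (appˡ C t)     inj = holeRenaming-injective C inj
    holeRenaming-injective (appʳ s C)     inj = holeRenaming-injective C inj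
    holeRenaming-injective (lam C)        inj = holeRenaming-injective C (lift-injective 1 inj)
    holeRenaming-injective (letrecᵉ C t)  inj = holeRenaming-injective* C (lift-injective _ inj)
    holeRenaming-injective (letrecⁱ E C)  inj = holeRenaming-injective C (lift-injective _ inj)
    holeRenaming-injective (con τ c C)    inj = holeRenaming-injective* C inj
    holeRenaming-injective (seqˡ C t)     inj = holeRenaming-injective C inj
    holeRenaming-injective (seqʳ s C)     inj = holeRenaming-injective C inj
    holeRenaming-injective (caseˢ τ C rs) inj = holeRenaming-injective C inj
    holeRenaming-injective (caseᵃ τ s C)  inj = holeRenaming-injectiveᵃ C inj

    holeRenaming-injective* : ∀ {g k n n′ j} (C : Ctxs g k n j) {ρ : Fin n → Fin n′} →
        (∀ {x y} → ρ x ≡ ρ y → x ≡ y) →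
                              ∀ {x y} → holeRenaming* C ρ x ≡ holeRenaming* C ρ y → x ≡ y
    holeRenaming-injective* (here C ss) inj = holeRenaming-injective C inj
    holeRenaming-injective* (there s C) inj = holeRenaming-injective* C inj

    holeRenaming-injectiveᵃ : ∀ {g k n n′ js} (C : AltsCtx g k n js) {ρ : Fin n → Fin n′} →
        (∀ {x y} → ρ x ≡ ρ y → x ≡ y) →
                              ∀ {x y} → holeRenamingᵃ C ρ x ≡ holeRenamingᵃ C ρ y → x ≡ y
    holeRenaming-injectiveᵃ (here C rs) inj = holeRenaming-injective C (lift-injective _ inj)
    holeRenaming-injectiveᵃ (there r C) inj = holeRenaming-injectiveᵃ C inj

  -- F is given by a context whose hole lies below further binders.
  record Contextual {k n} (F : Exp Λ k → Exp Λ n) : Set where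
    constructor contextual
    field
      {scope}   : ℕ
      context   : Ctx Λ scope n
      weakening : Fin k → Fin scope
      injective : ∀ {x y} → weakening x ≡ weakening y → x ≡ y
      plugs     : ∀ u → F u ≡ plug context (rename weakening u)

  contextual-id : ∀ {k} → Contextual {k} id
  contextual-id = contextual hole id id (λ u → sym (rename-id (λ _ → refl) u))

  contextual-rename : ∀ {k n} {F : Exp Λ k → Exp Λ n} {n′} {ρ : Fin n → Fin n′} →
                      (∀ {x y} → ρ x ≡ ρ y → x ≡ y) → Contextual F → Contextual (rename ρ ∘ F)
  contextual-rename {ρ = ρ} inj (contextual C π π-inj eq) =
    contextual (renameᶜ ρ C) (holeRenaming C ρ ∘ π)
    (λ e → π-inj (holeRenaming-injective C inj e))
    (λ u → trans (cong (rename ρ) (eq u)) (trans (rename-plug ρ C _) (cong (plug (renameᶜ ρ C)) (rename-∘ (λ _ → refl) u))))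

  contextual-appˡ : ∀ {k n} {F : Exp Λ k → Exp Λ n} {t} → Contextual F →
                    Contextual (λ u → app (F u) t)
  contextual-appˡ (contextual C π inj eq) =
    contextual (appˡ C _) π inj (λ u → cong (λ s → app s _) (eq u))

  contextual-appʳ : ∀ {k n} {F : Exp Λ k → Exp Λ n} {s} → Contextual F →
                    Contextual (λ u → app s (F u))
  contextual-appʳ (contextual C π inj eq) = contextual (appʳ _ C) π inj (λ u → cong (app _) (eq u))

  contextual-apps : ∀ {k n} {F : Exp Λ k → Exp Λ n} {j} (ss : Vec (Exp Λ n) j) → Contextual F →
                    Contextual (λ u → apps (F u) ss)
  contextual-apps []       c = c
  contextual-apps (s ∷ ss) c = contextual-appˡ (contextual-apps ss c)

  contextual-arg : ∀ {k n} {F : Exp Λ k → Exp Λ n} {j f} (ss : Vec (Exp Λ n) j) i → Contextual F →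
                   Contextual (λ u → apps f (ss [ i ]≔ F u))
  contextual-arg (s ∷ ss) zero    c = contextual-appʳ c
  contextual-arg (s ∷ ss) (suc i) c = contextual-appˡ (contextual-arg ss i c)

  contextual-lams : ∀ {k n j} {F : Exp Λ k → Exp Λ (j + n)} → Contextual F → Contextual (lams j ∘ F)
  contextual-lams {j = zero}  c = c
  contextual-lams {j = suc j} (contextual C π inj eq) =
    contextual-lams {j = j} (contextual (lam C) π inj (λ u → cong lam (eq u)))

  -- `knot` contains its body once, so N does not duplicate a hole. It only puts the hole below two
  -- groups of λs, the inner of which is weakened under the outer.
  contextual-knot : ∀ {k n j} {F : Exp Λ k → Exp Λ (j + n)} → Contextual F → Contextual (knot j ∘ F)
  contextual-knot {j = j} c = contextual-lams {j = j} (contextual-apps _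
    (contextual-rename (λ e → ↑ʳ-injective j _ _ e) (contextual-lams {j = j} c)))

  contextual-≗ : ∀ {k n} {F G : Exp Λ k → Exp Λ n} → F ≗ G → Contextual G → Contextual F
  contextual-≗ e (contextual C π inj eq) = contextual C π inj (λ u → trans (e u) (eq u))

  -- The entry containing the hole is kept apart from the vector because a letrec still applies
  -- `knot` to all entries before they become arguments.
  record Contextual* {k n j} (F : Exp Λ k → Vec (Exp Λ n) j) : Set where
    constructor contextual*
    field
      vector  : Vec (Exp Λ n) j
      index   : Fin j
      {entry} : Exp Λ k → Exp Λ n
      inner   : Contextual entry
      updates : ∀ u → F u ≡ vector [ index ]≔ entry u

  record Contextualᵃ {k n js} (F : Exp Λ k → Alts Λ n js) : Set where
    constructor contextualᵃ
    field
      {scope}   : ℕ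
      context   : AltsCtx Λ scope n js
      weakening : Fin k → Fin scope
      injective : ∀ {x y} → weakening x ≡ weakening y → x ≡ y
      plugs     : ∀ u → F u ≡ plugᵃ context (rename weakening u)

  mutual
    N-contextual : ∀ {k n} (C : Ctx 𝓛 k n) → ∃ λ F → Contextual F × ∀ s → N (plug C s) ≡ F (N s)
    N-contextual hole = id , contextual-id , λ s → refl
    N-contextual (appˡ C t) = let F , c , eq = N-contextual C in
      (λ u → app (F u) (N t)) , contextual-appˡ c , λ s → cong (λ u → app u (N t)) (eq s)
    N-contextual (appʳ r C) = let F , c , eq = N-contextual C in
      (λ u → app (N r) (F u)) , contextual-appʳ c , λ s → cong (app (N r)) (eq s)
    N-contextual (lam C) = let F , contextual D π inj pl , eq = N-contextual C in
      lam ∘ F , contextual (lam D) π inj (λ u → cong lam (pl u)) , λ s → cong lam (eq s)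
    N-contextual (letrecᵉ {p = p} C t) = let F , contextual* ss i {G} c up , eq = N-contextual* C in
      (λ u → apps (knot (suc p) (N t)) (Vec.map (knot (suc p)) (ss [ i ]≔ G u))) ,
      contextual-≗ (λ u → cong (apps (knot (suc p) (N t))) (map-[]≔ (knot (suc p)) ss i))
        (contextual-arg (Vec.map (knot (suc p)) ss) i (contextual-knot {j = suc p} c)) ,
      λ s → cong (λ E → apps (knot (suc p) (N t)) (Vec.map (knot (suc p)) E)) (trans (eq s) (up (N s)))
    N-contextual (letrecⁱ {p = p} E C) = let F , c , eq = N-contextual C in
      (λ u → apps (knot (suc p) (F u)) (Vec.map (knot (suc p)) (N* E))) ,
      contextual-apps _ (contextual-knot {j = suc p} c) ,
      λ s → cong (λ u → apps (knot (suc p) u) (Vec.map (knot (suc p)) (N* E))) (eq s)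
    N-contextual (con τ c C) = let F , contextual* ss i (contextual D π inj pl) up , eq = N-contextual* C in
      con τ c ∘ F ,
      contextual (con τ c (ctxAt ss i D)) π inj (λ u → cong (con τ c)
        (trans (up u) (trans (cong (ss [ i ]≔_) (pl u)) (sym (plug-ctxAt ss i D _))))) ,
      λ s → cong (con τ c) (eq s)
    N-contextual (seqˡ C t) = let F , contextual D π inj pl , eq = N-contextual C in
      (λ u → seq (F u) (N t)) , contextual (seqˡ D (N t)) π inj (λ u → cong (λ s → seq s (N t)) (pl u)) ,
      λ s → cong (λ u → seq u (N t)) (eq s)
    N-contextual (seqʳ r C) = let F , contextual D π inj pl , eq = N-contextual C in
      (λ u → seq (N r) (F u)) , contextual (seqʳ (N r) D) π inj (λ u → cong (seq (N r)) (pl u)) ,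
      λ s → cong (seq (N r)) (eq s)
    N-contextual (caseˢ τ C rs) = let F , contextual D π inj pl , eq = N-contextual C in
      (λ u → case τ (F u) (Nᵃ rs)) , contextual (caseˢ τ D (Nᵃ rs)) π inj (λ u → cong (λ s → case τ s (Nᵃ rs)) (pl u)) ,
      λ s → cong (λ u → case τ u (Nᵃ rs)) (eq s)
    N-contextual (caseᵃ τ r C) = let F , contextualᵃ D π inj pl , eq = N-contextualᵃ C in
      (λ u → case τ (N r) (F u)) , contextual (caseᵃ τ (N r) D) π inj (λ u → cong (case τ (N r)) (pl u)) ,
      λ s → cong (case τ (N r)) (eq s)

    N-contextual* : ∀ {k n j} (C : Ctxs 𝓛 k n j) → ∃ λ F → Contextual* F × ∀ s →
                    N* (plug* C s) ≡ F (N s)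
    N-contextual* (here C ss) = let F , c , eq = N-contextual C in
      -- Ω is a placeholder that the update overwrites.
      (λ u → F u ∷ N* ss) , contextual* (Ω ∷ N* ss) zero c (λ u → refl) , λ s → cong (_∷ N* ss) (eq s)
    N-contextual* (there r C) = let F , contextual* ss i c up , eq = N-contextual* C in
      (λ u → N r ∷ F u) , contextual* (N r ∷ ss) (suc i) c (λ u → cong (N r ∷_) (up u)) , λ s → cong (N r ∷_) (eq s)

    N-contextualᵃ : ∀ {k n js} (C : AltsCtx 𝓛 k n js) → ∃ λ F → Contextualᵃ F × ∀ s →
                    Nᵃ (plugᵃ C s) ≡ F (N s)
    N-contextualᵃ (here C rs) = let F , contextual D π inj pl , eq = N-contextual C in
      (λ u → F u ∷ Nᵃ rs) , contextualᵃ (here D (Nᵃ rs)) π inj (λ u → cong (_∷ Nᵃ rs) (pl u)) , λ s → cong (_∷ Nᵃ rs) (eq s)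
    N-contextualᵃ (there r C) = let F , contextualᵃ D π inj pl , eq = N-contextualᵃ C in
      (λ u → N r ∷ F u) , contextualᵃ (there (N r) D) π inj (λ u → cong (N r ∷_) (pl u)) , λ s → cong (N r ∷_) (eq s)

  embed : ∀ {n} → Exp Λ n → Exp 𝓛 n
  embed = convert (λ ()) id

  mutual
    N-embed : ∀ {n} (s : Exp Λ n) → N (embed s) ≡ s
    N-embed (var x)       = refl
    N-embed (app s t)     = cong₂ app (N-embed s) (N-embed t)
    N-embed (lam s)       = cong lam (N-embed s)
    N-embed (con τ c ss)  = cong (con τ c) (N-embed* ss)
    N-embed (seq s t)     = cong₂ seq (N-embed s) (N-embed t)
    N-embed (case τ s rs) = cong₂ (case τ) (N-embed s) (N-embedᵃ rs)

    N-embed* : ∀ {n k} (ss : Vec (Exp Λ n) k) → N* (convert* (λ ()) id ss) ≡ ss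
    N-embed* []       = refl
    N-embed* (s ∷ ss) = cong₂ _∷_ (N-embed s) (N-embed* ss)

    N-embedᵃ : ∀ {n ks} (rs : Alts Λ n ks) → Nᵃ (convertᵃ (λ ()) id rs) ≡ rs
    N-embedᵃ []       = refl
    N-embedᵃ (r ∷ rs) = cong₂ _∷_ (N-embed r) (N-embedᵃ rs)

  mutual
    embedding : ∀ {k n} (C : Ctx Λ k n) → ∃ λ (D : Ctx 𝓛 k n) → ∀ s → N (plug D s) ≡ plug C (N s)
    embedding hole           = hole , λ s → refl
    embedding (appˡ C t)     = let D , eq = embedding C in appˡ D (embed t) , λ s → cong₂ app (eq s) (N-embed t)
    embedding (appʳ r C)     = let D , eq = embedding C in appʳ (embed r) D , λ s → cong₂ app (N-embed r) (eq s)
    embedding (lam C)        = let D , eq = embedding C in lam D , λ s → cong lam (eq s)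
    embedding (con τ c C)    = let D , eq = embedding* C in con τ c D , λ s → cong (con τ c) (eq s)
    embedding (seqˡ C t)     = let D , eq = embedding C in seqˡ D (embed t) , λ s → cong₂ seq (eq s) (N-embed t)
    embedding (seqʳ r C)     = let D , eq = embedding C in seqʳ (embed r) D , λ s → cong₂ seq (N-embed r) (eq s)
    embedding (caseˢ τ C rs) = let D , eq = embedding C in caseˢ τ D _ , λ s → cong₂ (case τ) (eq s) (N-embedᵃ rs)
    embedding (caseᵃ τ r C)  = let D , eq = embeddingᵃ C in caseᵃ τ (embed r) D , λ s → cong₂ (case τ) (N-embed r) (eq s)

    embedding* : ∀ {k n j} (C : Ctxs Λ k n j) → ∃ λ (D : Ctxs 𝓛 k n j) → ∀ s →
                 N* (plug* D s) ≡ plug* C (N s)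
    embedding* (here C ss) = let D , eq = embedding C in here D _ , λ s → cong₂ _∷_ (eq s) (N-embed* ss)
    embedding* (there r C) = let D , eq = embedding* C in there (embed r) D , λ s → cong₂ _∷_ (N-embed r) (eq s)

    embeddingᵃ : ∀ {k n js} (C : AltsCtx Λ k n js) → ∃ λ (D : AltsCtx 𝓛 k n js) → ∀ s →
                 Nᵃ (plugᵃ D s) ≡ plugᵃ C (N s)
    embeddingᵃ (here C rs) = let D , eq = embedding C in here D _ , λ s → cong₂ _∷_ (eq s) (N-embedᵃ rs)
    embeddingᵃ (there r C) = let D , eq = embeddingᵃ C in there (embed r) D , λ s → cong₂ _∷_ (N-embed r) (eq s)

  -- Equivalence of convergence transfers to the preorders because contexts correspond in both
  -- directions: a letrec-free context is embedded, and a context with letrec is translated by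
  -- `N-contextual`.
  fully-abstract : (_↓ : ∀ {n} → Exp 𝓛 n → Set) →
                   (∀ {n} {s : Exp 𝓛 n} → s ↓ → N s ↓lcc) → (∀ {n} {s : Exp 𝓛 n} → N s ↓lcc → s ↓) →
                   ∀ {n} (s₁ s₂ : Exp 𝓛 n) → ContextualPreorder _↓ s₁ s₂ ⇔ N s₁ ≤lcc N s₂
  fully-abstract _↓ to from s₁ s₂ = mk⇔ preserves reflects
    where
    preserves : ContextualPreorder _↓ s₁ s₂ → N s₁ ≤lcc N s₂
    preserves le C ρ d = let D , eq = embedding C
                             translated s =
                               trans (eq (rename (Injection.to ρ) s)) (cong (plug C) (N-rename (Injection.to ρ) s))
                         in transport _↓lcc (translated s₂) (to (le D ρ (from (transport _↓lcc (sym (translated s₁)) d))))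

    reflects : N s₁ ≤lcc N s₂ → ContextualPreorder _↓ s₁ s₂
    reflects le C ρ d =
      let F , contextual D π inj pl , eq = N-contextual C
          translated s = trans (eq (rename (Injection.to ρ) s)) (trans (pl _) (cong (plug D)
            (trans (cong (rename π) (N-rename (Injection.to ρ) s)) (rename-∘ (λ _ → refl) (N s)))))
      in from (transport _↓lcc (sym (translated s₂))
           -- The translated context has further binders above its hole, so the names are renamed
           -- once more; injectivity of π keeps them distinct.
           (le D (mk↣ {to = π ∘ Injection.to ρ} (λ e → Injection.injective ρ (inj e))) (transport _↓lcc (translated s₁) (to d))))

  full-abstraction : (n : ℕ) (s₁ s₂ : Exp 𝓛 n) →
                     (s₁ ≤name s₂ ⇔ N s₁ ≤lcc N s₂) × (s₁ ≤LR s₂ ⇔ N W⟦ s₁ ⟧ ≤lcc N W⟦ s₂ ⟧)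
  full-abstraction n s₁ s₂ =
    fully-abstract _↓name name⇒lcc lcc⇒name s₁ s₂ , fully-abstract _↓LR LR⇒lcc (λ {n} {s} → lcc⇒LR {s = s}) s₁ s₂

theorem6p16 : (Sig : Signature) → let open Calculus Sig in
    (n : ℕ) (s₁ s₂ : Exp 𝓛 n) →
    (s₁ ≤name s₂ ⇔ N s₁ ≤lcc N s₂) ×
    (s₁ ≤LR s₂ ⇔ N W⟦ s₁ ⟧ ≤lcc N W⟦ s₂ ⟧)
theorem6p16 = Development.full-abstraction
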